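{- Let $G$ be a $4$-edge-connected graph and $r\in V(G)$. Then $G$ has a chain decomposition rooted at $r$.
   Context: Graphs are multigraphs (parallel edges and loops allowed; a loop adds $2$ to the degree; a loop is a cycle of length one and two parallel edges form a cycle of length two). Paths and cycles are simple. Fix $r\in V(G)$. The degree of a vertex in a subgraph not containing it is $0$. An up chain of $G$ with respect to a pair of edge-disjoint subgraphs $(H,\overline{H})$ is a subgraph of $G$, edge-disjoint from $H$ and $\overline{H}$, which is either (i) a path with at least one edge such that every vertex is either $r$ or has degree at least two in $\overline{H}$, and each end is either $r$ or lies in $H$; or (ii) a cycle such that every vertex is either $r$ or has degree at least two in $\overline{H}$, and some vertex $v$ of it is either $r$ or has degree at least two in $H$ ($v$ is regarded as both ends of the chain, all other vertices as internal). A down chain with respect to $(H,\overline{H})$ is an up chain with respect to $(\overline{H},H)$. A one-way chain with respect to $(H,\overline{H})$ is the subgraph induced by a single edge $e\notin E(H)\cup E(\overline{H})$ with ends $u$ (tail) and $v$ (head) such that $u$ is $r$ or has degree at least two in $H$, and $v$ is $r$ or has degree at least two in $\overline{H}$. A sequence $G_0,\dots,G_m$ of subgraphs of $G$ is a chain decomposition of $G$ rooted at $r$ if, writing $H_i=G_0\cup\cdots\cup G_{i-1}$ and $\overline{H_i}=G_{i+1}\cup\cdots\cup G_m$ (so $H_0$ and $\overline{H_m}$ are the null graph), the sets $E(G_0),\dots,E(G_m)$ partition $E(G)$ and for each $i=0,\dots,m$ the subgraph $G_i$ is an up chain, a down chain, or a one-way chain with respect to $(H_i,\overline{H_i})$.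 -}

module Defs where

open import Data.Nat using (ℕ; zero; suc; _+_; _≤_; _<_; _<ᵇ_)
open import Data.Fin using (Fin; zero; suc; toℕ; inject₁; fromℕ; _≟_)
open import Data.Bool using (Bool; true; false; not; if_then_else_)
open import Data.List using (List; map; allFin)
open import Data.Nat.ListAction using (sum)
open import Data.Product using (Σ; ∃; ∃-syntax; _×_; _,_)
open import Data.Sum using (_⊎_)
open import Relation.Binary.PropositionalEquality using (_≡_)
open import Relation.Nullary using (Dec; yes; no)
open import Relation.Nullary.Decidable using (⌊_⌋)
open import Function using (Injective)
open import Function.Bundles using (_⇔_)

-- Finite multigraphs: vertices Fin n, edges Fin m, each edge has an
-- (unordered, here stored as an ordered pair) pair of ends.  Parallel
-- edges and loops (ends equal) are allowed.

record Graph : Set where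
  field
    n    : ℕ
    m    : ℕ
    ends : Fin m → Fin n × Fin n
open Graph public

V : Graph → Set
V G = Fin (n G)

E : Graph → Set
E G = Fin (m G)

-- Edge-subgraphs: a subset of the edges (vertex set = vertices incident
-- to chosen edges).
EdgeSet : Graph → Set
EdgeSet G = E G → Bool

module _ (G : Graph) where

  Joins : E G → V G → V G → Set
  Joins e a b = ends G e ≡ (a , b) ⊎ ends G e ≡ (b , a)

  [_≟v_] : V G → V G → ℕ
  [ a ≟v b ] = if ⌊ a ≟ b ⌋ then 1 else 0

  endsAt : E G → V G → ℕ
  endsAt e v with ends G e
  ... | (a , b) = [ a ≟v v ] + [ b ≟v v ]

  deg : EdgeSet G → V G → ℕ
  deg H v = sum (map (λ e → if H e then endsAt e v else 0) (allFin (m G)))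

  InSub : EdgeSet G → V G → Set
  InSub H v = ∃[ e ] (H e ≡ true × Σ (V G) λ w → Joins e v w)

  size : EdgeSet G → ℕ
  size F = sum (map (λ e → if F e then 1 else 0) (allFin (m G)))

  data Reach (S : EdgeSet G) : V G → V G → Set where
    here : ∀ {u} → Reach S u u
    step : ∀ {u w v} (e : E G) → S e ≡ true → Joins e u w →
           Reach S w v → Reach S u v

  -- k-edge-connected (Diestel): at least two vertices, and G - F is
  -- connected for every set F of fewer than k edges
  EdgeConnected : ℕ → Set
  EdgeConnected k =
    2 ≤ n G ×
    ((F : EdgeSet G) → size F < k →
      (u v : V G) → Reach (λ e → not (F e)) u v)

  record Trail (S : EdgeSet G) (L : ℕ) : Set where
    field
      ws     : Fin (suc L) → V G
      es     : Fin L → E G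
      es-inj : Injective _≡_ _≡_ es
      es-join : ∀ i → Joins (es i) (ws (inject₁ i)) (ws (suc i))
      es-set : ∀ e → (S e ≡ true) ⇔ (∃[ i ] es i ≡ e)

  record IsPath (S : EdgeSet G) : Set where
    field
      L     : ℕ
      trail : Trail S (suc L)
    open Trail trail public
    field
      ws-inj : Injective _≡_ _≡_ ws

  -- S is a cycle (length ≥ 1; loops and 2-cycles of parallel edges allowed)
  record IsCycle (S : EdgeSet G) : Set where
    field
      L     : ℕ
      trail : Trail S (suc L)
    open Trail trail public
    field
      closed : ws (fromℕ (suc L)) ≡ ws zero
      ws-inj : Injective _≡_ _≡_ (λ (i : Fin (suc L)) → ws (inject₁ i))

  module _ (r : V G) where

    Good : EdgeSet G → V G → Set
    Good H v = v ≡ r ⊎ 2 ≤ deg H v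

    data UpChain (H Hb S : EdgeSet G) : Set where
      path  : (p : IsPath S) →
              (∀ j → Good Hb (IsPath.ws p j)) →
              (IsPath.ws p zero ≡ r ⊎ InSub H (IsPath.ws p zero)) →
              (IsPath.ws p (fromℕ (suc (IsPath.L p))) ≡ r ⊎ InSub H (IsPath.ws p (fromℕ (suc (IsPath.L p))))) →
              UpChain H Hb S
      cycle : (c : IsCycle S) →
              (∀ j → Good Hb (IsCycle.ws c j)) →
              (∃[ j ] Good H (IsCycle.ws c j)) →
              UpChain H Hb S

    DownChain : (H Hb S : EdgeSet G) → Set
    DownChain H Hb S = UpChain Hb H S

    OneWayChain : (H Hb S : EdgeSet G) → Set
    OneWayChain H Hb S =
      ∃[ e ] ((∀ f → (S f ≡ true) ⇔ (f ≡ e)) ×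
        Σ (V G) λ u → Σ (V G) λ v →
          Joins e u v × Good H u × Good Hb v)

    IsChain : (H Hb S : EdgeSet G) → Set
    IsChain H Hb S = UpChain H Hb S ⊎ DownChain H Hb S ⊎ OneWayChain H Hb S

    -- Chain decomposition G_0, ..., G_k: idx assigns each edge to the
    -- unique G_i containing it (so the E(G_i) partition E(G));
    -- H_i = G_0 ∪ ... ∪ G_{i-1}, Hb_i = G_{i+1} ∪ ... ∪ G_k.
    ChainDecomposition : Set
    ChainDecomposition =
      Σ ℕ λ k → Σ (E G → Fin (suc k)) λ idx →
        (i : Fin (suc k)) →
          IsChain (λ e → toℕ (idx e) <ᵇ toℕ i)
                  (λ e → toℕ i <ᵇ toℕ (idx e))
                  (λ e → ⌊ idx e ≟ i ⌋)

{-# OPTIONS --safe #-}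

-- Call a cut tight if it has four edges; by 4-edge-connectivity this is the
-- least possible.  If some edge crosses no tight cut, delete it: a decomposition
-- of the rest leaves a moment at which one end of the edge has degree two in the
-- earlier chains and the other in the later ones, and the edge is put back there
-- as a one-way chain.  Otherwise uncrossing tight cuts yields a vertex x ≠ r of
-- degree four, and x can be split off keeping all cuts of size four (Mader,
-- Lovász), so that the graph arises by pinching two edges of a smaller one at x.
--
-- To lift a decomposition through a pinch, the first of the two edges is routed
-- through x while x has degree two in the later chains, and the second one while
-- x has degree two in the earlier chains.  This fails only for a one-way edge
-- a → b such that b does not occur in an earlier chain, and dually.  Then a → x
-- takes its place, and xb waits for the first later chain through b.
module Submission where

open import Data.Bool using (Bool; true; false; not; if_then_else_; _∧_; _∨_; T)
open import Data.Bool.Properties using (∧-identityʳ; ∧-zeroʳ; ∨-zeroʳ; ∨-identityʳ) renaming (_≟_ to _≟ᵇ_)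
open import Data.Empty using (⊥; ⊥-elim)
open import Data.Fin using (Fin; zero; suc; _≟_; toℕ; inject₁; fromℕ)
open import Data.Fin.Properties using (any?)
open import Data.Fin.Subset.Properties using (anySubset?)
open import Data.List using (List; []; _∷_; _++_; _∷ʳ_; length; map; concat; allFin; lookup)
open import Data.List.Membership.Propositional using (_∈_; _∉_)
open import Data.List.Membership.Propositional.Properties using (∈-allFin; ∈-concat⁻; ∈-concat⁺; ∈-++⁺ˡ; ∈-++⁺ʳ)
open import Data.List.Relation.Binary.Permutation.Propositional using (_↭_; ↭-sym; ↭-trans; ↭-refl; prep; refl;
  ↭⇒↭ₛ) renaming (swap to swap↭)
open import Data.List.Relation.Binary.Permutation.Propositional.Properties using (map⁺; ∈-resp-↭; ++⁺ˡ)
import Data.List.Relation.Binary.Permutation.Setoid.Properties as Permₛ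
open import Data.List.Relation.Binary.Pointwise using (Pointwise; []; _∷_)
open import Data.List.Relation.Unary.All using (All; []; _∷_; decide; universal)
import Data.List.Relation.Unary.All as All
open import Data.List.Relation.Unary.AllPairs using ([]; _∷_)
open import Data.List.Relation.Unary.Any using (Any; here; there; index)
open import Data.List.Relation.Unary.Unique.Propositional using (Unique)
open import Data.List.Relation.Unary.Unique.Propositional.Properties using (allFin⁺)
open import Data.Nat using (ℕ; zero; suc; _+_; _≤_; _<_; z≤n; s≤s; s≤s⁻¹; _≤ᵇ_; _≡ᵇ_; _<ᵇ_)
open import Data.Nat.ListAction using (sum)
open import Data.Nat.ListAction.Properties using (sum-↭)
open import Data.Nat.Properties using (≤-trans; ≤-refl; ≤-reflexive; ≤-antisym; ≰⇒>; ≤ᵇ⇒≤; m≤m+n; m≤n+m; +-mono-≤;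
  +-monoˡ-≤; +-monoʳ-≤; +-assoc; +-identityʳ; +-cancelʳ-≤; +-cancelʳ-≡; _≤?_)
open import Data.Nat.Tactic.RingSolver using (solve-∀)
open import Data.Product using (Σ; _×_; _,_; proj₁; proj₂)
open import Data.Sum using (_⊎_; inj₁; inj₂)
open import Data.Unit using (⊤; tt)
import Data.Vec as Vec
open import Data.Vec.Properties using (lookup∘tabulate)
open import Function using (_∘_; Injective; mk⇔)
open import Function.Bundles using (_⇔_; module Equivalence)
open import Relation.Binary.PropositionalEquality using (_≡_; _≢_; refl; sym; trans; cong; cong₂; subst; setoid)
open import Relation.Nullary using (Dec; yes; no; ¬_)
open import Relation.Nullary.Decidable using (⌊_⌋; _×-dec_)

-- A vertex w other than r with degree at least four in the sequence has degree two on both sides at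
-- some moment: otherwise a single chain through w would lead from at most one earlier edge to at
-- most one later edge, while every vertex of a chain has degree two on one side. Before that moment
-- w keeps degree two in the later chains, after it in the earlier ones; so for two vertices the
-- moment of either one serves both. The wait of xb is harmless because the chains between a → x and
-- the first chain through b avoid b, and none of them sees that b has lost an edge. The difficulty
-- is that the second pinched edge may come before that chain, or that an edge at x has to wait on
-- both sides; hence the case analysis. A vertex that is split off keeps its number and only loses
-- its edges, so connectivity is asked only of sets containing a vertex with an edge. Edges have no
-- names until the end: a family of edges is known by its weight sums, and the edges of the graph
-- are matched to it afterwards.

infixl 6 _:+_

-- Linear inequalities over ℕ by reflection

data Expr : Set where
  # κ : ℕ → Expr
  _:+_ : Expr → Expr → Expr

nth : List ℕ → ℕ → ℕ
nth []      _       = 0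
nth (a ∷ _) zero    = a
nth (_ ∷ ρ) (suc i) = nth ρ i

⟦_⟧ : Expr → List ℕ → ℕ
⟦ # i ⟧   ρ = nth ρ i
⟦ κ n ⟧   ρ = n
⟦ s :+ t ⟧ ρ = ⟦ s ⟧ ρ + ⟦ t ⟧ ρ

coeff : Expr → ℕ → ℕ
coeff (# i)   j with i ≡ᵇ j
... | true  = 1
... | false = 0
coeff (κ n)   j = 0
coeff (s :+ t) j = coeff s j + coeff t j

const : Expr → ℕ
const (# i)   = 0
const (κ n)   = n
const (s :+ t) = const s + const t

times : ℕ → ℕ → ℕ
times zero    a = 0
times (suc n) a = a + times n a

times-+ : ∀ m n a → times (m + n) a ≡ times m a + times n a
times-+ zero    n a = refl
times-+ (suc m) n a rewrite times-+ m n a = sym (+-assoc a (times m a) (times n a))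

times-mono : ∀ {m n} a → m ≤ n → times m a ≤ times n a
times-mono {zero}  a p         = z≤n
times-mono {suc m} a (_≤_.s≤s p) = +-monoʳ-≤ a (times-mono a p)

dot : (ℕ → ℕ) → List ℕ → ℕ
dot c []      = 0
dot c (a ∷ ρ) = times (c 0) a + dot (λ i → c (suc i)) ρ

interchange : ∀ a b c d → (a + b) + (c + d) ≡ (a + c) + (b + d)
interchange = solve-∀

dot-+ : ∀ c d ρ → dot (λ i → c i + d i) ρ ≡ dot c ρ + dot d ρ
dot-+ c d []      = refl
dot-+ c d (a ∷ ρ) rewrite times-+ (c 0) (d 0) a | dot-+ (λ i → c (suc i)) (λ i → d (suc i)) ρ =
  interchange (times (c 0) a) (times (d 0) a) (dot (λ i → c (suc i)) ρ) (dot (λ i → d (suc i)) ρ)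

dot-0 : ∀ ρ → dot (λ _ → 0) ρ ≡ 0
dot-0 []      = refl
dot-0 (a ∷ ρ) = dot-0 ρ

dot-cong : ∀ {c d} → (∀ i → c i ≡ d i) → ∀ ρ → dot c ρ ≡ dot d ρ
dot-cong eq []      = refl
dot-cong eq (a ∷ ρ) = cong₂ _+_ (cong (λ m → times m a) (eq 0)) (dot-cong (λ i → eq (suc i)) ρ)

coeff-#-suc : ∀ i j → coeff (# (suc i)) (suc j) ≡ coeff (# i) j
coeff-#-suc i j with i ≡ᵇ j
... | true  = refl
... | false = refl

dot-# : ∀ i ρ → dot (coeff (# i)) ρ ≡ nth ρ i
dot-# i       []      = refl
dot-# zero    (a ∷ ρ) rewrite dot-0 ρ = trans (+-identityʳ (a + 0)) (+-identityʳ a)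
dot-# (suc i) (a ∷ ρ) = trans (dot-cong (coeff-#-suc i) ρ) (dot-# i ρ)

sound : ∀ ρ t → ⟦ t ⟧ ρ ≡ const t + dot (coeff t) ρ
sound ρ (# i)   = sym (dot-# i ρ)
sound ρ (κ n)   = trans (sym (+-identityʳ n)) (cong (n +_) (sym (dot-0 ρ)))
sound ρ (s :+ t) rewrite sound ρ s | sound ρ t | dot-+ (coeff s) (coeff t) ρ =
  interchange (const s) (dot (coeff s) ρ) (const t) (dot (coeff t) ρ)

below : (ℕ → ℕ) → (ℕ → ℕ) → List ℕ → Bool
below c d []      = true
below c d (_ ∷ ρ) = (c 0 ≤ᵇ d 0) ∧ below (λ i → c (suc i)) (λ i → d (suc i)) ρ

T-∧ : ∀ {p q} → T (p ∧ q) → T p × T q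
T-∧ {true} {true} _ = _ , _

dot-mono : ∀ c d ρ → T (below c d ρ) → dot c ρ ≤ dot d ρ
dot-mono c d []      _ = z≤n
dot-mono c d (a ∷ ρ) p with T-∧ {c 0 ≤ᵇ d 0} p
... | p₀ , p₁ = +-mono-≤ (times-mono a (≤ᵇ⇒≤ (c 0) (d 0) p₀)) (dot-mono _ _ ρ p₁)

-- In lin ρ s t the atoms of both sides are listed in ρ, and # i stands for the
-- i-th of them; via adds a hypothesis l ≤ r to the two sides of the goal.
lin : ∀ ρ s t → {T ((const s ≤ᵇ const t) ∧ below (coeff s) (coeff t) ρ)} → ⟦ s ⟧ ρ ≤ ⟦ t ⟧ ρ
lin ρ s t {p} with T-∧ {const s ≤ᵇ const t} p
... | p₀ , p₁ rewrite sound ρ s | sound ρ t = +-mono-≤ (≤ᵇ⇒≤ (const s) (const t) p₀) (dot-mono (coeff s) (coeff t) ρ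
  p₁)

lin≡ : ∀ ρ s t → {T ((const s ≤ᵇ const t) ∧ below (coeff s) (coeff t) ρ)} →
       {T ((const t ≤ᵇ const s) ∧ below (coeff t) (coeff s) ρ)} → ⟦ s ⟧ ρ ≡ ⟦ t ⟧ ρ
lin≡ ρ s t {p} {q} = ≤-antisym (lin ρ s t {p}) (lin ρ t s {q})

via : ∀ {a b l r} → l ≤ r → a + r ≤ b + l → a ≤ b
via {a} {b} {l} {r} p q = +-cancelʳ-≤ r a b (≤-trans q (+-monoʳ-≤ b p))

via≡ : ∀ {a b l r} → l ≡ r → a + r ≡ b + l → a ≡ b
via≡ {a} {b} {l} {r} refl q = +-cancelʳ-≡ l a b q

via= : ∀ {a b l r} → l ≡ r → a + r ≤ b + l → a ≤ b
via= p = via (≤-reflexive p)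

-- Sequences of chains

module Chains (n : ℕ) where

  Vertex : Set
  Vertex = Fin n

  -- Kept opaque so that `δ` remains an atom of the linear sums instead of unfolding to a decision
  -- of equality.
  opaque
    δ : Vertex → Vertex → ℕ
    δ u v = if ⌊ u ≟ v ⌋ then 1 else 0

    δ-def : ∀ u v → δ u v ≡ (if ⌊ u ≟ v ⌋ then 1 else 0)
    δ-def u v = refl

    δ-refl : ∀ v → δ v v ≡ 1
    δ-refl v with v ≟ v
    ... | yes _ = refl
    ... | no ¬p = ⊥-elim (¬p refl)

    δ-≢ : ∀ {u v} → u ≢ v → δ u v ≡ 0
    δ-≢ {u} {v} u≢v with u ≟ v
    ... | yes p = ⊥-elim (u≢v p)
    ... | no _  = refl

  δ-≡ : ∀ {u v} → u ≡ v → δ u v ≡ 1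
  δ-≡ refl = δ-refl _

  δ≤1 : ∀ u v → δ u v ≤ 1
  δ≤1 u v with u ≟ v
  ... | yes refl = ≤-reflexive (δ-refl u)
  ... | no ¬p    = ≤-trans (≤-reflexive (δ-≢ ¬p)) z≤n

  δ-split : ∀ u v → (u ≡ v) ⊎ (δ u v ≡ 0)
  δ-split u v with u ≟ v
  ... | yes p = inj₁ p
  ... | no ¬p = inj₂ (δ-≢ ¬p)

  absurd : ∀ {A : Set} → 1 ≤ 0 → A
  absurd ()

  absurd₀ : ∀ {m} {A : Set} → suc m ≤ 0 → A
  absurd₀ ()

  1≤-split : ∀ m → (m ≡ 0) ⊎ (1 ≤ m)
  1≤-split zero    = inj₁ refl
  1≤-split (suc m) = inj₂ (s≤s z≤n)

  2≤-split : ∀ m → (m ≤ 1) ⊎ (2 ≤ m)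
  2≤-split zero          = inj₁ z≤n
  2≤-split (suc zero)    = inj₁ (s≤s z≤n)
  2≤-split (suc (suc m)) = inj₂ (s≤s (s≤s z≤n))

  Weight : Set
  Weight = Vertex → Vertex → ℕ

  -- Weights are symmetrised, so that two families of edges agree as multisets of
  -- unordered pairs as soon as all their weight sums agree.
  sw : Weight → Vertex → Vertex → ℕ
  sw f u v = f u v + f v u

  wlk : Weight → Vertex → List Vertex → ℕ
  wlk f c []      = 0
  wlk f c (a ∷ A) = sw f c a + wlk f a A

  -- A walk is stored as its two arms c ∷ A and d ∷ B, read outwards from the
  -- central edge cd, so that any of its edges can be made central.
  data Chain : Set where
    walk : (up : Bool) (c : Vertex) (A : List Vertex) (d : Vertex) (B : List Vertex) → Chain
    one  : Vertex → Vertex → Chain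

  infixr 5 _⋄_

  -- Bracketed concatenation instead of a list: one chain can be replaced by several in place, and
  -- the weights of the parts add up by definition.
  data Seq : Set where
    ε   : Seq
    [_] : Chain → Seq
    _⋄_ : Seq → Seq → Seq

  S₁ : Weight → Chain → ℕ
  S₁ f (walk _ c A d B) = wlk f c A + sw f c d + wlk f d B
  S₁ f (one u v)        = sw f u v

  S : Weight → Seq → ℕ
  S f ε       = 0
  S f [ C ]   = S₁ f C
  S f (P ⋄ Q) = S f P + S f Q

  -- Symmetrised, this weight counts the ends of an edge at `v`, a loop counting twice; hence `D` is
  -- the degree.
  dl : Vertex → Weight
  dl v u _ = δ u v

  D : Seq → Vertex → ℕ
  D T v = S (dl v) T

  end : Vertex → List Vertex → Vertex
  end c []      = c
  end c (a ∷ A) = end a A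

  cnt : List Vertex → Vertex → ℕ
  cnt []      v = 0
  cnt (a ∷ A) v = δ a v + cnt A v

  cn : Vertex → List Vertex → Vertex → ℕ
  cn c A v = δ c v + cnt A v

  Ctx : Set
  Ctx = Vertex → ℕ

  -- h and k are the degrees in the earlier and in the later chains.  The root
  -- is treated by giving it degree two in the outermost contexts.
  record UpOK (h k : Ctx) (c : Vertex) (A : List Vertex) (d : Vertex) (B : List Vertex) : Set where
    constructor mkUp
    field
      good    : ∀ v → 1 ≤ cn c A v + cn d B v → 2 ≤ k v
      ends    : ∀ v → δ (end c A) v + δ (end d B) v ≤ h v
      -- Together with `simpleʳ` this allows a second visit only to a vertex at which both arms end,
      -- so the walk is a path or a cycle; for a cycle `ends` asks for earlier degree two there.
      simpleˡ : ∀ v → cn c A v + cn d B v ≤ 1 + δ (end c A) v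
      simpleʳ : ∀ v → cn c A v + cn d B v ≤ 1 + δ (end d B) v

  open UpOK

  OK : Ctx → Chain → Ctx → Set
  OK h (walk true  c A d B) k = UpOK h k c A d B
  OK h (walk false c A d B) k = UpOK k h c A d B
  OK h (one u v)            k = 2 ≤ h u × 2 ≤ k v

  -- Other chains enter only through their degrees, so a part of a sequence can be checked and
  -- replaced on its own.
  Valid : Ctx → Seq → Ctx → Set
  Valid h ε       k = ⊤
  Valid h [ C ]   k = OK h C k
  Valid h (P ⋄ Q) k = Valid h P (λ v → D Q v + k v) × Valid (λ v → h v + D P v) Q k

  cn-end : ∀ c A v → δ (end c A) v ≤ cn c A v
  cn-end c []      v = lin (δ (end c []) v ∷ []) (# 0) (# 0 :+ κ 0)
  cn-end c (a ∷ A) v = via (cn-end a A v)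
    (lin (δ (end c (a ∷ A)) v ∷ δ a v + cnt A v ∷ δ c v ∷ []) (# 0 :+ # 1) (# 2 :+ # 1 :+ # 0))

  -- Handshake count along a walk: each visit uses two edge ends, except that one is missing at each
  -- end of the walk.
  wlk-deg : ∀ c A v → wlk (dl v) c A + δ c v + δ (end c A) v ≡ cn c A v + cn c A v
  wlk-deg c []      v = lin≡ (δ c v ∷ []) (κ 0 :+ # 0 :+ # 0) (# 0 :+ κ 0 :+ (# 0 :+ κ 0))
  wlk-deg c (a ∷ A) v = via≡ (wlk-deg a A v)
    (lin≡ (δ c v ∷ δ a v ∷ wlk (dl v) a A ∷ δ (end c (a ∷ A)) v ∷ cnt A v ∷ []) (# 0 :+ # 1 :+ # 2 :+ # 0 :+ # 3 :+
    (# 1 :+ # 4 :+ (# 1 :+ # 4))) (# 0 :+ (# 1 :+ # 4) :+ (# 0 :+ (# 1 :+ # 4)) :+ (# 2 :+ # 1 :+ # 3)))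

  cn≤deg : ∀ c A v → cn c A v ≤ wlk (dl v) c A + δ c v
  cn≤deg c A v = via (cn-end c A v) (via= (sym (wlk-deg c A v))
    (lin (δ c v ∷ cnt A v ∷ wlk (dl v) c A ∷ δ (end c A) v ∷ []) (# 0 :+ # 1 :+ (# 0 :+ # 1) :+ (# 2 :+ # 0 :+ # 3))
    (# 2 :+ # 0 :+ # 3 :+ (# 0 :+ # 1 :+ (# 0 :+ # 1)))))

  occ≤D : ∀ u c A d B v → cn c A v + cn d B v ≤ D [ walk u c A d B ] v
  occ≤D u c A d B v = via (cn≤deg c A v) (via (cn≤deg d B v)
    (lin (δ c v ∷ cnt A v ∷ δ d v ∷ cnt B v ∷ wlk (dl v) c A ∷ wlk (dl v) d B ∷ []) (# 0 :+ # 1 :+ (# 2 :+ # 3) :+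
    (# 4 :+ # 0) :+ (# 5 :+ # 2)) (# 4 :+ (# 0 :+ # 2) :+ # 5 :+ (# 0 :+ # 1) :+ (# 2 :+ # 3))))

  D⇒occ : ∀ u c A d B v → 1 ≤ D [ walk u c A d B ] v → 1 ≤ cn c A v + cn d B v
  D⇒occ u c A d B v p with 1≤-split (cn c A v + cn d B v)
  ... | inj₂ q = q
  ... | inj₁ q = absurd (via p (via= (wlk-deg c A v) (via= (wlk-deg d B v) (via= q (via= q (via= q
    (lin (wlk (dl v) c A ∷ δ c v ∷ δ d v ∷ wlk (dl v) d B ∷ cnt A v ∷ cnt B v ∷ δ (end c A) v ∷ δ (end d B) v ∷ [])
    (κ 1 :+ κ 0 :+ (# 0 :+ (# 1 :+ # 2) :+ # 3) :+ (# 1 :+ # 4 :+ (# 1 :+ # 4)) :+ (# 2 :+ # 5 :+ (# 2 :+ # 5)) :+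
    κ 0 :+ κ 0 :+ κ 0) (κ 0 :+ κ 1 :+ (# 0 :+ # 1 :+ # 6) :+ (# 3 :+ # 2 :+ # 7) :+ (# 1 :+ # 4 :+ (# 2 :+ # 5)) :+
    (# 1 :+ # 4 :+ (# 2 :+ # 5)) :+ (# 1 :+ # 4 :+ (# 2 :+ # 5))))))))))

  flipUp : ∀ {h k c A d B} → UpOK h k c A d B → UpOK h k d B c A
  flipUp {h} {k} {c} {A} {d} {B} o = mkUp (λ v p → good o v (via p
    (lin (δ d v + cnt B v ∷ δ c v + cnt A v ∷ []) (κ 1 :+ (# 0 :+ # 1)) (# 1 :+ # 0 :+ κ 1)))) (λ v → via (ends o v)
    (lin (δ (end d B) v ∷ δ (end c A) v ∷ h v ∷ []) (# 0 :+ # 1 :+ # 2) (# 2 :+ (# 1 :+ # 0))))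
    (λ v → via (simpleʳ o v)
      (lin (δ d v + cnt B v ∷ δ c v + cnt A v ∷ δ (end d B) v ∷ []) (# 0 :+ # 1 :+ (κ 1 :+ # 2)) (κ 1 :+ # 2 :+ (# 1
      :+ # 0)))) (λ v → via (simpleˡ o v)
      (lin (δ d v + cnt B v ∷ δ c v + cnt A v ∷ δ (end c A) v ∷ []) (# 0 :+ # 1 :+ (κ 1 :+ # 2)) (κ 1 :+ # 2 :+ (# 1
      :+ # 0))))

  UpOK-mono : ∀ {h k h′ k′ c A d B} →
    (∀ v → 1 ≤ cn c A v + cn d B v → h v ≤ h′ v) → (∀ v → 1 ≤ cn c A v + cn d B v → k v ≤ k′ v) →
    UpOK h k c A d B → UpOK h′ k′ c A d B
  UpOK-mono {h} {h′ = h′} {c = c} {A} {d} {B} p q o =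
    mkUp (λ v i → ≤-trans (good o v i) (q v i)) e (simpleˡ o) (simpleʳ o)
    where
    e : ∀ v → δ (end c A) v + δ (end d B) v ≤ h′ v
    e v with 1≤-split (cn c A v + cn d B v)
    ... | inj₂ i = ≤-trans (ends o v) (p v i)
    ... | inj₁ i = via (cn-end c A v) (via (cn-end d B v) (via= i
      (lin (δ (end c A) v ∷ δ (end d B) v ∷ δ c v + cnt A v ∷ δ d v + cnt B v ∷ h′ v ∷ []) (# 0 :+ # 1 :+ # 2 :+ # 3
      :+ κ 0) (# 4 :+ # 0 :+ # 1 :+ (# 2 :+ # 3)))))

  OK-mono : ∀ {h k h′ k′} C → (∀ v → 1 ≤ D [ C ] v → h v ≤ h′ v) → (∀ v → 1 ≤ D [ C ] v → k v ≤ k′ v) →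
    OK h C k → OK h′ C k′
  OK-mono (walk true c A d B) p q o = UpOK-mono (λ v i → p v (≤-trans i (occ≤D true c A d B v))) (λ v i → q v
    (≤-trans i (occ≤D true c A d B v))) o
  OK-mono (walk false c A d B) p q o = UpOK-mono (λ v i → q v (≤-trans i (occ≤D true c A d B v))) (λ v i → p v
    (≤-trans i (occ≤D true c A d B v))) o
  OK-mono (one u w) p q (i , j) =
    ≤-trans i (p u (via= (sym (δ-refl u)) (lin (δ u u ∷ δ w u ∷ []) (κ 1 :+ # 0) (# 0 :+ # 1 :+ κ 1)))) , ≤-trans j
      (q w (via= (sym (δ-refl w)) (lin (δ w w ∷ δ u w ∷ []) (κ 1 :+ # 0) (# 1 :+ # 0 :+ κ 1))))

  -- Comparing the contexts only on the vertices of `T` is what lets a vertex lose degree while the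
  -- chains that avoid it stay valid.
  Valid-mono : ∀ {h k h′ k′} T → (∀ v → 1 ≤ D T v → h v ≤ h′ v) → (∀ v → 1 ≤ D T v → k v ≤ k′ v) →
    Valid h T k → Valid h′ T k′
  Valid-mono ε       p q _       = tt
  Valid-mono [ C ]   p q o       = OK-mono C p q o
  Valid-mono (P ⋄ Q) p q (o , o′) =
    Valid-mono P (λ v i → p v (≤-trans i (m≤m+n _ _))) (λ v i → +-monoʳ-≤ (D Q v) (q v (≤-trans i (m≤m+n _ _)))) o ,
    Valid-mono Q (λ v i → +-monoˡ-≤ (D P v) (p v (≤-trans i (m≤n+m _ _)))) (λ v i → q v (≤-trans i (m≤n+m _ _))) o′

  Valid-≤ : ∀ {h k h′ k′} T → (∀ v → h v ≤ h′ v) → (∀ v → k v ≤ k′ v) → Valid h T k → Valid h′ T k′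
  Valid-≤ T p q = Valid-mono T (λ v _ → p v) (λ v _ → q v)

  -- Hence no chain passes through a vertex of degree at most one on both sides; this excludes the
  -- bad positions in `no-window` and `one-one`.
  OK-side : ∀ {h k} C v → OK h C k → 1 ≤ D [ C ] v → 2 ≤ h v ⊎ 2 ≤ k v
  OK-side (walk true c A d B)  v o i = inj₂ (good o v (D⇒occ true c A d B v i))
  OK-side (walk false c A d B) v o i = inj₁ (good o v (D⇒occ true c A d B v i))
  OK-side (one u w) v (o , o′) i with δ-split u v | δ-split w v
  ... | inj₁ refl | _         = inj₁ o
  ... | inj₂ _    | inj₁ refl = inj₂ o′
  ... | inj₂ p | inj₂ q = absurd (via i (via= p (via= q
    (lin (δ u v ∷ δ w v ∷ []) (κ 1 :+ κ 0 :+ (# 0 :+ # 1) :+ κ 0 :+ κ 0) (κ 0 :+ κ 1 :+ # 0 :+ # 1)))))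

  -- Half of a walk that is cut at its central edge. It disappears if it has no edge, since a chain
  -- needs one.
  arm : Bool → Vertex → List Vertex → Seq
  arm up c []      = ε
  arm up c (a ∷ A) = [ walk up c [] a A ]

  S-arm : ∀ f up c A → S f (arm up c A) ≡ wlk f c A
  S-arm f up c []      = refl
  S-arm f up c (a ∷ A) = refl

  δ-pair : ∀ (h : Ctx) p q → 1 ≤ h p → 1 ≤ h q → (∀ v → δ p v + δ q v ≤ 1) → ∀ v → δ p v + δ q v ≤ h v
  δ-pair h p q i j le v with δ-split p v | δ-split q v
  ... | inj₁ refl | _ = ≤-trans (le v) i
  ... | inj₂ _ | inj₁ refl = ≤-trans (le v) j
  ... | inj₂ e | inj₂ e′ = via= e (via= e′
    (lin (δ p v ∷ δ q v ∷ h v ∷ []) (# 0 :+ # 1 :+ κ 0 :+ κ 0) (# 2 :+ # 0 :+ # 1)))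

  record ArmOK (h k : Ctx) (c : Vertex) (A : List Vertex) : Set where
    constructor mkArm
    field
      goodᵃ   : ∀ v → 1 ≤ cn c A v → 2 ≤ k v
      start   : 1 ≤ h c
      finish  : 1 ≤ h (end c A)
      simpleᵃ : ∀ v → cn c A v ≤ 1

  open ArmOK

  arm-up : ∀ {h k} c A → ArmOK h k c A → Valid h (arm true c A) k
  arm-up c []          o = tt
  arm-up {h} c (a ∷ A) o = mkUp (λ v i → goodᵃ o v (via i
    (lin (δ c v ∷ δ a v + cnt A v ∷ []) (κ 1 :+ (# 0 :+ κ 0 :+ # 1)) (# 0 :+ # 1 :+ κ 1))))
    (δ-pair h c (end a A) (start o) (finish o) (λ v → via (cn-end a A v) (via (simpleᵃ o v)
      (lin (δ c v ∷ δ (end a A) v ∷ δ a v + cnt A v ∷ []) (# 0 :+ # 1 :+ # 2 :+ κ 1) (κ 1 :+ # 1 :+ (# 0 :+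
      # 2))))))
    (λ v → via (simpleᵃ o v)
      (lin (δ c v ∷ δ a v + cnt A v ∷ []) (# 0 :+ κ 0 :+ # 1 :+ κ 1) (κ 1 :+ # 0 :+ (# 0 :+ # 1)))) (λ v → via
      (simpleᵃ o v)
      (lin (δ c v ∷ δ a v + cnt A v ∷ δ (end a A) v ∷ []) (# 0 :+ κ 0 :+ # 1 :+ κ 1) (κ 1 :+ # 2 :+ (# 0 :+ # 1))))

  arm-down : ∀ {h k} c A → ArmOK k h c A → Valid h (arm false c A) k
  arm-down c []      o = tt
  arm-down c (a ∷ A) o = arm-up c (a ∷ A) o

  Fresh : Vertex → Seq → Set
  Fresh x T = D T x ≤ 0

  -- A repeated vertex of a walk is the end of both arms, and the other arm already accounts for one
  -- of the two visits.
  uniqueˡ : ∀ {h k c A d B} → UpOK h k c A d B → ∀ v → cn c A v ≤ 1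
  uniqueˡ {c = c} {A} {d} {B} o v = via (simpleʳ o v) (via (cn-end d B v)
    (lin (δ c v + cnt A v ∷ δ (end d B) v ∷ δ d v + cnt B v ∷ []) (# 0 :+ (κ 1 :+ # 1) :+ # 2) (κ 1 :+ (# 0 :+ # 2)
    :+ # 1)))

  record Rerouted (x a b : Vertex) (T L : Seq) : Set where
    constructor rerouted
    field
      weigh : ∀ f → S f L + sw f a b ≡ S f T + (sw f x a + sw f x b)

  open Rerouted public

  -- An upward walk takes `x` as a new internal vertex. A downward one would need earlier degree at
  -- `x`, so it falls into its two arms, and the edges to `x` become one-way, directed towards the
  -- later degree of `x`.
  insU : ∀ {h k} x u a A b B → OK h (walk u a A b B) k → Fresh x [ walk u a A b B ] → 2 ≤ k x →
    Σ Seq λ L → Valid h L k × Rerouted x a b [ walk u a A b B ] L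
  insU {h} {k} x true a A b B o fr kx = [ walk true a A x (b ∷ B) ] , mkUp g (ends o) (s _ (simpleˡ o)) (s _
    (simpleʳ o)) , rerouted λ f →
    lin≡ (wlk f a A ∷ f a x ∷ f x a ∷ sw f x b ∷ wlk f b B ∷ sw f a b ∷ []) (# 0 :+ (# 1 :+ # 2) :+ (# 3 :+ # 4) :+
    # 5) (# 0 :+ # 5 :+ # 4 :+ (# 2 :+ # 1 :+ # 3))
    where
    fr′ = ≤-trans (occ≤D true a A b B x) fr
    g : ∀ v → 1 ≤ cn a A v + cn x (b ∷ B) v → 2 ≤ k v
    g v i with δ-split x v
    ... | inj₁ refl = kx
    ... | inj₂ e = good o v (via i (via= e
      (lin (δ a v + cnt A v ∷ δ x v ∷ δ b v + cnt B v ∷ []) (κ 1 :+ (# 0 :+ (# 1 :+ # 2)) :+ κ 0) (# 0 :+ # 2 :+ κ 1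
      :+ # 1))))
    s : ∀ (t : Vertex → ℕ) → (∀ v → cn a A v + cn b B v ≤ 1 + t v) → ∀ v → cn a A v + cn x (b ∷ B) v ≤ 1 + t v
    s t le v with δ-split x v
    ... | inj₁ refl = via fr′ (via= (δ-refl x)
      (lin (δ a v + cnt A v ∷ δ v v ∷ δ b v + cnt B v ∷ t v ∷ []) (# 0 :+ (# 1 :+ # 2) :+ κ 0 :+ κ 1) (κ 1 :+ # 3 :+
      (# 0 :+ # 2) :+ # 1)))
    ... | inj₂ e = via (le v) (via= e
      (lin (δ a v + cnt A v ∷ δ x v ∷ δ b v + cnt B v ∷ t v ∷ []) (# 0 :+ (# 1 :+ # 2) :+ (κ 1 :+ # 3) :+ κ 0) (κ 1
      :+ # 3 :+ (# 0 :+ # 2) :+ # 1)))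
  insU {h} {k} x false a A b B o fr kx =
    -- The arms come first: their new ends `a` and `b` must lie in later chains, and the edges to
    -- `x` provide this.
    arm false a A ⋄ arm false b B ⋄ [ one a x ] ⋄ [ one b x ] ,
    ( arm-down a A (mkArm (λ v i → good o v (via i
      (lin (δ a v + cnt A v ∷ δ b v ∷ cnt B v ∷ []) (κ 1 :+ # 0) (# 0 :+ (# 1 :+ # 2) :+ κ 1)))) (via= (sym (δ-refl
      a)) (lin (δ a a ∷ S (dl a) (arm false b B) ∷ δ x a ∷ δ b a ∷ k a ∷ []) (κ 1 :+ # 0) (# 1 :+ (# 0 :+ # 2 :+
      (# 3 :+ # 2)) :+ # 4 :+ κ 1)))
        (via (ends o (end a A)) (via= (sym (δ-refl (end a A)))
          (lin (k (end a A) ∷ δ (end a A) (end a A) ∷ S (dl (end a A)) (arm false b B) ∷ δ a (end a A) ∷ δ x (end a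
          A) ∷ δ b (end a A) ∷ δ (end b B) (end a A) ∷ []) (κ 1 :+ # 0 :+ # 1) (# 2 :+ (# 3 :+ # 4 :+ (# 5 :+ # 4))
          :+ # 0 :+ (# 1 :+ # 6) :+ κ 1)))) (uniqueˡ o))
    , arm-down b B (mkArm (λ v i → ≤-trans (good o v (via i
      (lin (δ b v + cnt B v ∷ δ a v ∷ cnt A v ∷ []) (κ 1 :+ # 0) (# 1 :+ # 2 :+ # 0 :+ κ 1))))
      (lin (h v ∷ D (arm false a A) v ∷ []) (# 0) (# 0 :+ # 1))) (via= (sym (δ-refl b))
      (lin (δ b b ∷ δ a b ∷ δ x b ∷ k b ∷ []) (κ 1 :+ # 0) (# 1 :+ # 2 :+ (# 0 :+ # 2) :+ # 3 :+ κ 1)))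
        (via (ends o (end b B)) (via= (sym (δ-refl (end b B)))
          (lin (k (end b B) ∷ δ (end b B) (end b B) ∷ δ a (end b B) ∷ δ x (end b B) ∷ δ b (end b B) ∷ δ (end a A)
          (end b B) ∷ []) (κ 1 :+ # 0 :+ # 1) (# 2 :+ # 3 :+ (# 4 :+ # 3) :+ # 0 :+ (# 5 :+ # 1) :+ κ 1)))) (uniqueˡ
          (flipUp o)))
    , (via (good o a (via= (sym (δ-refl a))
      (lin (δ a a ∷ cnt A a ∷ δ b a ∷ cnt B a ∷ []) (κ 1 :+ # 0) (# 0 :+ # 1 :+ (# 2 :+ # 3) :+ κ 1))))
      (lin (h a ∷ D (arm false a A) a ∷ D (arm false b B) a ∷ []) (κ 2 :+ # 0) (# 0 :+ # 1 :+ # 2 :+ κ 2)) , via kx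
      (lin (k x ∷ δ b x ∷ δ x x ∷ []) (κ 2 :+ # 0) (# 1 :+ # 2 :+ # 0 :+ κ 2)))
    , (via (good o b (via= (sym (δ-refl b))
      (lin (δ b b ∷ δ a b ∷ cnt A b ∷ cnt B b ∷ []) (κ 1 :+ # 0) (# 1 :+ # 2 :+ (# 0 :+ # 3) :+ κ 1))))
      (lin (h b ∷ D (arm false a A) b ∷ D (arm false b B) b ∷ δ a b ∷ δ x b ∷ []) (κ 2 :+ # 0) (# 0 :+ # 1 :+ # 2 :+
      (# 3 :+ # 4) :+ κ 2)) , via kx (lin (k x ∷ []) (κ 2 :+ # 0) (# 0 :+ κ 2)))) ,
    rerouted λ f → via≡ (S-arm f false a A) (via≡ (S-arm f false b B)
      (lin≡ (S f (arm false a A) ∷ S f (arm false b B) ∷ f a x ∷ f x a ∷ f b x ∷ f x b ∷ sw f a b ∷ wlk f a A ∷ wlk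
      f b B ∷ []) (# 0 :+ (# 1 :+ (# 2 :+ # 3 :+ (# 4 :+ # 5))) :+ # 6 :+ # 7 :+ # 8) (# 7 :+ # 6 :+ # 8 :+ (# 3 :+
      # 2 :+ (# 5 :+ # 4)) :+ # 0 :+ # 1)))

  -- Pinching two edges

  mirC : Chain → Chain
  mirC (walk u c A d B) = walk (not u) c A d B
  mirC (one u v)        = one v u

  -- Reversing the order exchanges earlier with later and up with down, so every construction has a
  -- dual.
  mir : Seq → Seq
  mir ε       = ε
  mir [ C ]   = [ mirC C ]
  mir (P ⋄ Q) = mir Q ⋄ mir P

  S-mir : ∀ f T → S f (mir T) ≡ S f T
  S-mir f ε                  = refl
  S-mir f [ walk u c A d B ] = refl
  S-mir f [ one u v ]        = lin≡ (f v u ∷ f u v ∷ []) (# 0 :+ # 1) (# 1 :+ # 0)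
  S-mir f (P ⋄ Q) = via≡ (S-mir f P) (via≡ (S-mir f Q)
    (lin≡ (S f (mir Q) ∷ S f (mir P) ∷ S f P ∷ S f Q ∷ []) (# 0 :+ # 1 :+ # 2 :+ # 3) (# 2 :+ # 3 :+ # 1 :+ # 0)))

  OK-mir : ∀ {h k} C → OK h C k → OK k (mirC C) h
  OK-mir (walk true c A d B)  o       = o
  OK-mir (walk false c A d B) o       = o
  OK-mir (one u v)            (p , q) = q , p

  Valid-mir : ∀ {h k} T → Valid h T k → Valid k (mir T) h
  Valid-mir ε       _       = tt
  Valid-mir [ C ]   o       = OK-mir C o
  Valid-mir {h} {k} (P ⋄ Q) (o , o′) =
    Valid-≤ (mir Q) (λ v → ≤-refl) (λ v → via= (sym (S-mir (dl v) P))
      (lin (h v ∷ D P v ∷ S (dl v) (mir P) ∷ []) (# 0 :+ # 1 :+ # 2) (# 2 :+ # 0 :+ # 1))) (Valid-mir Q o′) ,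
    Valid-≤ (mir P) (λ v → via= (sym (S-mir (dl v) Q))
      (lin (D Q v ∷ k v ∷ S (dl v) (mir Q) ∷ []) (# 0 :+ # 1 :+ # 2) (# 1 :+ # 2 :+ # 0))) (λ v → ≤-refl) (Valid-mir
      P o)

  -- Rewriting of sequences

  infix 4 _⟿_

  -- Validity is carried in one direction only, but in all contexts, so that a rewriting step
  -- applies inside a longer sequence.
  record _⟿_ (T T′ : Seq) : Set where
    constructor mk⟿
    field
      weight : ∀ f → S f T ≡ S f T′
      valid  : ∀ {h k} → Valid h T k → Valid h T′ k

  open _⟿_ public

  ⟿-refl : ∀ {T} → T ⟿ T
  ⟿-refl = mk⟿ (λ f → refl) (λ o → o)

  ⟿-trans : ∀ {T T′ T″} → T ⟿ T′ → T′ ⟿ T″ → T ⟿ T″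
  ⟿-trans p q = mk⟿ (λ f → trans (weight p f) (weight q f)) (λ o → valid q (valid p o))

  ⋄-cong : ∀ {P P′ Q Q′} → P ⟿ P′ → Q ⟿ Q′ → P ⋄ Q ⟿ P′ ⋄ Q′
  ⋄-cong {P} {P′} {Q} {Q′} p q = mk⟿ (λ f → cong₂ _+_ (weight p f) (weight q f)) λ {h} {k} (o , o′) →
    Valid-≤ P′ (λ v → ≤-refl) (λ v → via= (weight q (dl v))
      (lin (D Q v ∷ k v ∷ S (dl v) Q′ ∷ []) (# 0 :+ # 1 :+ # 2) (# 2 :+ # 1 :+ # 0))) (valid p o) ,
    Valid-≤ Q′ (λ v → via= (weight p (dl v))
      (lin (h v ∷ D P v ∷ S (dl v) P′ ∷ []) (# 0 :+ # 1 :+ # 2) (# 0 :+ # 2 :+ # 1))) (λ v → ≤-refl) (valid q o′)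

  ⋄-assoc : ∀ P Q R → (P ⋄ Q) ⋄ R ⟿ P ⋄ Q ⋄ R
  ⋄-assoc P Q R = mk⟿ (λ f → lin≡ (S f P ∷ S f Q ∷ S f R ∷ []) (# 0 :+ # 1 :+ # 2) (# 0 :+ (# 1 :+ # 2))) λ {h} {k}
    ((o , o′) , o″) →
    Valid-≤ P (λ v → ≤-refl) (λ v → lin (D Q v ∷ D R v ∷ k v ∷ []) (# 0 :+ (# 1 :+ # 2)) (# 0 :+ # 1 :+ # 2)) o ,
    Valid-≤ Q (λ v → lin (h v + D P v ∷ []) (# 0) (# 0)) (λ v → lin (D R v + k v ∷ []) (# 0) (# 0)) o′ ,
    Valid-≤ R (λ v → lin (h v ∷ S (dl v) P ∷ S (dl v) Q ∷ []) (# 0 :+ (# 1 :+ # 2)) (# 0 :+ # 1 :+ # 2)) (λ v →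
      lin (k v ∷ []) (# 0) (# 0)) o″

  ⋄-ε : ∀ P → P ⟿ ε ⋄ P
  ⋄-ε P = mk⟿ (λ f → refl) λ {h} {k} o → tt , Valid-≤ P (λ v → lin (h v ∷ []) (# 0) (# 0 :+ κ 0)) (λ v → ≤-refl) o

  ⋄-εʳ : ∀ P → P ⟿ P ⋄ ε
  ⋄-εʳ P = mk⟿ (λ f → lin≡ (S f P ∷ []) (# 0) (# 0 :+ κ 0)) λ {h} {k} o → Valid-≤ P (λ v → ≤-refl) (λ v →
    lin (k v ∷ []) (# 0) (κ 0 :+ # 0)) o , tt

  record Split (T : Seq) : Set where
    constructor split
    field
      {before} : Seq
      {at}     : Chain
      {after}  : Seq
      ⟿split   : T ⟿ before ⋄ [ at ] ⋄ after

  open Split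

  splitˡ : ∀ {P} Q → Split P → Split (P ⋄ Q)
  splitˡ Q (split {P₁} {C} {P₂} e) = split
    (⟿-trans (⋄-cong e ⟿-refl) (⟿-trans (⋄-assoc P₁ ([ C ] ⋄ P₂) Q) (⋄-cong ⟿-refl (⋄-assoc [ C ] P₂ Q))))

  ⋄-assoc⁻ : ∀ P Q R → P ⋄ Q ⋄ R ⟿ (P ⋄ Q) ⋄ R
  ⋄-assoc⁻ P Q R = mk⟿ (λ f → lin≡ (S f P ∷ S f Q ∷ S f R ∷ []) (# 0 :+ (# 1 :+ # 2)) (# 0 :+ # 1 :+ # 2)) λ {h} {k}
    (o , o′ , o″) →
    (Valid-≤ P (λ v → ≤-refl) (λ v →
      lin (S (dl v) Q ∷ S (dl v) R ∷ k v ∷ []) (# 0 :+ # 1 :+ # 2) (# 0 :+ (# 1 :+ # 2))) o ,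
    Valid-≤ Q (λ v → lin (h v + D P v ∷ []) (# 0) (# 0)) (λ v → lin (D R v + k v ∷ []) (# 0) (# 0)) o′) ,
    Valid-≤ R (λ v → lin (h v ∷ D P v ∷ D Q v ∷ []) (# 0 :+ # 1 :+ # 2) (# 0 :+ (# 1 :+ # 2))) (λ v →
      lin (k v ∷ []) (# 0) (# 0)) o″

  splitʳ : ∀ P {Q} → Split Q → Split (P ⋄ Q)
  splitʳ P (split {Q₁} {C} {Q₂} e) = split (⟿-trans (⋄-cong ⟿-refl e) (⋄-assoc⁻ P Q₁ ([ C ] ⋄ Q₂)))

  split₁ : ∀ C → Split [ C ]
  split₁ C = split {before = ε} {after = ε} (⟿-trans (⋄-ε [ C ]) (⋄-cong ⟿-refl (⋄-εʳ [ C ])))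

  first-at : ∀ b T → D T b ≡ 0 ⊎ Σ (Split T) λ s → D (before s) b ≡ 0 × 1 ≤ D [ at s ] b
  first-at b ε = inj₁ refl
  first-at b [ C ] with 1≤-split (D [ C ] b)
  ... | inj₁ p = inj₁ p
  ... | inj₂ p = inj₂ (split₁ C , refl , p)
  first-at b (P ⋄ Q) with first-at b P | first-at b Q
  ... | inj₂ (s , p , q) | _        = inj₂ (splitˡ Q s , p , q)
  ... | inj₁ p | inj₁ q             = inj₁ (cong₂ _+_ p q)
  ... | inj₁ p | inj₂ (s , q , q′)  = inj₂ (splitʳ P s , cong₂ _+_ p q , q′)

  last-at : ∀ b T → D T b ≡ 0 ⊎ Σ (Split T) λ s → D (after s) b ≡ 0 × 1 ≤ D [ at s ] b
  last-at b ε = inj₁ refl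
  last-at b [ C ] with 1≤-split (D [ C ] b)
  ... | inj₁ p = inj₁ p
  ... | inj₂ p = inj₂ (split₁ C , refl , p)
  last-at b (P ⋄ Q) with last-at b P | last-at b Q
  ... | _ | inj₂ (s , q , q′)       = inj₂ (splitʳ P s , q , q′)
  ... | inj₁ p | inj₁ q             = inj₁ (cong₂ _+_ p q)
  ... | inj₂ (s , p , p′) | inj₁ q  = inj₂ (splitˡ Q s , cong₂ _+_ p q , p′)

  -- Attaching edges to the new vertex

  insD : ∀ {h k} x u a A b B → OK h (walk u a A b B) k → Fresh x [ walk u a A b B ] → 2 ≤ h x →
    Σ Seq λ L → Valid h L k × Rerouted x a b [ walk u a A b B ] L
  insD x u a A b B o fr hx with insU x (not u) a A b B (OK-mir (walk u a A b B) o) fr hx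
  ... | L , vL , eq = mir L , Valid-mir L vL , rerouted λ f → trans (cong (_+ sw f a b) (S-mir f L)) (weigh eq f)

  ≢-from : ∀ {u v} (t : Ctx) → 1 ≤ t u → t v ≤ 0 → u ≢ v
  ≢-from t p q refl = absurd₀ (≤-trans p q)

  edge-up : ∀ {h k} x b → 2 ≤ k x → 2 ≤ k b → 1 ≤ h x → 1 ≤ h b → x ≢ b → UpOK h k x [] b []
  edge-up {h} {k} x b kx kb hx hb ne = mkUp g (δ-pair h x b hx hb e) (λ v → via (δ≤1 b v)
    (lin (δ x v ∷ δ b v ∷ []) (# 0 :+ κ 0 :+ (# 1 :+ κ 0) :+ κ 1) (κ 1 :+ # 0 :+ # 1))) (λ v → via (δ≤1 x v)
    (lin (δ x v ∷ δ b v ∷ []) (# 0 :+ κ 0 :+ (# 1 :+ κ 0) :+ κ 1) (κ 1 :+ # 1 :+ # 0)))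
    where
    g : ∀ v → 1 ≤ cn x [] v + cn b [] v → 2 ≤ k v
    g v i with δ-split x v | δ-split b v
    ... | inj₁ refl | _ = kx
    ... | inj₂ _ | inj₁ refl = kb
    ... | inj₂ p | inj₂ q = absurd (via i (via= p (via= q
      (lin (δ x v ∷ δ b v ∷ []) (κ 1 :+ κ 0 :+ (# 0 :+ κ 0 :+ (# 1 :+ κ 0)) :+ κ 0 :+ κ 0) (κ 0 :+ κ 1 :+ # 0 :+
      # 1)))))
    e : ∀ v → δ x v + δ b v ≤ 1
    e v with δ-split x v
    ... | inj₁ refl = via (δ≤1 x x) (via= (δ-≢ {b} {x} (λ q → ne (sym q)))
      (lin (δ v v ∷ δ b v ∷ []) (# 0 :+ # 1 :+ κ 1 :+ κ 0) (κ 1 :+ # 0 :+ # 1)))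
    ... | inj₂ p = via= p (via (δ≤1 b v) (lin (δ x v ∷ δ b v ∷ []) (# 0 :+ # 1 :+ κ 0 :+ κ 1) (κ 1 :+ # 0 :+ # 1)))

  -- The conditions depend on the walk as a whole and not on the choice of its central edge.
  shift : ∀ {h k c a A d B} → UpOK h k c (a ∷ A) d B → UpOK h k a A c (d ∷ B)
  shift {c = c} {a} {A} {d} {B} o = mkUp (λ v i → good o v (via i
    (lin (δ a v + cnt A v ∷ δ c v ∷ δ d v + cnt B v ∷ []) (κ 1 :+ (# 0 :+ (# 1 :+ # 2))) (# 1 :+ # 0 :+ # 2 :+
    κ 1)))) (ends o) (λ v → via (simpleˡ o v)
    (lin (δ a v + cnt A v ∷ δ c v ∷ δ d v + cnt B v ∷ δ (end c (a ∷ A)) v ∷ []) (# 0 :+ (# 1 :+ # 2) :+ (κ 1 :+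
    # 3)) (κ 1 :+ # 3 :+ (# 1 :+ # 0 :+ # 2)))) (λ v → via (simpleʳ o v)
    (lin (δ a v + cnt A v ∷ δ c v ∷ δ d v + cnt B v ∷ δ (end d B) v ∷ []) (# 0 :+ (# 1 :+ # 2) :+ (κ 1 :+ # 3)) (κ 1
    :+ # 3 :+ (# 1 :+ # 0 :+ # 2))))

  leftmost : ∀ {h k} c A d B → UpOK h k c A d B → Σ Vertex λ d′ → Σ (List Vertex) λ B′ →
    UpOK h k (end c A) [] d′ B′ × end d′ B′ ≡ end d B ×
    (∀ f → S f [ walk true (end c A) [] d′ B′ ] ≡ S f [ walk true c A d B ])
  leftmost c []      d B o = d , B , o , refl , λ f → refl
  leftmost c (a ∷ A) d B o with leftmost a A c (d ∷ B) (shift o)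
  ... | d′ , B′ , o′ , e , eq = d′ , B′ , o′ , e , λ f → via≡ (eq f)
    (lin≡ (sw f (end a A) d′ + wlk f d′ B′ ∷ wlk f a A ∷ f a c ∷ f c a ∷ sw f c d ∷ wlk f d B ∷ []) (# 0 :+ (# 1 :+
    (# 2 :+ # 3) :+ (# 4 :+ # 5))) (# 3 :+ # 2 :+ # 1 :+ # 4 :+ # 5 :+ # 0))

  -- `b` may lose an earlier edge because it stops being an end. As `h b` is at most one, the walk
  -- is not closed at `b`, so its prolongation to the fresh vertex `x` is a path.
  extend : ∀ {h k h′ k′ x b d B} → UpOK h k b [] d B → h b ≤ 1 → cn b [] x + cn d B x ≤ 0 →
    (∀ v → h v ≤ h′ v + δ b v) → (∀ v → k v ≤ k′ v) → 1 ≤ h′ x → 2 ≤ k′ x → UpOK h′ k′ x [] b (d ∷ B)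
  extend {h} {k} {h′} {k′} {x} {b} {d} {B} o hb fr hh kk hx kx = mkUp g e sl sr
    where
    g : ∀ v → 1 ≤ cn x [] v + cn b (d ∷ B) v → 2 ≤ k′ v
    g v i with δ-split x v
    ... | inj₁ refl = kx
    ... | inj₂ p = ≤-trans (good o v (via i (via= p
      (lin (δ x v ∷ δ b v ∷ δ d v + cnt B v ∷ []) (κ 1 :+ (# 0 :+ κ 0 :+ (# 1 :+ # 2)) :+ κ 0) (# 1 :+ κ 0 :+ # 2 :+
      κ 1 :+ # 0))))) (kk v)
    eb : δ (end d B) b ≤ 0
    eb = via (ends o b) (via hb (via= (sym (δ-refl b))
      (lin (δ (end d B) b ∷ h b ∷ δ b b ∷ []) (# 0 :+ # 1 :+ κ 1 :+ # 2) (κ 0 :+ (# 2 :+ # 0) :+ # 1 :+ κ 1))))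
    e : ∀ v → δ x v + δ (end d B) v ≤ h′ v
    e v with δ-split x v
    ... | inj₁ refl = via (cn-end d B x) (via fr (via hx (via (δ≤1 x x)
      (lin (δ v v ∷ δ (end d B) v ∷ δ d v + cnt B v ∷ h′ v ∷ δ b v ∷ []) (# 0 :+ # 1 :+ # 2 :+ κ 0 :+ # 3 :+ κ 1)
      (# 3 :+ # 1 :+ (# 4 :+ κ 0 :+ # 2) :+ κ 1 :+ # 0)))))
    ... | inj₂ p with δ-split b v
    ... | inj₁ refl = via= p (via eb
      (lin (δ x v ∷ δ (end d B) v ∷ h′ v ∷ []) (# 0 :+ # 1 :+ κ 0 :+ κ 0) (# 2 :+ # 0 :+ # 1)))
    ... | inj₂ q = via= p (via= q (via (ends o v) (via (hh v)
      (lin (δ x v ∷ δ (end d B) v ∷ h v ∷ h′ v ∷ δ b v ∷ []) (# 0 :+ # 1 :+ κ 0 :+ κ 0 :+ # 2 :+ (# 3 :+ # 4)) (# 3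
      :+ # 0 :+ # 4 :+ (# 4 :+ # 1) :+ # 2)))))
    old : ∀ v → cn b [] v + cn d B v ≤ 1
    old v with δ-split b v
    ... | inj₁ refl = via (simpleʳ o b) (via eb
      (lin (δ v v ∷ δ d v + cnt B v ∷ δ (end d B) v ∷ []) (# 0 :+ κ 0 :+ # 1 :+ (κ 1 :+ # 2) :+ κ 0) (κ 1 :+ (# 0 :+
      κ 0 :+ # 1) :+ # 2)))
    ... | inj₂ q = via (simpleˡ o v) (via= q
      (lin (δ b v ∷ δ d v + cnt B v ∷ []) (# 0 :+ κ 0 :+ # 1 :+ (κ 1 :+ # 0) :+ κ 0) (κ 1 :+ (# 0 :+ κ 0 :+ # 1) :+
      # 0)))
    sl : ∀ v → cn x [] v + cn b (d ∷ B) v ≤ 1 + δ x v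
    sl v = via (old v)
      (lin (δ x v ∷ δ b v ∷ δ d v + cnt B v ∷ []) (# 0 :+ κ 0 :+ (# 1 :+ # 2) :+ κ 1) (κ 1 :+ # 0 :+ (# 1 :+ κ 0 :+
      # 2)))
    sr : ∀ v → cn x [] v + cn b (d ∷ B) v ≤ 1 + δ (end d B) v
    sr v with δ-split x v
    ... | inj₁ refl = via fr (via (δ≤1 x x)
      (lin (δ v v ∷ δ b v ∷ δ d v + cnt B v ∷ δ (end d B) v ∷ []) (# 0 :+ κ 0 :+ (# 1 :+ # 2) :+ κ 0 :+ κ 1) (κ 1 :+
      # 3 :+ (# 1 :+ κ 0 :+ # 2) :+ # 0)))
    ... | inj₂ p = via (simpleʳ o v) (via= p
      (lin (δ x v ∷ δ b v ∷ δ d v + cnt B v ∷ δ (end d B) v ∷ []) (# 0 :+ κ 0 :+ (# 1 :+ # 2) :+ (κ 1 :+ # 3) :+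
      κ 0) (κ 1 :+ # 3 :+ (# 1 :+ κ 0 :+ # 2) :+ # 0)))

  -- A chain W through b, where b has degree at most one before, either ends at b
  -- and is prolonged to x, or makes b available as an end of a new chain xb.
  attach : ∀ {h k h′ k′} x {b} W → OK h W k → 1 ≤ D [ W ] b → h b ≤ 1 → Fresh x [ W ] →
    (∀ v → h v ≤ h′ v + δ b v) → (∀ v → k v ≤ k′ v) → 1 ≤ h′ x → 2 ≤ k′ x →
    Σ Seq λ L → Valid h′ L k′ × (∀ f → S f L ≡ S f [ W ] + sw f x b)
  attach {h} {k} {h′} {k′} x {b} (one u w) (p , q) i hb fr hh kk hx kx =
    [ one u w ] ⋄ [ walk true x [] b [] ] ,
    ((p′ , ≤-trans (≤-trans q (kk w)) (m≤n+m _ _)) , edge-up x b kx kb (via hx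
      (lin (h′ x ∷ δ u x ∷ δ w x ∷ []) (κ 1 :+ # 0) (# 0 :+ (# 1 :+ # 2) :+ κ 1))) (via i
      (lin (δ u b + δ w b ∷ h′ b ∷ []) (κ 1 :+ # 0) (# 1 :+ # 0 :+ κ 1))) (λ e → ne (sym e))) , λ f →
      lin≡ (sw f u w ∷ sw f x b ∷ []) (# 0 :+ (# 1 :+ κ 0)) (# 0 :+ # 1)
    where
    ne : b ≢ x
    ne = ≢-from (D [ one u w ]) i fr
    -- A tail has earlier degree two, so `b` can only be the head.
    bu : b ≢ u
    bu refl = absurd (via p (via hb (lin (h b ∷ []) (κ 1 :+ κ 0 :+ # 0 :+ κ 1) (κ 0 :+ κ 2 :+ # 0))))
    p′ : 2 ≤ h′ u
    p′ = via p (via (hh u) (via= (δ-≢ bu)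
      (lin (h u ∷ h′ u ∷ δ b u ∷ []) (κ 2 :+ # 0 :+ (# 1 :+ # 2) :+ κ 0) (# 1 :+ κ 2 :+ # 0 :+ # 2))))
    kb : 2 ≤ k′ b
    kb with δ-split w b
    ... | inj₁ refl = ≤-trans q (kk w)
    ... | inj₂ e = absurd (via i (via= e (via= (δ-≢ (λ e → bu (sym e)))
      (lin (δ u b ∷ δ w b ∷ []) (κ 1 :+ κ 0 :+ (# 0 :+ # 1) :+ κ 0 :+ κ 0) (κ 0 :+ κ 1 :+ # 1 :+ # 0)))))
  attach {h} {k} {h′} {k′} x {b} (walk false c A d B) o i hb = absurd (via (good o _ (D⇒occ false c A d B _ i)) (via
    hb (lin (h b ∷ []) (κ 1 :+ κ 0 :+ # 0 :+ κ 1) (κ 0 :+ κ 2 :+ # 0))))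
  attach {h} {k} {h′} {k′} x {b} W@(walk true c A d B) o i hb fr hh kk hx kx with end c A ≟ b | end d B ≟ b
  -- A cycle based at `b` would need earlier degree two there.
  ... | yes p | yes q = absurd (via (ends o b) (via hb (via= (sym (δ-≡ p)) (via= (sym (δ-≡ q))
    (lin (h b ∷ δ (end c A) b ∷ δ (end d B) b ∷ []) (κ 1 :+ κ 0 :+ # 0 :+ κ 1 :+ # 1 :+ # 2) (κ 0 :+ (# 1 :+ # 2) :+
    # 0 :+ κ 1 :+ κ 1))))))
  ... | yes refl | no _ with leftmost c A d B o
  ...   | d′ , B′ , o′ , e , eq = [ walk true x [] (end c A) (d′ ∷ B′) ] ,
          extend o′ hb (≤-trans (occ≤D true (end c A) [] d′ B′ x) (via= (eq (dl x)) (via fr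
            (lin (δ (end c A) x + δ d′ x + wlk (dl x) d′ B′ ∷ wlk (dl x) c A + (dl x c d + dl x d c) + wlk (dl x) d
            B ∷ []) (# 0 :+ # 1 :+ κ 0) (κ 0 :+ # 0 :+ # 1))))) hh kk hx kx , λ f → via≡ (eq f)
            (lin≡ (sw f x (end c A) ∷ sw f (end c A) d′ + wlk f d′ B′ ∷ wlk f c A + sw f c d + wlk f d B ∷ []) (# 0
            :+ # 1 :+ # 2) (# 2 :+ # 0 :+ # 1))
  attach {h} {k} {h′} {k′} x {b} W@(walk true c A d B) o i hb fr hh kk hx kx | no _ | yes refl with leftmost d B c A
    (flipUp o)
  ...   | d′ , B′ , o′ , e , eq = [ walk true x [] (end d B) (d′ ∷ B′) ] ,
          extend o′ hb (≤-trans (occ≤D true (end d B) [] d′ B′ x) (via= (eq (dl x)) (via fr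
            (lin (δ (end d B) x + δ d′ x + wlk (dl x) d′ B′ ∷ wlk (dl x) d B ∷ dl x d c ∷ dl x c d ∷ wlk (dl x) c A
            ∷ []) (# 0 :+ (# 1 :+ (# 2 :+ # 3) :+ # 4) :+ κ 0) (κ 0 :+ # 0 :+ (# 4 :+ (# 3 :+ # 2) :+ # 1)))))) hh
            kk hx kx , λ f → via≡ (eq f)
            (lin≡ (sw f x (end d B) ∷ sw f (end d B) d′ + wlk f d′ B′ ∷ wlk f d B ∷ f d c ∷ f c d ∷ wlk f c A ∷ [])
            (# 0 :+ # 1 :+ (# 2 :+ (# 3 :+ # 4) :+ # 5)) (# 5 :+ (# 4 :+ # 3) :+ # 2 :+ # 0 :+ # 1))
  attach {h} {k} {h′} {k′} x {b} W@(walk true c A d B) o i hb fr hh kk hx kx | no p | no q =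
    [ W ] ⋄ [ walk true x [] b [] ] ,
    (mkUp (λ v j → via (good o v j) (via (kk v)
      (lin (k v ∷ k′ v ∷ δ x v ∷ δ b v ∷ []) (κ 2 :+ # 0 :+ # 1) (# 2 :+ # 3 :+ κ 0 :+ # 1 :+ κ 2 :+ # 0)))) e
      (simpleˡ o) (simpleʳ o) ,
     edge-up x b kx (≤-trans (good o b (D⇒occ true c A d B b i)) (kk b)) (via hx
       (lin (h′ x ∷ wlk (dl x) c A ∷ δ c x ∷ δ d x ∷ wlk (dl x) d B ∷ []) (κ 1 :+ # 0) (# 0 :+ (# 1 :+ (# 2 :+ # 3)
       :+ # 4) :+ κ 1))) (via i
       (lin (wlk (dl b) c A + (δ c b + δ d b) + wlk (dl b) d B ∷ h′ b ∷ []) (κ 1 :+ # 0) (# 1 :+ # 0 :+ κ 1))) (λ e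
       → ne (sym e))) , λ f →
       lin≡ (wlk f c A + sw f c d + wlk f d B ∷ sw f x b ∷ []) (# 0 :+ (# 1 :+ κ 0)) (# 0 :+ # 1)
    where
    ne : b ≢ x
    ne = ≢-from (D [ W ]) i fr
    e : ∀ v → δ (end c A) v + δ (end d B) v ≤ h′ v
    e v with δ-split b v
    ... | inj₁ refl = via= (δ-≢ p) (via= (δ-≢ q)
      (lin (δ (end c A) v ∷ δ (end d B) v ∷ h′ v ∷ []) (# 0 :+ # 1 :+ κ 0 :+ κ 0) (# 2 :+ # 0 :+ # 1)))
    ... | inj₂ z = via (ends o v) (via (hh v) (via= z
      (lin (δ (end c A) v + δ (end d B) v ∷ h v ∷ h′ v ∷ δ b v ∷ []) (# 0 :+ # 1 :+ (# 2 :+ # 3) :+ κ 0) (# 2 :+ # 0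
      :+ # 1 :+ # 3))))

  attachᵐ : ∀ {h k h′ k′} x {b} W → OK h W k → 1 ≤ D [ W ] b → k b ≤ 1 → Fresh x [ W ] →
    (∀ v → h v ≤ h′ v) → (∀ v → k v ≤ k′ v + δ b v) → 2 ≤ h′ x → 1 ≤ k′ x →
    Σ Seq λ L → Valid h′ L k′ × (∀ f → S f L ≡ S f [ W ] + sw f x b)
  attachᵐ x {b} W o i kb fr hh kk hx kx with
    attach x (mirC W) (OK-mir W o) (≤-trans i (≤-reflexive (sym (S-mir (dl b) [ W ])))) kb
      (≤-trans (≤-reflexive (S-mir (dl x) [ W ])) fr) kk hh kx hx
  ... | L , vL , eq = mir L , Valid-mir L vL , λ f → trans (S-mir f L) (trans (eq f) (cong (_+ sw f x b) (S-mir f [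
    W ])))

  -- Cuts a walk at its edge cd and lets x, already the end of one earlier edge,
  -- take over both halves and the edge xb.
  breakUp : ∀ {h k h′ k′ x b} c C d E → UpOK h k c C d E → h b ≤ 1 → Fresh x [ walk true c C d E ] →
    (∀ v → h v ≤ h′ v + δ b v) → (∀ v → k v ≤ k′ v) → 1 ≤ h′ x → 2 ≤ k b → end d E ≢ b →
    Σ Seq λ L → Valid h′ L k′ × (∀ f → S f L + sw f c d ≡ S f [ walk true c C d E ] + (sw f x c + sw f x d + sw f x
      b))
  breakUp {h} {k} {h′} {k′} {x} {b} c C d E o hb fr hh kk hx kb e≢b =
    -- The first piece may end at `x` because of its one earlier edge, and the next two chains are
    -- the later degree of `x`. After this piece `x` has earlier degree two, as the one-way edges
    -- require. The other half may start at `c`, which `x → c` has put into an earlier chain.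
    [ walk true x [] d E ] ⋄ [ one x c ] ⋄ [ one x b ] ⋄ arm true c C ,
    ( mkUp g e (λ v → via (uE v) (lin (δ x v ∷ δ d v + cnt E v ∷ []) (# 0 :+ κ 0 :+ # 1 :+ κ 1) (κ 1 :+ # 0 :+
      # 1))) s
    , (via hx (via= (sym (δ-refl x))
      (lin (h′ x ∷ δ x x ∷ δ d x ∷ wlk (dl x) d E ∷ []) (κ 2 :+ # 0 :+ # 1) (# 0 :+ (# 1 :+ # 2 :+ # 3) :+ κ 1 :+
      κ 1))) , via (kgood c (via= (sym (δ-refl c))
      (lin (δ c c ∷ cnt C c ∷ δ d c ∷ cnt E c ∷ []) (κ 1 :+ # 0) (# 0 :+ # 1 :+ (# 2 :+ # 3) :+ κ 1)))) (via (kk c)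
      (lin (k c ∷ k′ c ∷ δ x c ∷ δ b c ∷ S (dl c) (arm true c C) ∷ []) (κ 2 :+ # 0 :+ # 1) (# 2 :+ # 3 :+ # 4 :+ # 1
      :+ κ 2 :+ # 0))))
    , (via hx (via= (sym (δ-refl x))
      (lin (h′ x ∷ δ x x ∷ δ d x ∷ wlk (dl x) d E ∷ δ c x ∷ []) (κ 2 :+ # 0 :+ # 1) (# 0 :+ (# 1 :+ # 2 :+ # 3) :+
      (# 1 :+ # 4) :+ κ 1 :+ κ 1))) , via kb (via (kk b)
      (lin (k b ∷ k′ b ∷ D (arm true c C) b ∷ []) (κ 2 :+ # 0 :+ # 1) (# 2 :+ # 1 :+ κ 2 :+ # 0))))
    , arm-up c C (mkArm (λ v i → ≤-trans (kgood v (via i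
      (lin (δ c v + cnt C v ∷ δ d v ∷ cnt E v ∷ []) (κ 1 :+ # 0) (# 0 :+ (# 1 :+ # 2) :+ κ 1)))) (kk v)) (via= (sym
      (δ-refl c))
      (lin (δ c c ∷ h′ c ∷ δ x c ∷ δ d c ∷ wlk (dl c) d E ∷ δ b c ∷ []) (κ 1 :+ # 0) (# 1 :+ (# 2 :+ # 3 :+ # 4) :+
      (# 2 :+ # 0) :+ (# 2 :+ # 5) :+ κ 1))) fin (uniqueˡ o))) ,
    λ f → via≡ (S-arm f true c C)
      (lin≡ (sw f x d ∷ wlk f d E ∷ sw f x c ∷ sw f x b ∷ S f (arm true c C) ∷ sw f c d ∷ wlk f c C ∷ []) (# 0 :+
      # 1 :+ (# 2 :+ (# 3 :+ # 4)) :+ # 5 :+ # 6) (# 6 :+ # 5 :+ # 1 :+ (# 2 :+ # 0 :+ # 3) :+ # 4))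
    where
    fr′ = ≤-trans (occ≤D true c C d E x) fr
    kgood = good o
    uE = uniqueˡ (flipUp o)
    g : ∀ v → 1 ≤ cn x [] v + cn d E v → 2 ≤ D ([ one x c ] ⋄ [ one x b ] ⋄ arm true c C) v + k′ v
    g v i with δ-split x v
    ... | inj₁ refl = via= (sym (δ-refl x)) (via= (sym (δ-refl x))
      (lin (δ v v ∷ δ c v ∷ δ b v ∷ S (dl v) (arm true c C) ∷ k′ v ∷ []) (κ 2 :+ # 0 :+ # 0) (# 0 :+ # 1 :+ (# 0 :+
      # 2 :+ # 3) :+ # 4 :+ κ 1 :+ κ 1)))
    ... | inj₂ p = via (kgood v (via i (via= p
      (lin (δ x v ∷ δ d v + cnt E v ∷ δ c v ∷ cnt C v ∷ []) (κ 1 :+ (# 0 :+ κ 0 :+ # 1) :+ κ 0) (# 2 :+ # 3 :+ # 1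
      :+ κ 1 :+ # 0))))) (via (kk v)
      (lin (k v ∷ k′ v ∷ δ x v ∷ δ c v ∷ δ b v ∷ S (dl v) (arm true c C) ∷ []) (κ 2 :+ # 0 :+ # 1) (# 2 :+ # 3 :+
      (# 2 :+ # 4 :+ # 5) :+ # 1 :+ κ 2 :+ # 0)))
    e : ∀ v → δ x v + δ (end d E) v ≤ h′ v
    e v with δ-split x v
    ... | inj₁ refl = via (cn-end d E x) (via fr′ (via hx (via (δ≤1 x x)
      (lin (δ v v ∷ δ (end d E) v ∷ δ d v + cnt E v ∷ h′ v ∷ δ c v ∷ cnt C v ∷ []) (# 0 :+ # 1 :+ # 2 :+ κ 0 :+ # 3
      :+ κ 1) (# 3 :+ # 1 :+ (# 4 :+ # 5 :+ # 2) :+ κ 1 :+ # 0)))))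
    ... | inj₂ p with δ-split b v
    -- `b` may have lost its earlier edge and so cannot serve as an end of the first piece.
    ... | inj₁ refl = via= p (via= (δ-≢ e≢b)
      (lin (δ x v ∷ δ (end d E) v ∷ h′ v ∷ []) (# 0 :+ # 1 :+ κ 0 :+ κ 0) (# 2 :+ # 0 :+ # 1)))
    ... | inj₂ q = via= p (via= q (via (ends o v) (via (hh v)
      (lin (δ x v ∷ δ (end d E) v ∷ h v ∷ h′ v ∷ δ b v ∷ δ (end c C) v ∷ []) (# 0 :+ # 1 :+ κ 0 :+ κ 0 :+ # 2 :+
      (# 3 :+ # 4)) (# 3 :+ # 0 :+ # 4 :+ (# 5 :+ # 1) :+ # 2)))))
    s : ∀ v → cn x [] v + cn d E v ≤ 1 + δ (end d E) v
    s v with δ-split x v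
    ... | inj₁ refl = via fr′ (via (δ≤1 x x)
      (lin (δ v v ∷ δ d v + cnt E v ∷ δ (end d E) v ∷ δ c v ∷ cnt C v ∷ []) (# 0 :+ κ 0 :+ # 1 :+ κ 0 :+ κ 1) (κ 1
      :+ # 2 :+ (# 3 :+ # 4 :+ # 1) :+ # 0)))
    ... | inj₂ p = via= p (via (uE v)
      (lin (δ x v ∷ δ d v + cnt E v ∷ δ (end d E) v ∷ []) (# 0 :+ κ 0 :+ # 1 :+ κ 0 :+ κ 1) (κ 1 :+ # 2 :+ # 0 :+
      # 1)))
    fin : 1 ≤ ((h′ (end c C) + D [ walk true x [] d E ] (end c C)) + D [ one x c ] (end c C)) + D [ one x b ] (end c
      C)
    fin with δ-split b (end c C)
    -- If this half ends at `b`, the edge `x → b` just before it replaces the lost one.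
    ... | inj₁ p = via= (sym (δ-≡ p))
      (lin (δ b (end c C) ∷ h′ (end c C) ∷ δ x (end c C) ∷ δ d (end c C) ∷ wlk (λ u z → δ u (end c C)) d E ∷ δ c
      (end c C) ∷ []) (κ 1 :+ # 0) (# 1 :+ (# 2 :+ # 3 :+ # 4) :+ (# 2 :+ # 5) :+ (# 2 :+ # 0) :+ κ 1))
    ... | inj₂ q = via (ends o (end c C)) (via (hh (end c C)) (via= q (via= (sym (δ-refl (end c C)))
      (lin (h (end c C) ∷ h′ (end c C) ∷ δ b (end c C) ∷ δ (end c C) (end c C) ∷ δ x (end c C) ∷ δ d (end c C) ∷ wlk
      (λ u z → δ u (end c C)) d E ∷ δ c (end c C) ∷ δ (end d E) (end c C) ∷ []) (κ 1 :+ # 0 :+ (# 1 :+ # 2) :+ κ 0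
      :+ # 3) (# 1 :+ (# 4 :+ # 5 :+ # 6) :+ (# 4 :+ # 7) :+ (# 4 :+ # 2) :+ (# 3 :+ # 8) :+ # 0 :+ # 2 :+ κ 1)))))

  -- For the case that no chain through `b` lies between the one-way edge and this walk. An upward
  -- walk has a half that does not end at `b`, since closing at `b` needs earlier degree two; a
  -- downward walk avoids `b` altogether.
  breakAt : ∀ {h k h′ k′} x {b} u c C d E → OK h (walk u c C d E) k → h b ≤ 1 → Fresh x [ walk u c C d E ] →
    (∀ v → h v ≤ h′ v + δ b v) → (∀ v → k v ≤ k′ v) → 1 ≤ h′ x → 2 ≤ D [ walk u c C d E ] b + k b →
    Σ Seq λ L → Valid h′ L k′ × (∀ f → S f L + sw f c d ≡ S f [ walk u c C d E ] + (sw f x c + sw f x d + sw f x b))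
  breakAt {h} {k} {h′} {k′} x {b} u c C d E o hb fr hh kk hx kb with 1≤-split (D [ walk u c C d E ] b)
  breakAt {h} {k} {h′} {k′} x {b} true c C d E o hb fr hh kk hx kb | dec = go (end d E ≟ b) (end c C ≟ b)
    where
    kb′ : (D [ walk true c C d E ] b ≡ 0) ⊎ (1 ≤ D [ walk true c C d E ] b) → 2 ≤ k b
    kb′ (inj₁ p) = via kb (via= p
      (lin (wlk (dl b) c C + (δ c b + δ d b) + wlk (dl b) d E ∷ k b ∷ []) (κ 2 :+ (# 0 :+ # 1) :+ κ 0) (# 1 :+ κ 2
      :+ # 0)))
    kb′ (inj₂ p) = good o b (D⇒occ true c C d E b p)
    go : _ → _ → Σ Seq λ L → Valid h′ L k′ × (∀ f → S f L + sw f c d ≡ S f [ walk true c C d E ] + (sw f x c + sw f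
      x d + sw f x b))
    go (no p) _ = breakUp c C d E o hb fr hh kk hx (kb′ dec) p
    go (yes p) (yes q) = absurd (via (ends o b) (via hb (via= (sym (δ-≡ p)) (via= (sym (δ-≡ q))
      (lin (h b ∷ δ (end d E) b ∷ δ (end c C) b ∷ []) (κ 1 :+ κ 0 :+ # 0 :+ κ 1 :+ # 1 :+ # 2) (κ 0 :+ (# 2 :+ # 1)
      :+ # 0 :+ κ 1 :+ κ 1))))))
    go (yes _) (no q) with breakUp d E c C (flipUp o) hb (via fr
      (lin (wlk (dl x) d E ∷ δ d x ∷ δ c x ∷ wlk (dl x) c C ∷ []) (# 0 :+ (# 1 :+ # 2) :+ # 3 :+ κ 0) (κ 0 :+ (# 3
      :+ (# 2 :+ # 1) :+ # 0)))) hh kk hx (kb′ dec) q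
    ... | L , vL , eq = L , vL , λ f → via≡ (eq f)
      (lin≡ (S f L ∷ f c d ∷ f d c ∷ wlk f d E ∷ wlk f c C ∷ sw f x d ∷ sw f x c ∷ sw f x b ∷ []) (# 0 :+ (# 1 :+
      # 2) :+ (# 3 :+ (# 2 :+ # 1) :+ # 4 :+ (# 5 :+ # 6 :+ # 7))) (# 4 :+ (# 1 :+ # 2) :+ # 3 :+ (# 6 :+ # 5 :+
      # 7) :+ (# 0 :+ (# 2 :+ # 1))))
  breakAt {h} {k} {h′} {k′} x {b} false c C d E o hb fr hh kk hx kb | inj₂ p =
    absurd (via (good o _ (D⇒occ false c C d E _ p)) (via hb
      (lin (h b ∷ []) (κ 1 :+ κ 0 :+ # 0 :+ κ 1) (κ 0 :+ κ 2 :+ # 0))))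
  breakAt {h} {k} {h′} {k′} x {b} false c C d E o hb fr hh kk hx kb | inj₁ p =
    -- `c → x` gives `x` the second earlier edge that the downward half from `x` needs, and `x → b`
    -- is the later edge that lets this half end at `x`.
    arm false c C ⋄ [ one c x ] ⋄ [ walk false x [] d E ] ⋄ [ one x b ] ,
    ( arm-down c C (mkArm (λ v i → hgood v (via i
      (lin (δ c v + cnt C v ∷ δ d v ∷ cnt E v ∷ []) (κ 1 :+ # 0) (# 0 :+ (# 1 :+ # 2) :+ κ 1)))) (via= (sym (δ-refl
      c)) (lin (δ c c ∷ δ x c ∷ δ d c ∷ wlk (dl c) d E ∷ δ b c ∷ k′ c ∷ []) (κ 1 :+ # 0) (# 0 :+ # 1 :+ (# 1 :+ # 2
      :+ # 3 :+ (# 1 :+ # 4)) :+ # 5 :+ κ 1)))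
        (via (ends o (end c C)) (via (kk (end c C)) (via= (sym (δ-refl (end c C)))
          (lin (k (end c C) ∷ k′ (end c C) ∷ δ (end c C) (end c C) ∷ δ c (end c C) ∷ δ x (end c C) ∷ δ d (end c C) ∷
          wlk (λ u z → δ u (end c C)) d E ∷ δ b (end c C) ∷ δ (end d E) (end c C) ∷ []) (κ 1 :+ # 0 :+ # 1 :+ # 2)
          (# 3 :+ # 4 :+ (# 4 :+ # 5 :+ # 6 :+ (# 4 :+ # 7)) :+ # 1 :+ (# 2 :+ # 8) :+ # 0 :+ κ 1))))) (uniqueˡ o))
    , (via (hgood c (via= (sym (δ-refl c))
      (lin (δ c c ∷ cnt C c ∷ δ d c ∷ cnt E c ∷ []) (κ 1 :+ # 0) (# 0 :+ # 1 :+ (# 2 :+ # 3) :+ κ 1))))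
      (lin (h′ c ∷ D (arm false c C) c ∷ []) (κ 2 :+ # 0) (# 0 :+ # 1 :+ κ 2)) , via= (sym (δ-refl x)) (via= (sym
      (δ-refl x))
      (lin (δ x x ∷ δ d x ∷ wlk (dl x) d E ∷ δ b x ∷ k′ x ∷ []) (κ 2 :+ # 0 :+ # 0) (# 0 :+ # 1 :+ # 2 :+ (# 0 :+
      # 3) :+ # 4 :+ κ 1 :+ κ 1))))
    , mkUp g (λ v → via (ends o v) (via (kk v)
      (lin (δ (end x []) v ∷ δ (end d E) v ∷ k v ∷ k′ v ∷ δ b v ∷ δ (end c C) v ∷ []) (# 0 :+ # 1 :+ # 2 :+ # 3)
      (# 0 :+ # 4 :+ # 3 :+ (# 5 :+ # 1) :+ # 2)))) (λ v → via (uE v)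
      (lin (δ x v ∷ δ d v + cnt E v ∷ []) (# 0 :+ κ 0 :+ # 1 :+ κ 1) (κ 1 :+ # 0 :+ # 1))) s
    , (via hx (via= (sym (δ-refl x)) (via= (sym (δ-refl x))
      (lin (h′ x ∷ δ x x ∷ D (arm false c C) x ∷ δ c x ∷ δ d x ∷ wlk (dl x) d E ∷ []) (κ 2 :+ # 0 :+ # 1 :+ # 1)
      (# 0 :+ # 2 :+ (# 3 :+ # 1) :+ (# 1 :+ # 4 :+ # 5) :+ κ 1 :+ κ 1 :+ κ 1)))) , via kb (via= p (via (kk b)
      (lin (wlk (dl b) c C + (δ c b + δ d b) + wlk (dl b) d E ∷ k b ∷ k′ b ∷ []) (κ 2 :+ (# 0 :+ # 1) :+ κ 0 :+ # 2)
      (# 2 :+ κ 2 :+ # 0 :+ # 1)))))) ,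
    λ f → via≡ (S-arm f false c C)
      (lin≡ (S f (arm false c C) ∷ f c x ∷ f x c ∷ sw f x d ∷ wlk f d E ∷ sw f x b ∷ sw f c d ∷ wlk f c C ∷ []) (# 0
      :+ (# 1 :+ # 2 :+ (# 3 :+ # 4 :+ # 5)) :+ # 6 :+ # 7) (# 7 :+ # 6 :+ # 4 :+ (# 2 :+ # 1 :+ # 3 :+ # 5) :+
      # 0))
    where
    fr′ = ≤-trans (occ≤D false c C d E x) fr
    uE = uniqueˡ (flipUp o)
    hgood : ∀ v → 1 ≤ cn c C v + cn d E v → 2 ≤ h′ v
    hgood v i with δ-split b v
    ... | inj₁ refl = absurd (via i (via (occ≤D false c C d E b) (via= p
      (lin (δ c v ∷ cnt C v ∷ δ d v ∷ cnt E v ∷ wlk (dl v) c C ∷ wlk (dl v) d E ∷ []) (κ 1 :+ κ 0 :+ (# 0 :+ # 1 :+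
      (# 2 :+ # 3)) :+ (# 4 :+ (# 0 :+ # 2) :+ # 5) :+ κ 0) (κ 0 :+ κ 1 :+ (# 0 :+ # 1 :+ (# 2 :+ # 3)) :+ (# 4 :+
      (# 0 :+ # 2) :+ # 5))))))
    ... | inj₂ q = via (good o v i) (via (hh v) (via= q
      (lin (h v ∷ h′ v ∷ δ b v ∷ []) (κ 2 :+ # 0 :+ (# 1 :+ # 2) :+ κ 0) (# 1 :+ κ 2 :+ # 0 :+ # 2))))
    g : ∀ v → 1 ≤ cn x [] v + cn d E v → 2 ≤ (h′ v + D (arm false c C) v) + D [ one c x ] v
    g v i with δ-split x v
    ... | inj₁ refl = via hx (via= (sym (δ-refl x))
      (lin (h′ v ∷ δ v v ∷ S (dl v) (arm false c C) ∷ δ c v ∷ []) (κ 2 :+ # 0 :+ # 1) (# 0 :+ # 2 :+ (# 3 :+ # 1) :+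
      κ 1 :+ κ 1)))
    ... | inj₂ q = via (hgood v (via i (via= q
      (lin (δ x v ∷ δ d v + cnt E v ∷ δ c v ∷ cnt C v ∷ []) (κ 1 :+ (# 0 :+ κ 0 :+ # 1) :+ κ 0) (# 2 :+ # 3 :+ # 1
      :+ κ 1 :+ # 0)))))
      (lin (h′ v ∷ S (dl v) (arm false c C) ∷ δ c v ∷ δ x v ∷ []) (κ 2 :+ # 0) (# 0 :+ # 1 :+ (# 2 :+ # 3) :+ κ 2))
    s : ∀ v → cn x [] v + cn d E v ≤ 1 + δ (end d E) v
    s v with δ-split x v
    ... | inj₁ refl = via fr′ (via (δ≤1 x x)
      (lin (δ v v ∷ δ d v + cnt E v ∷ δ (end d E) v ∷ δ c v ∷ cnt C v ∷ []) (# 0 :+ κ 0 :+ # 1 :+ κ 0 :+ κ 1) (κ 1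
      :+ # 2 :+ (# 3 :+ # 4 :+ # 1) :+ # 0)))
    ... | inj₂ q = via= q (via (uE v)
      (lin (δ x v ∷ δ d v + cnt E v ∷ δ (end d E) v ∷ []) (# 0 :+ κ 0 :+ # 1 :+ κ 0 :+ κ 1) (κ 1 :+ # 2 :+ # 0 :+
      # 1)))

  -- Two pinched edges in different chains

  Pinched : Ctx → Ctx → Seq → (a b c d x : Vertex) → Set
  Pinched h k M a b c d x = Σ Seq λ M′ → Valid h M′ k ×
    (∀ f → S f M′ + (sw f a b + sw f c d) ≡ S f M + (sw f x a + sw f x b + (sw f x c + sw f x d)))

  Rerouted-D : ∀ {x a b T L} → Rerouted x a b T L → ∀ v → D T v + (δ x v + δ x v) ≤ D L v
  Rerouted-D {x} {a} {b} {U} {L} eq v = via= (sym (weigh eq (dl v)))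
    (lin (D U v ∷ δ x v ∷ S (dl v) L ∷ δ a v ∷ δ b v ∷ []) (# 0 :+ (# 1 :+ # 1) :+ (# 2 :+ (# 3 :+ # 4))) (# 2 :+
    (# 0 :+ (# 1 :+ # 3 :+ (# 1 :+ # 4)))))

  -- The two edges that `x` receives in one walk are the degree two that the rerouting of the other
  -- walk asks for.
  walk-walk : ∀ {h k x} u a A b B Q u′ c C d E → Valid h ([ walk u a A b B ] ⋄ Q ⋄ [ walk u′ c C d E ]) k →
    Fresh x ([ walk u a A b B ] ⋄ Q ⋄ [ walk u′ c C d E ]) →
    Pinched h k ([ walk u a A b B ] ⋄ Q ⋄ [ walk u′ c C d E ]) a b c d x
  walk-walk {h} {k} {x} u a A b B Q u′ c C d E (o₁ , vQ , o₂) fr with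
    -- The later context anticipates the other rerouting as two more edge ends at `x`; `Rerouted-D`
    -- confirms this afterwards.
    insU {k = λ v → (D Q v + D [ walk u′ c C d E ] v) + k v + (δ x v + δ x v)} x u a A b B
      (OK-mono (walk u a A b B) (λ v _ → ≤-refl) (λ v _ →
        lin (S (dl v) Q + (wlk (dl v) c C + (δ c v + δ d v) + wlk (dl v) d E) + k v ∷ δ x v ∷ []) (# 0) (# 0 :+ (# 1
        :+ # 1))) o₁) (via fr
        (lin (wlk (dl x) a A + (δ a x + δ b x) + wlk (dl x) b B ∷ S (dl x) Q ∷ wlk (dl x) c C ∷ δ c x ∷ δ d x ∷ wlk
        (dl x) d E ∷ []) (# 0 :+ κ 0) (κ 0 :+ (# 0 :+ (# 1 :+ (# 2 :+ (# 3 :+ # 4) :+ # 5))))))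
      (via= (sym (δ-refl x)) (via= (sym (δ-refl x))
        (lin (δ x x ∷ D Q x ∷ wlk (dl x) c C ∷ δ c x ∷ δ d x ∷ wlk (dl x) d E ∷ k x ∷ []) (κ 2 :+ # 0 :+ # 0) (# 1
        :+ (# 2 :+ (# 3 :+ # 4) :+ # 5) :+ # 6 :+ (# 0 :+ # 0) :+ κ 1 :+ κ 1))))
    | insD {h = λ v → (h v + D [ walk u a A b B ] v) + D Q v + (δ x v + δ x v)} x u′ c C d E
      (OK-mono (walk u′ c C d E) (λ v _ →
        lin (h v + (wlk (dl v) a A + (δ a v + δ b v) + wlk (dl v) b B) + D Q v ∷ δ x v ∷ []) (# 0) (# 0 :+ (# 1 :+
        # 1))) (λ v _ → ≤-refl) o₂) (via fr
        (lin (wlk (dl x) c C + (δ c x + δ d x) + wlk (dl x) d E ∷ wlk (dl x) a A ∷ δ a x ∷ δ b x ∷ wlk (dl x) b B ∷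
        S (dl x) Q ∷ []) (# 0 :+ κ 0) (κ 0 :+ (# 1 :+ (# 2 :+ # 3) :+ # 4 :+ (# 5 :+ # 0)))))
      (via= (sym (δ-refl x)) (via= (sym (δ-refl x))
        (lin (δ x x ∷ h x ∷ wlk (dl x) a A ∷ δ a x ∷ δ b x ∷ wlk (dl x) b B ∷ D Q x ∷ []) (κ 2 :+ # 0 :+ # 0) (# 1
        :+ (# 2 :+ (# 3 :+ # 4) :+ # 5) :+ # 6 :+ (# 0 :+ # 0) :+ κ 1 :+ κ 1))))
  ... | L , vL , eqL | R , vR , eqR = L ⋄ Q ⋄ R ,
    ( Valid-≤ L (λ v → ≤-refl) (λ v → via (Rerouted-D eqR v)
      (lin (S (dl v) Q ∷ wlk (dl v) c C + (δ c v + δ d v) + wlk (dl v) d E ∷ k v ∷ δ x v + δ x v ∷ D R v ∷ []) (# 0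
      :+ # 1 :+ # 2 :+ # 3 :+ # 4) (# 0 :+ # 4 :+ # 2 :+ (# 1 :+ # 3)))) vL
    , Valid-≤ Q (λ v → via (Rerouted-D eqL v)
      (lin (h v ∷ wlk (dl v) a A + (δ a v + δ b v) + wlk (dl v) b B ∷ D L v ∷ δ x v ∷ []) (# 0 :+ # 1 :+ # 2) (# 0
      :+ # 2 :+ (# 1 :+ (# 3 :+ # 3))))) (λ v → via (Rerouted-D eqR v)
      (lin (wlk (dl v) c C + (δ c v + δ d v) + wlk (dl v) d E ∷ k v ∷ D R v ∷ δ x v ∷ []) (# 0 :+ # 1 :+ # 2) (# 2
      :+ # 1 :+ (# 0 :+ (# 3 :+ # 3))))) vQ
    , Valid-≤ R (λ v → via (Rerouted-D eqL v)
      (lin (h v ∷ wlk (dl v) a A + (δ a v + δ b v) + wlk (dl v) b B ∷ S (dl v) Q ∷ δ x v + δ x v ∷ D L v ∷ []) (# 0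
      :+ # 1 :+ # 2 :+ # 3 :+ # 4) (# 0 :+ # 4 :+ # 2 :+ (# 1 :+ # 3)))) (λ v → ≤-refl) vR) ,
    λ f → via≡ (weigh eqL f) (via≡ (weigh eqR f)
      (lin≡ (S f L ∷ S f Q ∷ S f R ∷ sw f a b ∷ sw f c d ∷ wlk f a A ∷ wlk f b B ∷ sw f x a + sw f x b ∷ wlk f c C ∷
      wlk f d E ∷ sw f x c + sw f x d ∷ []) (# 0 :+ (# 1 :+ # 2) :+ (# 3 :+ # 4) :+ (# 5 :+ # 3 :+ # 6 :+ # 7) :+
      (# 8 :+ # 4 :+ # 9 :+ # 10)) (# 5 :+ # 3 :+ # 6 :+ (# 1 :+ (# 8 :+ # 4 :+ # 9)) :+ (# 7 :+ # 10) :+ (# 0 :+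
      # 3) :+ (# 2 :+ # 4))))

  δ≤0 : ∀ {u v} → u ≢ v → δ u v ≤ 0
  δ≤0 p = ≤-reflexive (δ-≢ p)

  avoids : ∀ {b v} T → D T b ≡ 0 → 1 ≤ D T v → b ≢ v
  avoids T p i refl = absurd (≤-trans i (≤-reflexive p))

  one-walk : ∀ {h k x} a b Q u c C d E → Valid h ([ one a b ] ⋄ Q ⋄ [ walk u c C d E ]) k →
    Fresh x ([ one a b ] ⋄ Q ⋄ [ walk u c C d E ]) →
    Pinched h k ([ one a b ] ⋄ Q ⋄ [ walk u c C d E ]) a b c d x
  one-walk {h} {k} {x} a b Q u c C d E ((ha , kb) , vQ , o) fr = go (1≤-split (h b)) (first-at b Q)
    where
    W = walk u c C d E
    x≢b : x ≢ b
    x≢b e = absurd (via fr (via= (sym (δ-≡ (sym e)))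
      (lin (δ b x ∷ δ a x ∷ S (dl x) Q ∷ wlk (dl x) c C ∷ δ c x ∷ δ d x ∷ wlk (dl x) d E ∷ []) (κ 1 :+ κ 0 :+ κ 0 :+
      # 0) (κ 0 :+ (# 1 :+ # 0 :+ (# 2 :+ (# 3 :+ (# 4 :+ # 5) :+ # 6))) :+ κ 1))))
    x1 = ≤-reflexive (sym (δ-refl x))
    ins : Σ Seq λ L → Valid (λ v → (h v + (δ a v + δ b v)) + D Q v + (δ x v + δ x v)) L k × Rerouted x c d [ W ] L
    ins = insD x u c C d E (OK-mono W (λ v _ →
      lin (h v + (δ a v + δ b v) + D Q v ∷ δ x v ∷ []) (# 0) (# 0 :+ (# 1 :+ # 1))) (λ v _ → ≤-refl) o) (via fr
      (lin (wlk (dl x) c C + (δ c x + δ d x) + wlk (dl x) d E ∷ δ a x ∷ δ b x ∷ S (dl x) Q ∷ []) (# 0 :+ κ 0) (κ 0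
      :+ (# 1 :+ # 2 :+ (# 3 :+ # 0))))) (via x1 (via x1
      (lin (δ x x ∷ h x ∷ δ a x ∷ δ b x ∷ D Q x ∷ []) (κ 2 :+ # 0 :+ # 0) (# 1 :+ (# 2 :+ # 3) :+ # 4 :+ (# 0 :+
      # 0) :+ κ 1 :+ κ 1))))
    L = proj₁ ins
    vL = proj₁ (proj₂ ins)
    eqL = proj₂ (proj₂ ins)
    L≥ = Rerouted-D eqL
    go : _ → _ → Pinched h k ([ one a b ] ⋄ Q ⋄ [ walk u c C d E ]) a b c d x
    -- `b` lies in an earlier chain, so the edge `xb` can follow `a → x` at once as an upward path.
    go (inj₂ hb) _ = [ one a x ] ⋄ [ walk true x [] b [] ] ⋄ Q ⋄ L ,
      ( (ha , via (L≥ x) (via x1 (via x1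
        (lin (D (proj₁ ins) x ∷ δ x x ∷ δ b x ∷ S (dl x) Q ∷ k x ∷ wlk (dl x) c C ∷ δ c x ∷ δ d x ∷ wlk (dl x) d E ∷
        []) (κ 2 :+ # 0 :+ # 1 :+ # 1) (# 1 :+ # 2 :+ κ 0 :+ (# 3 :+ # 0) :+ # 4 :+ (# 5 :+ (# 6 :+ # 7) :+ # 8 :+
        (# 1 :+ # 1)) :+ κ 1 :+ κ 1)))))
      , edge-up x b (via (L≥ x) (via x1 (via x1
        (lin (D (proj₁ ins) x ∷ δ x x ∷ S (dl x) Q ∷ k x ∷ wlk (dl x) c C ∷ δ c x ∷ δ d x ∷ wlk (dl x) d E ∷ [])
        (κ 2 :+ # 0 :+ # 1 :+ # 1) (# 2 :+ # 0 :+ # 3 :+ (# 4 :+ (# 5 :+ # 6) :+ # 7 :+ (# 1 :+ # 1)) :+ κ 1 :+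
        κ 1))))) (via (L≥ b) (via kb
        (lin (D (proj₁ ins) b ∷ S (dl b) Q ∷ wlk (dl b) c C + (δ c b + δ d b) + wlk (dl b) d E ∷ k b ∷ δ x b ∷ [])
        (κ 2 :+ # 0 :+ (# 1 :+ # 2 :+ # 3)) (# 1 :+ # 0 :+ # 3 :+ (# 2 :+ (# 4 :+ # 4)) :+ κ 2)))) (via x1
        (lin (δ x x ∷ h x ∷ δ a x ∷ []) (κ 1 :+ # 0) (# 1 :+ (# 2 :+ # 0) :+ κ 1))) (via hb
        (lin (h b ∷ δ a b ∷ δ x b ∷ []) (κ 1 :+ # 0) (# 0 :+ (# 1 :+ # 2) :+ κ 1))) x≢b
      , Valid-≤ Q (λ v →
        lin (h v ∷ δ a v ∷ δ b v ∷ δ x v ∷ []) (# 0 :+ (# 1 :+ # 2)) (# 0 :+ (# 1 :+ # 3) :+ (# 3 :+ # 2 :+ κ 0)))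
        (λ v → via (L≥ v)
        (lin (wlk (dl v) c C + (δ c v + δ d v) + wlk (dl v) d E ∷ k v ∷ D (proj₁ ins) v ∷ δ x v ∷ []) (# 0 :+ # 1 :+
        # 2) (# 2 :+ # 1 :+ (# 0 :+ (# 3 :+ # 3))))) vQ
      , Valid-≤ L (λ v →
        lin (h v ∷ δ a v ∷ δ b v ∷ D Q v ∷ δ x v ∷ []) (# 0 :+ (# 1 :+ # 2) :+ # 3 :+ (# 4 :+ # 4)) (# 0 :+ (# 1 :+
        # 4) :+ (# 4 :+ # 2 :+ κ 0) :+ # 3)) (λ v → ≤-refl) vL) ,
      λ f → via≡ (weigh eqL f)
        (lin≡ (f a x ∷ f x a ∷ sw f x b ∷ S f Q ∷ S f L ∷ sw f a b ∷ sw f c d ∷ wlk f c C ∷ wlk f d E ∷ sw f x c +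
        sw f x d ∷ []) (# 0 :+ # 1 :+ (# 2 :+ κ 0 :+ (# 3 :+ # 4)) :+ (# 5 :+ # 6) :+ (# 7 :+ # 6 :+ # 8 :+ # 9))
        (# 5 :+ (# 3 :+ (# 7 :+ # 6 :+ # 8)) :+ (# 1 :+ # 0 :+ # 2 :+ # 9) :+ (# 4 :+ # 6)))
    -- No chain before the walk lets `xb` in, so the walk itself is broken to make room for it.
    go (inj₁ hb) (inj₁ q0) with breakAt {h = λ v → (h v + D [ one a b ] v) + D Q v} {h′ = λ v → (h v + D [ one a x ]
      v) + D Q v} {k′ = k} x u c C d E o
        (via= hb (via= q0 (via (δ≤0 a≢b) (via (δ≤1 b b)
          (lin (h b ∷ δ a b ∷ δ b b ∷ D Q b ∷ []) (# 0 :+ (# 1 :+ # 2) :+ # 3 :+ κ 0 :+ κ 0 :+ κ 0 :+ κ 1) (κ 1 :+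
          # 0 :+ # 3 :+ # 1 :+ # 2)))))) (via fr
          (lin (wlk (dl x) c C + (δ c x + δ d x) + wlk (dl x) d E ∷ δ a x ∷ δ b x ∷ S (dl x) Q ∷ []) (# 0 :+ κ 0)
          (κ 0 :+ (# 1 :+ # 2 :+ (# 3 :+ # 0))))) (λ v →
          lin (h v ∷ δ a v ∷ δ b v ∷ D Q v ∷ δ x v ∷ []) (# 0 :+ (# 1 :+ # 2) :+ # 3) (# 0 :+ (# 1 :+ # 4) :+ # 3 :+
          # 2)) (λ v → ≤-refl) (via x1
          (lin (δ x x ∷ h x ∷ δ a x ∷ D Q x ∷ []) (κ 1 :+ # 0) (# 1 :+ (# 2 :+ # 0) :+ # 3 :+ κ 1)))
        (via kb (via= q0
          (lin (S (dl b) Q ∷ wlk (dl b) c C + (δ c b + δ d b) + wlk (dl b) d E ∷ k b ∷ []) (κ 2 :+ (# 0 :+ # 1 :+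
          # 2) :+ κ 0) (# 1 :+ # 2 :+ κ 2 :+ # 0))))
      where
      -- The tail has earlier degree two and the head none, so `a → b` is not a loop and leaves `b`
      -- with earlier degree one.
      a≢b : a ≢ b
      a≢b = ≢-from h (via ha (lin (h a ∷ []) (κ 1 :+ # 0) (# 0 :+ κ 2))) (≤-reflexive hb)
    ... | R , vR , eqR = [ one a x ] ⋄ Q ⋄ R ,
      ( (ha , via= (sym (eqR (dl x))) (via x1 (via x1 (via x1
        (lin (S (dl x) R ∷ dl x c d ∷ dl x d c ∷ δ x x ∷ S (dl x) Q ∷ k x ∷ wlk (dl x) c C ∷ wlk (dl x) d E ∷ dl x b
        x ∷ []) (κ 2 :+ (# 0 :+ (# 1 :+ # 2)) :+ # 3 :+ # 3 :+ # 3) (# 4 :+ # 0 :+ # 5 :+ (# 6 :+ (# 1 :+ # 2) :+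
        # 7 :+ (# 3 :+ # 1 :+ (# 3 :+ # 2) :+ (# 3 :+ # 8))) :+ κ 1 :+ κ 1 :+ κ 1))))))
      , Valid-mono Q (λ v i → via (δ≤0 (avoids Q q0 i))
        (lin (h v ∷ δ a v ∷ δ b v ∷ δ x v ∷ []) (# 0 :+ (# 1 :+ # 2) :+ κ 0) (# 0 :+ (# 1 :+ # 3) :+ # 2))) (λ v i →
        via= (sym (eqR (dl v)))
        (lin (wlk (dl v) c C ∷ δ c v ∷ δ d v ∷ wlk (dl v) d E ∷ k v ∷ S (dl v) R ∷ dl v x c ∷ dl v b x ∷ []) (# 0 :+
        (# 1 :+ # 2) :+ # 3 :+ # 4 :+ (# 5 :+ (# 1 :+ # 2))) (# 5 :+ # 4 :+ (# 0 :+ (# 1 :+ # 2) :+ # 3 :+ (# 6 :+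
        # 1 :+ (# 6 :+ # 2) :+ (# 6 :+ # 7)))))) vQ
      , vR) ,
      λ f → via≡ (eqR f)
        (lin≡ (f a x ∷ f x a ∷ S f Q ∷ S f R ∷ sw f a b ∷ sw f c d ∷ wlk f c C ∷ wlk f d E ∷ sw f x c + sw f x d ∷
        sw f x b ∷ []) (# 0 :+ # 1 :+ (# 2 :+ # 3) :+ (# 4 :+ # 5) :+ (# 6 :+ # 5 :+ # 7 :+ (# 8 :+ # 9))) (# 4 :+
        (# 2 :+ (# 6 :+ # 5 :+ # 7)) :+ (# 1 :+ # 0 :+ # 9 :+ # 8) :+ (# 3 :+ # 5)))
    go (inj₁ hb) (inj₂ (split {Q₁} {X} {Q₂} e , q0 , i)) = found (valid e vQ)
      where
      a≢b : a ≢ b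
      a≢b = ≢-from h (via ha (lin (h a ∷ []) (κ 1 :+ # 0) (# 0 :+ κ 2))) (≤-reflexive hb)
      found : Valid (λ v → h v + D [ one a b ] v) (Q₁ ⋄ [ X ] ⋄ Q₂) (λ v → D [ W ] v + k v) → Pinched h k ([ one a b
        ] ⋄ Q ⋄ [ walk u c C d E ]) a b c d x
      found (v₁ , oX , v₂) with attach {h′ = λ v → (h v + D [ one a x ] v) + D Q₁ v} {k′ = λ v → (D Q₂ v + D L v) +
        k v} x X oX i
        (via= hb (via= q0 (via (δ≤0 a≢b) (via (δ≤1 b b)
          (lin (h b ∷ δ a b ∷ δ b b ∷ D Q₁ b ∷ []) (# 0 :+ (# 1 :+ # 2) :+ # 3 :+ κ 0 :+ κ 0 :+ κ 0 :+ κ 1) (κ 1 :+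
          # 0 :+ # 3 :+ # 1 :+ # 2)))))) (via fr (via= (sym (weight e (dl x)))
          (lin (D [ X ] x ∷ S (dl x) Q ∷ δ a x ∷ δ b x ∷ wlk (dl x) c C ∷ δ c x ∷ δ d x ∷ wlk (dl x) d E ∷ S (dl x)
          Q₁ ∷ S (dl x) Q₂ ∷ []) (# 0 :+ κ 0 :+ # 1) (κ 0 :+ (# 2 :+ # 3 :+ (# 1 :+ (# 4 :+ (# 5 :+ # 6) :+ # 7)))
          :+ (# 8 :+ (# 0 :+ # 9)))))) (λ v →
          lin (h v ∷ δ a v ∷ δ b v ∷ D Q₁ v ∷ δ x v ∷ []) (# 0 :+ (# 1 :+ # 2) :+ # 3) (# 0 :+ (# 1 :+ # 4) :+ # 3
          :+ # 2)) (λ v → via (L≥ v)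
          (lin (D Q₂ v ∷ wlk (dl v) c C + (δ c v + δ d v) + wlk (dl v) d E ∷ k v ∷ D (proj₁ ins) v ∷ δ x v ∷ [])
          (# 0 :+ (# 1 :+ # 2) :+ # 3) (# 0 :+ # 3 :+ # 2 :+ (# 1 :+ (# 4 :+ # 4))))) (via x1
          (lin (δ x x ∷ h x ∷ δ a x ∷ D Q₁ x ∷ []) (κ 1 :+ # 0) (# 1 :+ (# 2 :+ # 0) :+ # 3 :+ κ 1)))
        (via (L≥ x) (via x1 (via x1
          (lin (D (proj₁ ins) x ∷ δ x x ∷ D Q₂ x ∷ k x ∷ wlk (dl x) c C ∷ δ c x ∷ δ d x ∷ wlk (dl x) d E ∷ []) (κ 2
          :+ # 0 :+ # 1 :+ # 1) (# 2 :+ # 0 :+ # 3 :+ (# 4 :+ (# 5 :+ # 6) :+ # 7 :+ (# 1 :+ # 1)) :+ κ 1 :+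
          κ 1)))))
      ... | R , vR , eqR = [ one a x ] ⋄ Q₁ ⋄ R ⋄ Q₂ ⋄ L ,
        ( (ha , via (L≥ x) (via x1 (via x1
          (lin (D (proj₁ ins) x ∷ δ x x ∷ S (dl x) Q₁ ∷ S (dl x) R ∷ S (dl x) Q₂ ∷ k x ∷ wlk (dl x) c C ∷ δ c x ∷ δ
          d x ∷ wlk (dl x) d E ∷ []) (κ 2 :+ # 0 :+ # 1 :+ # 1) (# 2 :+ (# 3 :+ (# 4 :+ # 0)) :+ # 5 :+ (# 6 :+ (# 7
          :+ # 8) :+ # 9 :+ (# 1 :+ # 1)) :+ κ 1 :+ κ 1)))))
        , Valid-mono Q₁ (λ v j → via (δ≤0 (avoids Q₁ q0 j))
          (lin (h v ∷ δ a v ∷ δ b v ∷ δ x v ∷ []) (# 0 :+ (# 1 :+ # 2) :+ κ 0) (# 0 :+ (# 1 :+ # 3) :+ # 2))) (λ v j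
          → via= (sym (eqR (dl v))) (via (L≥ v)
          (lin (S₁ (dl v) X ∷ S (dl v) Q₂ ∷ wlk (dl v) c C + (δ c v + δ d v) + wlk (dl v) d E ∷ k v ∷ S (dl v) R ∷ D
          (proj₁ ins) v ∷ dl v x b ∷ dl v b x ∷ []) (# 0 :+ # 1 :+ (# 2 :+ # 3) :+ # 4 :+ # 5) (# 4 :+ (# 1 :+ # 5)
          :+ # 3 :+ (# 0 :+ (# 6 :+ # 7)) :+ (# 2 :+ (# 6 :+ # 6)))))) v₁
        , vR
        , Valid-≤ Q₂ (λ v → via= (sym (eqR (dl v)))
          (lin (h v ∷ δ a v ∷ δ b v ∷ S (dl v) Q₁ ∷ S₁ (dl v) X ∷ S (dl v) R ∷ δ x v ∷ []) (# 0 :+ (# 1 :+ # 2) :+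
          # 3 :+ # 4 :+ # 5) (# 0 :+ (# 1 :+ # 6) :+ # 3 :+ # 5 :+ (# 4 :+ (# 6 :+ # 2))))) (λ v → via (L≥ v)
          (lin (wlk (dl v) c C + (δ c v + δ d v) + wlk (dl v) d E ∷ k v ∷ D (proj₁ ins) v ∷ δ x v ∷ []) (# 0 :+ # 1
          :+ # 2) (# 2 :+ # 1 :+ (# 0 :+ (# 3 :+ # 3))))) v₂
        , Valid-≤ L (λ v → via= (sym (eqR (dl v))) (via= (weight e (dl v))
          (lin (h v ∷ δ a v ∷ δ b v ∷ D Q v ∷ δ x v ∷ S (dl v) R ∷ S (dl v) Q₁ ∷ S₁ (dl v) X ∷ S (dl v) Q₂ ∷ [])
          (# 0 :+ (# 1 :+ # 2) :+ # 3 :+ (# 4 :+ # 4) :+ # 5 :+ (# 6 :+ (# 7 :+ # 8))) (# 0 :+ (# 1 :+ # 4) :+ # 6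
          :+ # 5 :+ # 8 :+ (# 7 :+ (# 4 :+ # 2)) :+ # 3)))) (λ v → ≤-refl) vL) ,
        λ f → via≡ (weigh eqL f) (via≡ (eqR f) (via≡ (sym (weight e f))
          (lin≡ (f a x ∷ f x a ∷ S f Q₁ ∷ S f R ∷ S f Q₂ ∷ S f L ∷ sw f a b ∷ sw f c d ∷ wlk f c C ∷ wlk f d E ∷ sw
          f x c + sw f x d ∷ S₁ f X ∷ sw f x b ∷ S f Q ∷ []) (# 0 :+ # 1 :+ (# 2 :+ (# 3 :+ (# 4 :+ # 5))) :+ (# 6
          :+ # 7) :+ (# 8 :+ # 7 :+ # 9 :+ # 10) :+ (# 11 :+ # 12) :+ # 13) (# 6 :+ (# 13 :+ (# 8 :+ # 7 :+ # 9)) :+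
          (# 1 :+ # 0 :+ # 12 :+ # 10) :+ (# 5 :+ # 7) :+ # 3 :+ (# 2 :+ (# 11 :+ # 4))))))

  walk-one : ∀ {h k x} u a A b B Q c d → Valid h ([ walk u a A b B ] ⋄ Q ⋄ [ one c d ]) k →
    Fresh x ([ walk u a A b B ] ⋄ Q ⋄ [ one c d ]) →
    Pinched h k ([ walk u a A b B ] ⋄ Q ⋄ [ one c d ]) a b c d x
  walk-one {h} {k} {x} u a A b B Q c d v fr with one-walk {x = x} d c (mir Q) (not u) a A b B
    (valid (⋄-assoc [ one d c ] (mir Q) [ walk (not u) a A b B ]) {k} {h} (Valid-mir ([ walk u a A b B ] ⋄ Q ⋄ [ one
      c d ]) v))
    (via fr (via= (S-mir (dl x) Q)
      (lin (δ d x ∷ δ c x ∷ S (dl x) (mir Q) ∷ wlk (dl x) a A + (δ a x + δ b x) + wlk (dl x) b B ∷ S (dl x) Q ∷ [])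
      (# 0 :+ # 1 :+ (# 2 :+ # 3) :+ κ 0 :+ # 4) (κ 0 :+ (# 3 :+ (# 4 :+ (# 1 :+ # 0))) :+ # 2))))
  ... | L , vL , eq = mir L , Valid-mir L vL , λ f → via≡ (S-mir f L) (via≡ (S-mir f Q) (via≡ (eq f)
    (lin≡ (S f (mir L) ∷ sw f a b ∷ f c d ∷ f d c ∷ S f L ∷ S f Q ∷ S f (mir Q) ∷ wlk f a A ∷ wlk f b B ∷ sw f x d ∷
    sw f x c ∷ sw f x a + sw f x b ∷ []) (# 0 :+ (# 1 :+ (# 2 :+ # 3)) :+ # 4 :+ # 5 :+ (# 3 :+ # 2 :+ (# 6 :+ (# 7
    :+ # 1 :+ # 8)) :+ (# 9 :+ # 10 :+ # 11))) (# 7 :+ # 1 :+ # 8 :+ (# 5 :+ (# 2 :+ # 3)) :+ (# 11 :+ (# 10 :+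
    # 9)) :+ # 0 :+ # 6 :+ (# 4 :+ (# 3 :+ # 2 :+ # 1))))))

  -- With `b` in an earlier chain only `xc` may have to wait, and dually it waits backwards, for the
  -- last chain through `c` before the second edge.
  one-one-settled : ∀ {h k x} a b Q c d → Valid h ([ one a b ] ⋄ Q ⋄ [ one c d ]) k →
    Fresh x ([ one a b ] ⋄ Q ⋄ [ one c d ]) → 1 ≤ h b →
    Pinched h k ([ one a b ] ⋄ Q ⋄ [ one c d ]) a b c d x
  one-one-settled {h} {k} {x} a b Q c d ((ha , kb) , vQ , hc , kd) fr hb = go (1≤-split (k c)) (last-at c Q)
    where
    x≢b : x ≢ b
    x≢b e = absurd (via fr (via= (sym (δ-≡ (sym e)))
      (lin (δ b x ∷ δ a x ∷ S (dl x) Q ∷ δ c x ∷ δ d x ∷ []) (κ 1 :+ κ 0 :+ κ 0 :+ # 0) (κ 0 :+ (# 1 :+ # 0 :+ (# 2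
      :+ (# 3 :+ # 4))) :+ κ 1))))
    x≢c : x ≢ c
    x≢c e = absurd (via fr (via= (sym (δ-≡ (sym e)))
      (lin (δ c x ∷ δ a x ∷ δ b x ∷ S (dl x) Q ∷ δ d x ∷ []) (κ 1 :+ κ 0 :+ κ 0 :+ # 0) (κ 0 :+ (# 1 :+ # 2 :+ (# 3
      :+ (# 0 :+ # 4))) :+ κ 1))))
    x1 = ≤-reflexive (sym (δ-refl x))
    go : _ → _ → Pinched h k ([ one a b ] ⋄ Q ⋄ [ one c d ]) a b c d x
    go (inj₂ kc) _ = [ one a x ] ⋄ [ walk true x [] b [] ] ⋄ Q ⋄ [ walk false x [] c [] ] ⋄ [ one x d ] ,
      ( (ha , via x1 (via x1
        (lin (δ x x ∷ δ b x ∷ S (dl x) Q ∷ δ c x ∷ δ d x ∷ k x ∷ []) (κ 2 :+ # 0 :+ # 0) (# 0 :+ # 1 :+ κ 0 :+ (# 2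
        :+ (# 0 :+ # 3 :+ κ 0 :+ (# 0 :+ # 4))) :+ # 5 :+ κ 1 :+ κ 1))))
      , edge-up x b (via x1 (via x1
        (lin (δ x x ∷ S (dl x) Q ∷ δ c x ∷ δ d x ∷ k x ∷ []) (κ 2 :+ # 0 :+ # 0) (# 1 :+ (# 0 :+ # 2 :+ κ 0 :+ (# 0
        :+ # 3)) :+ # 4 :+ κ 1 :+ κ 1)))) (via kb
        (lin (S (dl b) Q ∷ δ c b ∷ δ d b ∷ k b ∷ δ x b ∷ []) (κ 2 :+ (# 0 :+ (# 1 :+ # 2) :+ # 3)) (# 0 :+ (# 4 :+
        # 1 :+ κ 0 :+ (# 4 :+ # 2)) :+ # 3 :+ κ 2))) (via x1
        (lin (δ x x ∷ h x ∷ δ a x ∷ []) (κ 1 :+ # 0) (# 1 :+ (# 2 :+ # 0) :+ κ 1))) (via hb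
        (lin (h b ∷ δ a b ∷ δ x b ∷ []) (κ 1 :+ # 0) (# 0 :+ (# 1 :+ # 2) :+ κ 1))) x≢b
      , Valid-≤ Q (λ v →
        lin (h v ∷ δ a v ∷ δ b v ∷ δ x v ∷ []) (# 0 :+ (# 1 :+ # 2)) (# 0 :+ (# 1 :+ # 3) :+ (# 3 :+ # 2 :+ κ 0)))
        (λ v → lin (δ c v ∷ δ d v ∷ k v ∷ δ x v ∷ []) (# 0 :+ # 1 :+ # 2) (# 3 :+ # 0 :+ κ 0 :+ (# 3 :+ # 1) :+
        # 2)) vQ
      , edge-up x c (via x1 (via x1
        (lin (δ x x ∷ h x ∷ δ a x ∷ δ b x ∷ D Q x ∷ []) (κ 2 :+ # 0 :+ # 0) (# 1 :+ (# 2 :+ # 0) :+ (# 0 :+ # 3 :+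
        κ 0) :+ # 4 :+ κ 1 :+ κ 1)))) (via hc
        (lin (h c ∷ δ a c ∷ δ b c ∷ D Q c ∷ δ x c ∷ []) (κ 2 :+ (# 0 :+ (# 1 :+ # 2) :+ # 3)) (# 0 :+ (# 1 :+ # 4)
        :+ (# 4 :+ # 2 :+ κ 0) :+ # 3 :+ κ 2))) (via x1
        (lin (δ x x ∷ δ d x ∷ k x ∷ []) (κ 1 :+ # 0) (# 0 :+ # 1 :+ # 2 :+ κ 1))) (via kc
        (lin (k c ∷ δ x c ∷ δ d c ∷ []) (κ 1 :+ # 0) (# 1 :+ # 2 :+ # 0 :+ κ 1))) x≢c
      , (via x1 (via x1
        (lin (δ x x ∷ h x ∷ δ a x ∷ δ b x ∷ D Q x ∷ δ c x ∷ []) (κ 2 :+ # 0 :+ # 0) (# 1 :+ (# 2 :+ # 0) :+ (# 0 :+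
        # 3 :+ κ 0) :+ # 4 :+ (# 0 :+ # 5 :+ κ 0) :+ κ 1 :+ κ 1))) , kd)) ,
      λ f → lin≡ (f a x ∷ f x a ∷ sw f x b ∷ S f Q ∷ sw f x c ∷ sw f x d ∷ sw f a b ∷ sw f c d ∷ []) (# 0 :+ # 1 :+
        (# 2 :+ κ 0 :+ (# 3 :+ (# 4 :+ κ 0 :+ # 5))) :+ (# 6 :+ # 7)) (# 6 :+ (# 3 :+ # 7) :+ (# 1 :+ # 0 :+ # 2 :+
        (# 4 :+ # 5)))
    -- As `Q` avoids `c`, the tail `c` has its earlier degree two even before `Q`. There `a → x` and
    -- `c → x` together give `x` the degree for `x → b`.
    go (inj₁ kc) (inj₁ q0) = [ one a x ] ⋄ [ one c x ] ⋄ [ one x b ] ⋄ Q ⋄ [ one x d ] ,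
      ( (ha , via x1 (via x1
        (lin (δ x x ∷ δ c x ∷ δ b x ∷ S (dl x) Q ∷ δ d x ∷ k x ∷ []) (κ 2 :+ # 0 :+ # 0) (# 1 :+ # 0 :+ (# 0 :+ # 2
        :+ (# 3 :+ (# 0 :+ # 4))) :+ # 5 :+ κ 1 :+ κ 1))))
      , (via hc (via= q0 (via (δ≤0 b≢c)
        (lin (h c ∷ δ a c ∷ δ b c ∷ D Q c ∷ δ x c ∷ []) (κ 2 :+ (# 0 :+ (# 1 :+ # 2) :+ # 3) :+ κ 0 :+ κ 0) (# 0 :+
        (# 1 :+ # 4) :+ κ 2 :+ # 3 :+ # 2)))) , via x1 (via x1
        (lin (δ x x ∷ δ b x ∷ S (dl x) Q ∷ δ d x ∷ k x ∷ []) (κ 2 :+ # 0 :+ # 0) (# 0 :+ # 1 :+ (# 2 :+ (# 0 :+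
        # 3)) :+ # 4 :+ κ 1 :+ κ 1))))
      , (via x1 (via x1
        (lin (δ x x ∷ h x ∷ δ a x ∷ δ c x ∷ []) (κ 2 :+ # 0 :+ # 0) (# 1 :+ (# 2 :+ # 0) :+ (# 3 :+ # 0) :+ κ 1 :+
        κ 1))) , via kb (via (δ≤0 (λ e → b≢c (sym e)))
        (lin (S (dl b) Q ∷ δ c b ∷ δ d b ∷ k b ∷ δ x b ∷ []) (κ 2 :+ (# 0 :+ (# 1 :+ # 2) :+ # 3) :+ κ 0) (# 0 :+
        (# 4 :+ # 2) :+ # 3 :+ κ 2 :+ # 1))))
      , Valid-mono Q (λ v i →
        lin (h v ∷ δ a v ∷ δ b v ∷ δ x v ∷ δ c v ∷ []) (# 0 :+ (# 1 :+ # 2)) (# 0 :+ (# 1 :+ # 3) :+ (# 4 :+ # 3) :+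
        (# 3 :+ # 2))) (λ v i → via (δ≤0 (avoids Q q0 i))
        (lin (δ c v ∷ δ d v ∷ k v ∷ δ x v ∷ []) (# 0 :+ # 1 :+ # 2 :+ κ 0) (# 3 :+ # 1 :+ # 2 :+ # 0))) vQ
      , (via x1 (via x1
        (lin (δ x x ∷ h x ∷ δ a x ∷ δ c x ∷ δ b x ∷ D Q x ∷ []) (κ 2 :+ # 0 :+ # 0) (# 1 :+ (# 2 :+ # 0) :+ (# 3 :+
        # 0) :+ (# 0 :+ # 4) :+ # 5 :+ κ 1 :+ κ 1))) , kd)) ,
      λ f → lin≡ (f a x ∷ f x a ∷ f c x ∷ f x c ∷ sw f x b ∷ S f Q ∷ sw f x d ∷ sw f a b ∷ sw f c d ∷ []) (# 0 :+
        # 1 :+ (# 2 :+ # 3 :+ (# 4 :+ (# 5 :+ # 6))) :+ (# 7 :+ # 8)) (# 7 :+ (# 5 :+ # 8) :+ (# 1 :+ # 0 :+ # 4 :+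
        (# 3 :+ # 2 :+ # 6)))
      where
      d≢c : d ≢ c
      d≢c = ≢-from k (via kd (lin (k d ∷ []) (κ 1 :+ # 0) (# 0 :+ κ 2))) (≤-reflexive kc)
      -- Otherwise the later degree two of the head `b` would have to come from the single end of
      -- the edge `cd` at `c`.
      b≢c : b ≢ c
      b≢c refl = absurd (via kb (via= q0 (via= kc (via (δ≤0 d≢c) (via (δ≤1 c c)
        (lin (S (dl b) Q ∷ δ b b ∷ δ d b ∷ k b ∷ []) (κ 1 :+ κ 0 :+ (# 0 :+ (# 1 :+ # 2) :+ # 3) :+ κ 0 :+ κ 0 :+
        κ 0 :+ κ 1) (κ 0 :+ κ 2 :+ # 0 :+ # 3 :+ # 2 :+ # 1)))))))
    go (inj₁ kc) (inj₂ (split {Q₁} {X} {Q₂} e , q0 , i)) = found (valid e vQ)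
      where
      d≢c : d ≢ c
      d≢c = ≢-from k (via kd (lin (k d ∷ []) (κ 1 :+ # 0) (# 0 :+ κ 2))) (≤-reflexive kc)
      found : Valid (λ v → h v + D [ one a b ] v) (Q₁ ⋄ [ X ] ⋄ Q₂) (λ v → D [ one c d ] v + k v) → Pinched h k ([
        one a b ] ⋄ Q ⋄ [ one c d ]) a b c d x
      found (v₁ , oX , v₂) with attachᵐ {h′ = λ v → ((h v + D [ one a x ] v) + D [ walk true x [] b [] ] v) + D Q₁
        v} {k′ = λ v → (D Q₂ v + D [ one x d ] v) + k v} x X oX i
        (via= kc (via= q0 (via (δ≤0 d≢c) (via (δ≤1 c c)
          (lin (D Q₂ c ∷ δ c c ∷ δ d c ∷ k c ∷ []) (# 0 :+ (# 1 :+ # 2 :+ # 3) :+ κ 0 :+ κ 0 :+ κ 0 :+ κ 1) (κ 1 :+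
          # 3 :+ # 0 :+ # 2 :+ # 1)))))) (via fr (via= (sym (weight e (dl x)))
          (lin (D [ X ] x ∷ S (dl x) Q ∷ δ a x ∷ δ b x ∷ δ c x ∷ δ d x ∷ S (dl x) Q₁ ∷ S (dl x) Q₂ ∷ []) (# 0 :+ κ 0
          :+ # 1) (κ 0 :+ (# 2 :+ # 3 :+ (# 1 :+ (# 4 :+ # 5))) :+ (# 6 :+ (# 0 :+ # 7)))))) (λ v →
          lin (h v ∷ δ a v ∷ δ b v ∷ D Q₁ v ∷ δ x v ∷ []) (# 0 :+ (# 1 :+ # 2) :+ # 3) (# 0 :+ (# 1 :+ # 4) :+ (# 4
          :+ # 2 :+ κ 0) :+ # 3)) (λ v →
          lin (D Q₂ v ∷ δ c v ∷ δ d v ∷ k v ∷ δ x v ∷ []) (# 0 :+ (# 1 :+ # 2 :+ # 3)) (# 0 :+ (# 4 :+ # 2) :+ # 3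
          :+ # 1)) (via x1 (via x1
          (lin (δ x x ∷ h x ∷ δ a x ∷ δ b x ∷ D Q₁ x ∷ []) (κ 2 :+ # 0 :+ # 0) (# 1 :+ (# 2 :+ # 0) :+ (# 0 :+ # 3
          :+ κ 0) :+ # 4 :+ κ 1 :+ κ 1)))) (via x1
          (lin (δ x x ∷ D Q₂ x ∷ δ d x ∷ k x ∷ []) (κ 1 :+ # 0) (# 1 :+ (# 0 :+ # 2) :+ # 3 :+ κ 1)))
      ... | R , vR , eqR = [ one a x ] ⋄ [ walk true x [] b [] ] ⋄ Q₁ ⋄ R ⋄ Q₂ ⋄ [ one x d ] ,
        ( (ha , via= (sym (eqR (dl x))) (via x1 (via x1
          (lin (S (dl x) R ∷ δ x x ∷ δ b x ∷ S (dl x) Q₁ ∷ S (dl x) Q₂ ∷ δ d x ∷ k x ∷ S₁ (dl x) X ∷ dl x c x ∷ [])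
          (κ 2 :+ # 0 :+ # 1 :+ # 1) (# 1 :+ # 2 :+ κ 0 :+ (# 3 :+ (# 0 :+ (# 4 :+ (# 1 :+ # 5)))) :+ # 6 :+ (# 7 :+
          (# 1 :+ # 8)) :+ κ 1 :+ κ 1)))))
        , edge-up x b (via= (sym (eqR (dl x))) (via x1 (via x1
          (lin (S (dl x) R ∷ δ x x ∷ S (dl x) Q₁ ∷ S (dl x) Q₂ ∷ δ d x ∷ k x ∷ S₁ (dl x) X ∷ dl x c x ∷ []) (κ 2 :+
          # 0 :+ # 1 :+ # 1) (# 2 :+ (# 0 :+ (# 3 :+ (# 1 :+ # 4))) :+ # 5 :+ (# 6 :+ (# 1 :+ # 7)) :+ κ 1 :+
          κ 1))))) (via kb (via= (weight e (dl b)) (via= (sym (eqR (dl b)))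
          (lin (S (dl b) Q ∷ δ c b ∷ δ d b ∷ k b ∷ S (dl b) Q₁ ∷ S₁ (dl b) X ∷ S (dl b) Q₂ ∷ S (dl b) R ∷ δ x b ∷
          []) (κ 2 :+ (# 0 :+ (# 1 :+ # 2) :+ # 3) :+ (# 4 :+ (# 5 :+ # 6)) :+ # 7) (# 4 :+ (# 7 :+ (# 6 :+ (# 8 :+
          # 2))) :+ # 3 :+ κ 2 :+ # 0 :+ (# 5 :+ (# 8 :+ # 1))))))) (via x1
          (lin (δ x x ∷ h x ∷ δ a x ∷ []) (κ 1 :+ # 0) (# 1 :+ (# 2 :+ # 0) :+ κ 1))) (via hb
          (lin (h b ∷ δ a b ∷ δ x b ∷ []) (κ 1 :+ # 0) (# 0 :+ (# 1 :+ # 2) :+ κ 1))) x≢b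
        , Valid-≤ Q₁ (λ v →
          lin (h v ∷ δ a v ∷ δ b v ∷ δ x v ∷ []) (# 0 :+ (# 1 :+ # 2)) (# 0 :+ (# 1 :+ # 3) :+ (# 3 :+ # 2 :+ κ 0)))
          (λ v → via= (sym (eqR (dl v)))
          (lin (S₁ (dl v) X ∷ S (dl v) Q₂ ∷ δ c v ∷ δ d v ∷ k v ∷ S (dl v) R ∷ δ x v ∷ []) (# 0 :+ # 1 :+ (# 2 :+
          # 3 :+ # 4) :+ # 5) (# 5 :+ (# 1 :+ (# 6 :+ # 3)) :+ # 4 :+ (# 0 :+ (# 6 :+ # 2))))) v₁
        , vR
        , Valid-mono Q₂ (λ v j → via= (sym (eqR (dl v)))
          (lin (h v ∷ δ a v ∷ δ b v ∷ S (dl v) Q₁ ∷ S₁ (dl v) X ∷ S (dl v) R ∷ δ x v ∷ dl v c x ∷ []) (# 0 :+ (# 1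
          :+ # 2) :+ # 3 :+ # 4 :+ # 5) (# 0 :+ (# 1 :+ # 6) :+ (# 6 :+ # 2 :+ κ 0) :+ # 3 :+ # 5 :+ (# 4 :+ (# 6 :+
          # 7))))) (λ v j → via (δ≤0 (avoids Q₂ q0 j))
          (lin (δ c v ∷ δ d v ∷ k v ∷ δ x v ∷ []) (# 0 :+ # 1 :+ # 2 :+ κ 0) (# 3 :+ # 1 :+ # 2 :+ # 0))) v₂
        , (via= (sym (eqR (dl x))) (via x1 (via x1
          (lin (S (dl x) R ∷ δ x x ∷ h x ∷ δ a x ∷ δ b x ∷ D Q₁ x ∷ D Q₂ x ∷ S₁ (dl x) X ∷ dl x c x ∷ []) (κ 2 :+
          # 0 :+ # 1 :+ # 1) (# 2 :+ (# 3 :+ # 1) :+ (# 1 :+ # 4 :+ κ 0) :+ # 5 :+ # 0 :+ # 6 :+ (# 7 :+ (# 1 :+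
          # 8)) :+ κ 1 :+ κ 1)))) , kd)) ,
        λ f → via≡ (eqR f) (via≡ (sym (weight e f))
          (lin≡ (f a x ∷ f x a ∷ sw f x b ∷ S f Q₁ ∷ S f R ∷ S f Q₂ ∷ sw f x d ∷ sw f a b ∷ sw f c d ∷ S₁ f X ∷ sw f
          x c ∷ S f Q ∷ []) (# 0 :+ # 1 :+ (# 2 :+ κ 0 :+ (# 3 :+ (# 4 :+ (# 5 :+ # 6)))) :+ (# 7 :+ # 8) :+ (# 9 :+
          # 10) :+ # 11) (# 7 :+ (# 11 :+ # 8) :+ (# 1 :+ # 0 :+ # 2 :+ (# 10 :+ # 6)) :+ # 4 :+ (# 3 :+ (# 9 :+
          # 5)))))

  -- A chain through b with h b ≤ 1 is upward at b, hence does not use the later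
  -- degree of a vertex c with k c ≤ 1.
  lower : ∀ {h k h′ k′ b c} W → OK h W k → 1 ≤ D [ W ] b → h b ≤ 1 → k c ≤ 1 → b ≢ c →
    (∀ v → h v ≤ h′ v) → (∀ v → k v ≤ k′ v + δ c v) → OK h′ W k′
  lower {h} {k} {h′} {k′} {b} {c} (walk true p A q B) o i hb kc b≢c hh kk = UpOK-mono (λ v _ → hh v) g o
    where
    g : ∀ v → 1 ≤ cn p A v + cn q B v → k v ≤ k′ v
    g v j with δ-split c v
    ... | inj₁ refl = absurd (via (good o c j) (via kc
      (lin (k v ∷ []) (κ 1 :+ κ 0 :+ # 0 :+ κ 1) (κ 0 :+ κ 2 :+ # 0))))
    ... | inj₂ z = via (kk v) (via= z
      (lin (k v ∷ k′ v ∷ δ c v ∷ []) (# 0 :+ (# 1 :+ # 2) :+ κ 0) (# 1 :+ # 0 :+ # 2)))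
  lower {h} {k} {h′} {k′} {b} {c} (walk false p A q B) o i hb kc b≢c hh kk = absurd (via (good o b (D⇒occ true p A q
    B b i)) (via hb (lin (h b ∷ []) (κ 1 :+ κ 0 :+ # 0 :+ κ 1) (κ 0 :+ κ 2 :+ # 0))))
  lower {h} {k} {h′} {k′} {b} {c} (one u w) (o , o′) i hb kc b≢c hh kk with δ-split u b | δ-split w b
  ... | inj₁ refl | _ = absurd (via o (via hb (lin (h b ∷ []) (κ 1 :+ κ 0 :+ # 0 :+ κ 1) (κ 0 :+ κ 2 :+ # 0))))
  ... | inj₂ z | inj₂ z′ = absurd (via i (via= z (via= z′
    (lin (δ u b ∷ δ w b ∷ []) (κ 1 :+ κ 0 :+ (# 0 :+ # 1) :+ κ 0 :+ κ 0) (κ 0 :+ κ 1 :+ # 0 :+ # 1)))))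
  ... | inj₂ z | inj₁ refl = ≤-trans o (hh u) , via o′ (via (kk w) (via (δ≤0 (λ e → b≢c (sym e)))
    (lin (k b ∷ k′ b ∷ δ c b ∷ []) (κ 2 :+ # 0 :+ (# 1 :+ # 2) :+ κ 0) (# 1 :+ κ 2 :+ # 0 :+ # 2))))

  -- If neither side is settled, `xb` waits for the first chain `W` through `b` and `xc` for the
  -- last chain through `c`. If the latter comes after `W`, both are attached, each to its own
  -- chain; if not, `c → x` and `x → b` both fit in directly before `W`.
  one-one : ∀ {h k x} a b Q c d → Valid h ([ one a b ] ⋄ Q ⋄ [ one c d ]) k →
    Fresh x ([ one a b ] ⋄ Q ⋄ [ one c d ]) →
    Pinched h k ([ one a b ] ⋄ Q ⋄ [ one c d ]) a b c d x
  one-one {h} {k} {x} a b Q c d V@((ha , kb) , vQ , hc , kd) fr = go (1≤-split (h b)) (1≤-split (k c)) (first-at b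
    Q)
    where
    x1 = ≤-reflexive (sym (δ-refl x))
    go : _ → _ → _ → Pinched h k ([ one a b ] ⋄ Q ⋄ [ one c d ]) a b c d x
    go (inj₂ hb) _ _ = one-one-settled a b Q c d V fr hb
    go (inj₁ _) (inj₂ kc) _ with one-one-settled {x = x} d c (mir Q) b a
      (valid (⋄-assoc [ one d c ] (mir Q) [ one b a ]) {k} {h} (Valid-mir ([ one a b ] ⋄ Q ⋄ [ one c d ]) V)) (via
        fr (via= (S-mir (dl x) Q)
        (lin (δ d x ∷ δ c x ∷ S (dl x) (mir Q) ∷ δ b x ∷ δ a x ∷ S (dl x) Q ∷ []) (# 0 :+ # 1 :+ (# 2 :+ (# 3 :+
        # 4)) :+ κ 0 :+ # 5) (κ 0 :+ (# 4 :+ # 3 :+ (# 5 :+ (# 1 :+ # 0))) :+ # 2)))) kc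
    ... | L , vL , eq = mir L , Valid-mir L vL , λ f → via≡ (S-mir f L) (via≡ (S-mir f Q) (via≡ (eq f)
      (lin≡ (S f (mir L) ∷ f a b ∷ f b a ∷ f c d ∷ f d c ∷ S f L ∷ S f Q ∷ S f (mir Q) ∷ sw f x d ∷ sw f x c ∷ sw f
      x b ∷ sw f x a ∷ []) (# 0 :+ (# 1 :+ # 2 :+ (# 3 :+ # 4)) :+ # 5 :+ # 6 :+ (# 4 :+ # 3 :+ (# 7 :+ (# 2 :+
      # 1)) :+ (# 8 :+ # 9 :+ (# 10 :+ # 11)))) (# 1 :+ # 2 :+ (# 6 :+ (# 3 :+ # 4)) :+ (# 11 :+ # 10 :+ (# 9 :+
      # 8)) :+ # 0 :+ # 7 :+ (# 5 :+ (# 4 :+ # 3 :+ (# 2 :+ # 1)))))))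
    -- With `b` absent from `Q`, the edge `xb` can wait until the end of `Q`, where `c → x` has
    -- given `x` its second earlier edge.
    go (inj₁ hb) (inj₁ kc) (inj₁ q0) = [ one a x ] ⋄ Q ⋄ [ one c x ] ⋄ [ one x b ] ⋄ [ one x d ] ,
      ( (ha , via x1 (via x1
        (lin (δ x x ∷ S (dl x) Q ∷ δ c x ∷ δ b x ∷ δ d x ∷ k x ∷ []) (κ 2 :+ # 0 :+ # 0) (# 1 :+ (# 2 :+ # 0 :+ (# 0
        :+ # 3 :+ (# 0 :+ # 4))) :+ # 5 :+ κ 1 :+ κ 1))))
      , Valid-mono Q (λ v i → via (δ≤0 (avoids Q q0 i))
        (lin (h v ∷ δ a v ∷ δ b v ∷ δ x v ∷ []) (# 0 :+ (# 1 :+ # 2) :+ κ 0) (# 0 :+ (# 1 :+ # 3) :+ # 2))) (λ v i →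
        lin (δ c v ∷ δ d v ∷ k v ∷ δ x v ∷ δ b v ∷ []) (# 0 :+ # 1 :+ # 2) (# 0 :+ # 3 :+ (# 3 :+ # 4 :+ (# 3 :+
        # 1)) :+ # 2)) vQ
      , (via hc (via (δ≤0 b≢c)
        (lin (h c ∷ δ a c ∷ δ b c ∷ D Q c ∷ δ x c ∷ []) (κ 2 :+ (# 0 :+ (# 1 :+ # 2) :+ # 3) :+ κ 0) (# 0 :+ (# 1 :+
        # 4) :+ # 3 :+ κ 2 :+ # 2))) , via x1 (via x1
        (lin (δ x x ∷ δ b x ∷ δ d x ∷ k x ∷ []) (κ 2 :+ # 0 :+ # 0) (# 0 :+ # 1 :+ (# 0 :+ # 2) :+ # 3 :+ κ 1 :+
        κ 1))))
      , (via x1 (via x1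
        (lin (δ x x ∷ h x ∷ δ a x ∷ D Q x ∷ δ c x ∷ []) (κ 2 :+ # 0 :+ # 0) (# 1 :+ (# 2 :+ # 0) :+ # 3 :+ (# 4 :+
        # 0) :+ κ 1 :+ κ 1))) , via kb (via= q0 (via (δ≤0 (λ e → b≢c (sym e)))
        (lin (S (dl b) Q ∷ δ c b ∷ δ d b ∷ k b ∷ δ x b ∷ []) (κ 2 :+ (# 0 :+ (# 1 :+ # 2) :+ # 3) :+ κ 0 :+ κ 0)
        (# 4 :+ # 2 :+ # 3 :+ κ 2 :+ # 0 :+ # 1)))))
      , (via x1 (via x1
        (lin (δ x x ∷ h x ∷ δ a x ∷ D Q x ∷ δ c x ∷ δ b x ∷ []) (κ 2 :+ # 0 :+ # 0) (# 1 :+ (# 2 :+ # 0) :+ # 3 :+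
        (# 4 :+ # 0) :+ (# 0 :+ # 5) :+ κ 1 :+ κ 1))) , kd)) ,
      λ f → lin≡ (f a x ∷ f x a ∷ S f Q ∷ f c x ∷ f x c ∷ sw f x b ∷ sw f x d ∷ sw f a b ∷ sw f c d ∷ []) (# 0 :+
        # 1 :+ (# 2 :+ (# 3 :+ # 4 :+ (# 5 :+ # 6))) :+ (# 7 :+ # 8)) (# 7 :+ (# 2 :+ # 8) :+ (# 1 :+ # 0 :+ # 5 :+
        (# 4 :+ # 3 :+ # 6)))
      where
      a≢b : a ≢ b
      a≢b = ≢-from h (via ha (lin (h a ∷ []) (κ 1 :+ # 0) (# 0 :+ κ 2))) (≤-reflexive hb)
      b≢c : b ≢ c
      b≢c refl = absurd (via hc (via= q0 (via= hb (via (δ≤0 a≢b) (via (δ≤1 b b)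
        (lin (h b ∷ δ a b ∷ δ b b ∷ D Q b ∷ []) (κ 1 :+ κ 0 :+ (# 0 :+ (# 1 :+ # 2) :+ # 3) :+ κ 0 :+ κ 0 :+ κ 0 :+
        κ 1) (κ 0 :+ κ 2 :+ # 3 :+ # 0 :+ # 1 :+ # 2)))))))
    go (inj₁ hb) (inj₁ kc) (inj₂ (split {Q₁} {W} {Q₂} e , q0 , i)) = found (valid e vQ) (last-at c Q₂)
      where
      a≢b : a ≢ b
      a≢b = ≢-from h (via ha (lin (h a ∷ []) (κ 1 :+ # 0) (# 0 :+ κ 2))) (≤-reflexive hb)
      d≢c : d ≢ c
      d≢c = ≢-from k (via kd (lin (k d ∷ []) (κ 1 :+ # 0) (# 0 :+ κ 2))) (≤-reflexive kc)
      hb1 : (h b + D [ one a b ] b) + D Q₁ b ≤ 1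
      hb1 = via= hb (via= q0 (via (δ≤0 a≢b) (via (δ≤1 b b)
        (lin (h b ∷ δ a b ∷ δ b b ∷ D Q₁ b ∷ []) (# 0 :+ (# 1 :+ # 2) :+ # 3 :+ κ 0 :+ κ 0 :+ κ 0 :+ κ 1) (κ 1 :+
        # 0 :+ # 3 :+ # 1 :+ # 2)))))
      found : Valid (λ v → h v + D [ one a b ] v) (Q₁ ⋄ [ W ] ⋄ Q₂) (λ v → D [ one c d ] v + k v) → _ →
        Pinched h k ([ one a b ] ⋄ Q ⋄ [ one c d ]) a b c d x
      found (v₁ , oW , v₂) (inj₁ p0) = [ one a x ] ⋄ Q₁ ⋄ [ one c x ] ⋄ [ one x b ] ⋄ [ W ] ⋄ Q₂ ⋄ [ one x d ] ,
        ( (ha , via x1 (via x1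
          (lin (δ x x ∷ S (dl x) Q₁ ∷ δ c x ∷ δ b x ∷ S₁ (dl x) W ∷ S (dl x) Q₂ ∷ δ d x ∷ k x ∷ []) (κ 2 :+ # 0 :+
          # 0) (# 1 :+ (# 2 :+ # 0 :+ (# 0 :+ # 3 :+ (# 4 :+ (# 5 :+ (# 0 :+ # 6))))) :+ # 7 :+ κ 1 :+ κ 1))))
        , Valid-mono Q₁ (λ v j → via (δ≤0 (avoids Q₁ q0 j))
          (lin (h v ∷ δ a v ∷ δ b v ∷ δ x v ∷ []) (# 0 :+ (# 1 :+ # 2) :+ κ 0) (# 0 :+ (# 1 :+ # 3) :+ # 2))) (λ v j
          → lin (S₁ (dl v) W ∷ S (dl v) Q₂ ∷ δ c v ∷ δ d v ∷ k v ∷ δ x v ∷ δ b v ∷ []) (# 0 :+ # 1 :+ (# 2 :+ # 3 :+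
          # 4)) (# 2 :+ # 5 :+ (# 5 :+ # 6 :+ (# 0 :+ (# 1 :+ (# 5 :+ # 3)))) :+ # 4)) v₁
        , (via hcW (via (δ≤0 b≢c)
          (lin (h c ∷ δ a c ∷ δ b c ∷ D Q₁ c ∷ δ x c ∷ []) (κ 2 :+ (# 0 :+ (# 1 :+ # 2) :+ # 3) :+ κ 0) (# 0 :+ (# 1
          :+ # 4) :+ # 3 :+ κ 2 :+ # 2))) , via x1 (via x1
          (lin (δ x x ∷ δ b x ∷ S₁ (dl x) W ∷ S (dl x) Q₂ ∷ δ d x ∷ k x ∷ []) (κ 2 :+ # 0 :+ # 0) (# 0 :+ # 1 :+
          (# 2 :+ (# 3 :+ (# 0 :+ # 4))) :+ # 5 :+ κ 1 :+ κ 1))))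
        , (via x1 (via x1
          (lin (δ x x ∷ h x ∷ δ a x ∷ D Q₁ x ∷ δ c x ∷ []) (κ 2 :+ # 0 :+ # 0) (# 1 :+ (# 2 :+ # 0) :+ # 3 :+ (# 4
          :+ # 0) :+ κ 1 :+ κ 1))) , via kb (via= (weight e (dl b)) (via= q0 (via (δ≤0 (λ z → b≢c (sym z)))
          (lin (S (dl b) Q ∷ δ c b ∷ δ d b ∷ k b ∷ S (dl b) Q₁ ∷ S₁ (dl b) W ∷ S (dl b) Q₂ ∷ δ x b ∷ []) (κ 2 :+
          (# 0 :+ (# 1 :+ # 2) :+ # 3) :+ (# 4 :+ (# 5 :+ # 6)) :+ κ 0 :+ κ 0) (# 5 :+ (# 6 :+ (# 7 :+ # 2)) :+ # 3
          :+ κ 2 :+ # 0 :+ # 4 :+ # 1))))))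
        , lower W oW i hb1 kc1 b≢c (λ v →
          lin (h v ∷ δ a v ∷ δ b v ∷ D Q₁ v ∷ δ x v ∷ δ c v ∷ []) (# 0 :+ (# 1 :+ # 2) :+ # 3) (# 0 :+ (# 1 :+ # 4)
          :+ # 3 :+ (# 5 :+ # 4) :+ (# 4 :+ # 2))) (λ v →
          lin (D Q₂ v ∷ δ c v ∷ δ d v ∷ k v ∷ δ x v ∷ []) (# 0 :+ (# 1 :+ # 2 :+ # 3)) (# 0 :+ (# 4 :+ # 2) :+ # 3
          :+ # 1))
        , Valid-mono Q₂ (λ v j →
          lin (h v ∷ δ a v ∷ δ b v ∷ D Q₁ v ∷ D [ W ] v ∷ δ x v ∷ δ c v ∷ []) (# 0 :+ (# 1 :+ # 2) :+ # 3 :+ # 4)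
          (# 0 :+ (# 1 :+ # 5) :+ # 3 :+ (# 6 :+ # 5) :+ (# 5 :+ # 2) :+ # 4)) (λ v j → via (δ≤0 (avoids Q₂ p0 j))
          (lin (δ c v ∷ δ d v ∷ k v ∷ δ x v ∷ []) (# 0 :+ # 1 :+ # 2 :+ κ 0) (# 3 :+ # 1 :+ # 2 :+ # 0))) v₂
        , (via x1 (via x1
          (lin (δ x x ∷ h x ∷ δ a x ∷ D Q₁ x ∷ δ c x ∷ δ b x ∷ D [ W ] x ∷ D Q₂ x ∷ []) (κ 2 :+ # 0 :+ # 0) (# 1 :+
          (# 2 :+ # 0) :+ # 3 :+ (# 4 :+ # 0) :+ (# 0 :+ # 5) :+ # 6 :+ # 7 :+ κ 1 :+ κ 1))) , kd)) ,
        λ f → via≡ (sym (weight e f))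
          (lin≡ (f a x ∷ f x a ∷ S f Q₁ ∷ f c x ∷ f x c ∷ sw f x b ∷ S₁ f W ∷ S f Q₂ ∷ sw f x d ∷ sw f a b ∷ sw f c
          d ∷ S f Q ∷ []) (# 0 :+ # 1 :+ (# 2 :+ (# 3 :+ # 4 :+ (# 5 :+ (# 6 :+ (# 7 :+ # 8))))) :+ (# 9 :+ # 10) :+
          # 11) (# 9 :+ (# 11 :+ # 10) :+ (# 1 :+ # 0 :+ # 5 :+ (# 4 :+ # 3 :+ # 8)) :+ (# 2 :+ (# 6 :+ # 7))))
        where
        kc1 : D Q₂ c + (D [ one c d ] c + k c) ≤ 1
        kc1 = via= kc (via= p0 (via (δ≤0 d≢c) (via (δ≤1 c c)
          (lin (D Q₂ c ∷ δ c c ∷ δ d c ∷ k c ∷ []) (# 0 :+ (# 1 :+ # 2 :+ # 3) :+ κ 0 :+ κ 0 :+ κ 0 :+ κ 1) (κ 1 :+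
          # 3 :+ # 0 :+ # 2 :+ # 1)))))
        -- Were they equal, `W` would pass through a vertex of degree at most one on both sides.
        b≢c : b ≢ c
        b≢c refl with OK-side W b oW i
        ... | inj₁ g = absurd (via g (via hb1
          (lin (h b + (δ a b + δ b b) + S (dl b) Q₁ ∷ []) (κ 1 :+ κ 0 :+ # 0 :+ κ 1) (κ 0 :+ κ 2 :+ # 0))))
        ... | inj₂ g = absurd (via g (via kc1
          (lin (S (dl b) Q₂ + (δ b b + δ d b + k b) ∷ []) (κ 1 :+ κ 0 :+ # 0 :+ κ 1) (κ 0 :+ κ 2 :+ # 0))))
        -- The later degree of `c` after `W` is at most one. So if `W` passes through `c`, the
        -- earlier degree is two already; if not, all edges that make `c` a tail precede `W`.
        hcW : 2 ≤ (h c + D [ one a b ] c) + D Q₁ c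
        hcW with 1≤-split (D [ W ] c)
        ... | inj₁ w0 = via hc (via= (weight e (dl c)) (via= w0 (via= p0
          (lin (h c + (δ a c + δ b c) ∷ S (dl c) Q ∷ S (dl c) Q₁ ∷ S₁ (dl c) W ∷ S (dl c) Q₂ ∷ []) (κ 2 :+ (# 0 :+
          # 1) :+ (# 2 :+ (# 3 :+ # 4)) :+ κ 0 :+ κ 0) (# 0 :+ # 2 :+ κ 2 :+ # 1 :+ # 3 :+ # 4)))))
        ... | inj₂ w1 with OK-side W c oW w1
        ... | inj₁ g = g
        ... | inj₂ g = absurd (via g (via kc1
          (lin (S (dl c) Q₂ + (δ c c + δ d c + k c) ∷ []) (κ 1 :+ κ 0 :+ # 0 :+ κ 1) (κ 0 :+ κ 2 :+ # 0))))
      found (v₁ , oW , v₂) (inj₂ (split {Q₃} {X} {Q₄} e′ , p0 , j)) = found′ (valid e′ v₂)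
        where
        found′ : Valid (λ v → ((h v + D [ one a b ] v) + D Q₁ v) + D [ W ] v) (Q₃ ⋄ [ X ] ⋄ Q₄) (λ v → D [ one c d ]
          v + k v) →
          Pinched h k ([ one a b ] ⋄ Q ⋄ [ one c d ]) a b c d x
        found′ (v₃ , oX , v₄) with
          -- Each attachment sees the other one only as degrees in its context, so neither has to be
          -- made first.
          attach {h′ = λ v → (h v + D [ one a x ] v) + D Q₁ v} {k′ = λ v → D Q₃ v + (D [ X ] v + (δ x v + δ c v)) +
            D Q₄ v + (δ x v + δ d v) + k v} x W oW i hb1
            (via fr (via= (sym (weight e (dl x)))
              (lin (D [ W ] x ∷ S (dl x) Q ∷ δ a x ∷ δ b x ∷ δ c x ∷ δ d x ∷ S (dl x) Q₁ ∷ S (dl x) Q₂ ∷ []) (# 0 :+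
              κ 0 :+ # 1) (κ 0 :+ (# 2 :+ # 3 :+ (# 1 :+ (# 4 :+ # 5))) :+ (# 6 :+ (# 0 :+ # 7)))))) (λ v →
              lin (h v ∷ δ a v ∷ δ b v ∷ D Q₁ v ∷ δ x v ∷ []) (# 0 :+ (# 1 :+ # 2) :+ # 3) (# 0 :+ (# 1 :+ # 4) :+
              # 3 :+ # 2)) (λ v → via= (weight e′ (dl v))
              (lin (D Q₂ v ∷ δ c v ∷ δ d v ∷ k v ∷ S (dl v) Q₃ ∷ S₁ (dl v) X ∷ S (dl v) Q₄ ∷ δ x v ∷ []) (# 0 :+
              (# 1 :+ # 2 :+ # 3) :+ (# 4 :+ (# 5 :+ # 6))) (# 4 :+ (# 5 :+ (# 7 :+ # 1)) :+ # 6 :+ (# 7 :+ # 2) :+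
              # 3 :+ # 0))) (via x1
              (lin (δ x x ∷ h x ∷ δ a x ∷ D Q₁ x ∷ []) (κ 1 :+ # 0) (# 1 :+ (# 2 :+ # 0) :+ # 3 :+ κ 1))) (via x1
              (via x1 (lin (δ x x ∷ D Q₃ x ∷ D [ X ] x ∷ δ c x ∷ D Q₄ x ∷ δ d x ∷ k x ∷ []) (κ 2 :+ # 0 :+ # 0) (# 1
              :+ (# 2 :+ (# 0 :+ # 3)) :+ # 4 :+ (# 0 :+ # 5) :+ # 6 :+ κ 1 :+ κ 1))))
          | attachᵐ {h′ = λ v → (h v + (δ a v + δ x v)) + D Q₁ v + (D [ W ] v + (δ x v + δ b v)) + D Q₃ v} {k′ = λ v
            → (D Q₄ v + D [ one x d ] v) + k v} x X oX j
            (via= kc (via= p0 (via (δ≤0 d≢c) (via (δ≤1 c c)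
              (lin (D Q₄ c ∷ δ c c ∷ δ d c ∷ k c ∷ []) (# 0 :+ (# 1 :+ # 2 :+ # 3) :+ κ 0 :+ κ 0 :+ κ 0 :+ κ 1) (κ 1
              :+ # 3 :+ # 0 :+ # 2 :+ # 1)))))) (via fr (via= (sym (weight e (dl x))) (via= (sym (weight e′ (dl x)))
              (lin (D [ X ] x ∷ S (dl x) Q ∷ S (dl x) Q₂ ∷ δ a x ∷ δ b x ∷ δ c x ∷ δ d x ∷ S (dl x) Q₁ ∷ S₁ (dl x) W
              ∷ S (dl x) Q₃ ∷ S (dl x) Q₄ ∷ []) (# 0 :+ κ 0 :+ # 1 :+ # 2) (κ 0 :+ (# 3 :+ # 4 :+ (# 1 :+ (# 5 :+
              # 6))) :+ (# 7 :+ (# 8 :+ # 2)) :+ (# 9 :+ (# 0 :+ # 10)))))))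
            (λ v → lin (h v ∷ δ a v ∷ δ b v ∷ D Q₁ v ∷ D [ W ] v ∷ D Q₃ v ∷ δ x v ∷ []) (# 0 :+ (# 1 :+ # 2) :+ # 3
              :+ # 4 :+ # 5) (# 0 :+ (# 1 :+ # 6) :+ # 3 :+ (# 4 :+ (# 6 :+ # 2)) :+ # 5)) (λ v →
              lin (D Q₄ v ∷ δ c v ∷ δ d v ∷ k v ∷ δ x v ∷ []) (# 0 :+ (# 1 :+ # 2 :+ # 3)) (# 0 :+ (# 4 :+ # 2) :+
              # 3 :+ # 1)) (via x1 (via x1
              (lin (δ x x ∷ h x ∷ δ a x ∷ D Q₁ x ∷ D [ W ] x ∷ δ b x ∷ D Q₃ x ∷ []) (κ 2 :+ # 0 :+ # 0) (# 1 :+ (# 2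
              :+ # 0) :+ # 3 :+ (# 4 :+ (# 0 :+ # 5)) :+ # 6 :+ κ 1 :+ κ 1)))) (via x1
              (lin (δ x x ∷ D Q₄ x ∷ δ d x ∷ k x ∷ []) (κ 1 :+ # 0) (# 1 :+ (# 0 :+ # 2) :+ # 3 :+ κ 1)))
        ... | L , vL , eqL | R , vR , eqR = [ one a x ] ⋄ Q₁ ⋄ L ⋄ Q₃ ⋄ R ⋄ Q₄ ⋄ [ one x d ] ,
          ( (ha , via= (sym (eqL (dl x))) (via= (sym (eqR (dl x))) (via x1 (via x1
            (lin (S (dl x) L ∷ S (dl x) R ∷ δ x x ∷ S (dl x) Q₁ ∷ S (dl x) Q₃ ∷ S (dl x) Q₄ ∷ δ d x ∷ k x ∷ S₁ (dl
            x) W ∷ dl x b x ∷ S₁ (dl x) X ∷ dl x c x ∷ []) (κ 2 :+ # 0 :+ # 1 :+ # 2 :+ # 2) (# 3 :+ (# 0 :+ (# 4 :+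
            (# 1 :+ (# 5 :+ (# 2 :+ # 6))))) :+ # 7 :+ (# 8 :+ (# 2 :+ # 9)) :+ (# 10 :+ (# 2 :+ # 11)) :+ κ 1 :+
            κ 1))))))
          , Valid-mono Q₁ (λ v j → via (δ≤0 (avoids Q₁ q0 j))
            (lin (h v ∷ δ a v ∷ δ b v ∷ δ x v ∷ []) (# 0 :+ (# 1 :+ # 2) :+ κ 0) (# 0 :+ (# 1 :+ # 3) :+ # 2))) (λ v
            j → via= (sym (eqL (dl v))) (via= (weight e′ (dl v)) (via= (sym (eqR (dl v)))
            (lin (S₁ (dl v) W ∷ S (dl v) Q₂ ∷ δ c v ∷ δ d v ∷ k v ∷ S (dl v) L ∷ S (dl v) Q₃ ∷ S₁ (dl v) X ∷ S (dl
            v) Q₄ ∷ S (dl v) R ∷ δ x v ∷ dl v b x ∷ []) (# 0 :+ # 1 :+ (# 2 :+ # 3 :+ # 4) :+ # 5 :+ (# 6 :+ (# 7 :+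
            # 8)) :+ # 9) (# 5 :+ (# 6 :+ (# 9 :+ (# 8 :+ (# 10 :+ # 3)))) :+ # 4 :+ (# 0 :+ (# 10 :+ # 11)) :+ # 1
            :+ (# 7 :+ (# 10 :+ # 2))))))) v₁
          , Valid-≤ L (λ v → ≤-refl) (λ v → via= (sym (eqR (dl v)))
            (lin (S (dl v) Q₃ ∷ S₁ (dl v) X ∷ δ x v ∷ δ c v ∷ S (dl v) Q₄ ∷ δ d v ∷ k v ∷ S (dl v) R ∷ []) (# 0 :+
            (# 1 :+ (# 2 :+ # 3)) :+ # 4 :+ (# 2 :+ # 5) :+ # 6 :+ # 7) (# 0 :+ (# 7 :+ (# 4 :+ (# 2 :+ # 5))) :+
            # 6 :+ (# 1 :+ (# 2 :+ # 3))))) vL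
          , Valid-≤ Q₃ (λ v → via= (sym (eqL (dl v)))
            (lin (h v ∷ δ a v ∷ δ b v ∷ S (dl v) Q₁ ∷ S₁ (dl v) W ∷ S (dl v) L ∷ δ x v ∷ []) (# 0 :+ (# 1 :+ # 2) :+
            # 3 :+ # 4 :+ # 5) (# 0 :+ (# 1 :+ # 6) :+ # 3 :+ # 5 :+ (# 4 :+ (# 6 :+ # 2))))) (λ v → via= (sym (eqR
            (dl v))) (lin (S₁ (dl v) X ∷ S (dl v) Q₄ ∷ δ c v ∷ δ d v ∷ k v ∷ S (dl v) R ∷ δ x v ∷ []) (# 0 :+ # 1 :+
            (# 2 :+ # 3 :+ # 4) :+ # 5) (# 5 :+ (# 1 :+ (# 6 :+ # 3)) :+ # 4 :+ (# 0 :+ (# 6 :+ # 2))))) v₃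
          , Valid-≤ R (λ v → via= (sym (eqL (dl v)))
            (lin (h v ∷ δ a v ∷ δ x v ∷ S (dl v) Q₁ ∷ S₁ (dl v) W ∷ δ b v ∷ S (dl v) Q₃ ∷ S (dl v) L ∷ []) (# 0 :+
            (# 1 :+ # 2) :+ # 3 :+ (# 4 :+ (# 2 :+ # 5)) :+ # 6 :+ # 7) (# 0 :+ (# 1 :+ # 2) :+ # 3 :+ # 7 :+ # 6 :+
            (# 4 :+ (# 2 :+ # 5))))) (λ v → ≤-refl) vR
          , Valid-mono Q₄ (λ v j → via= (sym (eqL (dl v))) (via= (sym (eqR (dl v)))
            (lin (h v ∷ δ a v ∷ δ b v ∷ S (dl v) Q₁ ∷ S₁ (dl v) W ∷ S (dl v) Q₃ ∷ S₁ (dl v) X ∷ S (dl v) L ∷ S (dl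
            v) R ∷ δ x v ∷ dl v c x ∷ []) (# 0 :+ (# 1 :+ # 2) :+ # 3 :+ # 4 :+ # 5 :+ # 6 :+ # 7 :+ # 8) (# 0 :+
            (# 1 :+ # 9) :+ # 3 :+ # 7 :+ # 5 :+ # 8 :+ (# 4 :+ (# 9 :+ # 2)) :+ (# 6 :+ (# 9 :+ # 10)))))) (λ v j →
            via (δ≤0 (avoids Q₄ p0 j))
            (lin (δ c v ∷ δ d v ∷ k v ∷ δ x v ∷ []) (# 0 :+ # 1 :+ # 2 :+ κ 0) (# 3 :+ # 1 :+ # 2 :+ # 0))) v₄
          , (via= (sym (eqL (dl x))) (via= (sym (eqR (dl x))) (via x1 (via x1
            (lin (S (dl x) L ∷ S (dl x) R ∷ δ x x ∷ h x ∷ δ a x ∷ D Q₁ x ∷ D Q₃ x ∷ D Q₄ x ∷ S₁ (dl x) W ∷ dl x b x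
            ∷ S₁ (dl x) X ∷ dl x c x ∷ []) (κ 2 :+ # 0 :+ # 1 :+ # 2 :+ # 2) (# 3 :+ (# 4 :+ # 2) :+ # 5 :+ # 0 :+
            # 6 :+ # 1 :+ # 7 :+ (# 8 :+ (# 2 :+ # 9)) :+ (# 10 :+ (# 2 :+ # 11)) :+ κ 1 :+ κ 1))))) , kd)) ,
          λ f → via≡ (eqL f) (via≡ (eqR f) (via≡ (sym (weight e f)) (via≡ (sym (weight e′ f))
            (lin≡ (f a x ∷ f x a ∷ S f Q₁ ∷ S f L ∷ S f Q₃ ∷ S f R ∷ S f Q₄ ∷ sw f x d ∷ sw f a b ∷ sw f c d ∷ S₁ f
            W ∷ sw f x b ∷ S₁ f X ∷ sw f x c ∷ S f Q ∷ S f Q₂ ∷ []) (# 0 :+ # 1 :+ (# 2 :+ (# 3 :+ (# 4 :+ (# 5 :+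
            (# 6 :+ # 7))))) :+ (# 8 :+ # 9) :+ (# 10 :+ # 11) :+ (# 12 :+ # 13) :+ # 14 :+ # 15) (# 8 :+ (# 14 :+
            # 9) :+ (# 1 :+ # 0 :+ # 11 :+ (# 13 :+ # 7)) :+ # 3 :+ # 5 :+ (# 2 :+ (# 10 :+ # 15)) :+ (# 4 :+ (# 12
            :+ # 6)))))))

  -- Locating the edges to be pinched

  data Same (u w : Vertex) : Vertex → Vertex → Set where
    same : Same u w u w
    swap : Same u w w u

  sw-same : ∀ {u w a b} f → Same u w a b → sw f u w ≡ sw f a b
  sw-same f same = refl
  sw-same {u} {w} f swap = lin≡ (f u w ∷ f w u ∷ []) (# 0 :+ # 1) (# 1 :+ # 0)

  opaque
    -- A test weight: its symmetrised sum over a family is positive exactly if the family contains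
    -- an edge `ab`, so equations between weights suffice to find edges.
    ind : Vertex → Vertex → Weight
    ind a b u w = if ⌊ a ≟ u ⌋ ∧ ⌊ b ≟ w ⌋ then 1 else 0

    ind-refl : ∀ a b → 1 ≤ ind a b a b
    ind-refl a b with a ≟ a | b ≟ b
    ... | yes _ | yes _ = ≤-refl
    ... | no p  | _     = ⊥-elim (p refl)
    ... | yes _ | no p  = ⊥-elim (p refl)

    ind-hit : ∀ a b u w → (a ≡ u × b ≡ w) ⊎ ind a b u w ≡ 0
    ind-hit a b u w with a ≟ u | b ≟ w
    ... | yes p | yes q = inj₁ (p , q)
    ... | yes p | no q  = inj₂ refl
    ... | no p  | _     = inj₂ refl

  sw-ind : ∀ a b u w → Same u w a b ⊎ sw (ind a b) u w ≡ 0
  sw-ind a b u w with ind-hit a b u w | ind-hit a b w u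
  ... | inj₁ (refl , refl) | _ = inj₁ same
  ... | inj₂ _ | inj₁ (refl , refl) = inj₁ swap
  ... | inj₂ p | inj₂ q = inj₂ (cong₂ _+_ p q)

  end-∷ʳ : ∀ c M b → end c (M ∷ʳ b) ≡ b
  end-∷ʳ c []      b = refl
  end-∷ʳ c (a ∷ M) b = end-∷ʳ a M b

  cnt-∷ʳ : ∀ M b v → cnt (M ∷ʳ b) v ≡ cnt M v + δ b v
  cnt-∷ʳ []      b v = lin≡ (δ b v ∷ []) (# 0 :+ κ 0) (κ 0 :+ # 0)
  cnt-∷ʳ (a ∷ M) b v = via≡ (cnt-∷ʳ M b v)
    (lin≡ (δ a v ∷ cnt (M ∷ʳ b) v ∷ cnt M v ∷ δ b v ∷ []) (# 0 :+ # 1 :+ (# 2 :+ # 3)) (# 0 :+ # 2 :+ # 3 :+ # 1))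

  wlk-∷ʳ : ∀ f c M b → wlk f c (M ∷ʳ b) ≡ wlk f c M + sw f (end c M) b
  wlk-∷ʳ f c []      b = lin≡ (sw f c b ∷ []) (# 0 :+ κ 0) (κ 0 :+ # 0)
  wlk-∷ʳ f c (a ∷ M) b = via≡ (wlk-∷ʳ f a M b)
    (lin≡ (sw f c a ∷ wlk f a (M ∷ʳ b) ∷ wlk f a M ∷ sw f (end a M) b ∷ []) (# 0 :+ # 1 :+ (# 2 :+ # 3)) (# 0 :+ # 2
    :+ # 3 :+ # 1))

  -- The path from `e` is cut at an edge `ab`. The first part is stored backwards, from the cut to
  -- `e`, as arms are read outwards.
  record Cut (a b e : Vertex) (B : List Vertex) : Set where
    constructor cut
    field
      {c d}  : Vertex
      {M N}  : List Vertex
      edge   : Same c d a b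
      end-M  : end c M ≡ e
      end-N  : end d N ≡ end e B
      cn-cut : ∀ v → cn c M v + cn d N v ≡ cn e B v
      S-cut  : ∀ f → wlk f c M + sw f c d + wlk f d N ≡ wlk f e B

  find-cut : ∀ a b e B → 1 ≤ wlk (ind a b) e B → Cut a b e B
  find-cut a b e (e′ ∷ B) i with sw-ind a b e e′
  ... | inj₁ s = cut {c = e} {e′} {[]} {B} s refl refl (λ v →
    lin≡ (δ e v ∷ δ e′ v + cnt B v ∷ []) (# 0 :+ κ 0 :+ # 1) (# 0 :+ # 1)) (λ f →
    lin≡ (sw f e e′ ∷ wlk f e′ B ∷ []) (κ 0 :+ # 0 :+ # 1) (# 0 :+ # 1))
  ... | inj₂ z with find-cut a b e′ B (via i (via= z
    (lin (ind a b e e′ + ind a b e′ e ∷ wlk (ind a b) e′ B ∷ []) (κ 1 :+ (# 0 :+ # 1) :+ κ 0) (# 1 :+ κ 1 :+ # 0))))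
  ... | cut {c} {d} {M} {N} s eM eN eqc eqS = cut {c = c} {d} {M ∷ʳ e} {N} s (end-∷ʳ c M e) eN
    (λ v → via≡ (cnt-∷ʳ M e v) (via≡ (eqc v)
      (lin≡ (δ c v ∷ cnt (M ∷ʳ e) v ∷ δ d v + cnt N v ∷ cnt M v ∷ δ e v ∷ δ e′ v + cnt B v ∷ []) (# 0 :+ # 1 :+ # 2
      :+ (# 3 :+ # 4) :+ # 5) (# 4 :+ # 5 :+ # 1 :+ (# 0 :+ # 3 :+ # 2)))))
    (λ f → via≡ (wlk-∷ʳ f c M e) (via≡ (eqS f) (via≡ (cong (λ t → sw f t e) eM)
      (lin≡ (wlk f c (M ∷ʳ e) ∷ sw f c d ∷ wlk f d N ∷ wlk f c M ∷ sw f (end c M) e ∷ wlk f e′ B ∷ f e′ e ∷ f e e′ ∷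
      []) (# 0 :+ # 1 :+ # 2 :+ (# 3 :+ # 4) :+ # 5 :+ (# 6 :+ # 7)) (# 7 :+ # 6 :+ # 5 :+ # 0 :+ (# 3 :+ # 1 :+
      # 2) :+ # 4)))))

  Pinched-same : ∀ {h k} M x {a b c d a′ b′ c′ d′} → Same a b a′ b′ → Same c d c′ d′ → Pinched h k M a b c d x →
    Pinched h k M a′ b′ c′ d′ x
  Pinched-same M x same same p = p
  Pinched-same M x {a} {b} {c} {d} same swap (L , vL , eq) = L , vL , λ f → via≡ (eq f)
    (lin≡ (S f L ∷ sw f a b ∷ f d c ∷ f c d ∷ S f M ∷ sw f x a + sw f x b ∷ sw f x c ∷ sw f x d ∷ []) (# 0 :+ (# 1
    :+ (# 2 :+ # 3)) :+ (# 4 :+ (# 5 :+ (# 6 :+ # 7)))) (# 4 :+ (# 5 :+ (# 7 :+ # 6)) :+ (# 0 :+ (# 1 :+ (# 3 :+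
    # 2)))))
  Pinched-same M x {a} {b} {c} {d} swap same (L , vL , eq) = L , vL , λ f → via≡ (eq f)
    (lin≡ (S f L ∷ f b a ∷ f a b ∷ sw f c d ∷ S f M ∷ sw f x a ∷ sw f x b ∷ sw f x c + sw f x d ∷ []) (# 0 :+ (# 1
    :+ # 2 :+ # 3) :+ (# 4 :+ (# 5 :+ # 6 :+ # 7))) (# 4 :+ (# 6 :+ # 5 :+ # 7) :+ (# 0 :+ (# 2 :+ # 1 :+ # 3))))
  Pinched-same M x {a} {b} {c} {d} swap swap (L , vL , eq) = L , vL , λ f → via≡ (eq f)
    (lin≡ (S f L ∷ f b a ∷ f a b ∷ f d c ∷ f c d ∷ S f M ∷ sw f x a ∷ sw f x b ∷ sw f x c ∷ sw f x d ∷ []) (# 0 :+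
    (# 1 :+ # 2 :+ (# 3 :+ # 4)) :+ (# 5 :+ (# 6 :+ # 7 :+ (# 8 :+ # 9)))) (# 5 :+ (# 7 :+ # 6 :+ (# 9 :+ # 8)) :+
    (# 0 :+ (# 2 :+ # 1 :+ (# 4 :+ # 3)))))

  Pinched-comm : ∀ {h k} M x {a b c d} → Pinched h k M a b c d x → Pinched h k M c d a b x
  Pinched-comm M x {a} {b} {c} {d} (L , vL , eq) = L , vL , λ f → via≡ (eq f)
    (lin≡ (S f L ∷ sw f c d ∷ sw f a b ∷ S f M ∷ sw f x a + sw f x b ∷ sw f x c + sw f x d ∷ []) (# 0 :+ (# 1 :+
    # 2) :+ (# 3 :+ (# 4 :+ # 5))) (# 3 :+ (# 5 :+ # 4) :+ (# 0 :+ (# 2 :+ # 1))))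

  one-chain-up : ∀ {h k x} a A b B {c d} M N → UpOK h k a A b B → Fresh x [ walk true a A b B ] →
    end c M ≡ b → end d N ≡ end b B → (∀ v → cn c M v + cn d N v ≡ cn b B v) →
    (∀ f → wlk f c M + sw f c d + wlk f d N ≡ wlk f b B) → Pinched h k [ walk true a A b B ] a b c d x
  one-chain-up {h} {k} {x} a A b B {c} {d} M N o fr eM eN eqc eqS =
    [ walk true a A x (d ∷ N) ] ⋄ [ one x b ] ⋄ [ one x c ] ⋄ arm true c M ,
    ( mkUp g (λ v → via (ends o v) (via= (cong (λ t → δ t v) eN)
      (lin (δ (end a A) v ∷ δ (end x (d ∷ N)) v ∷ h v ∷ δ (end b B) v ∷ []) (# 0 :+ # 1 :+ # 2 :+ # 3) (# 2 :+ (# 0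
      :+ # 3) :+ # 1)))) (s _ (simpleˡ o))
        (s _ (λ v → via (simpleʳ o v) (via= (cong (λ t → δ t v) (sym eN))
          (lin (δ a v + cnt A v + (δ b v + cnt B v) ∷ δ (end b B) v ∷ δ (end d N) v ∷ []) (# 0 :+ (κ 1 :+ # 1) :+
          # 2) (κ 1 :+ # 2 :+ # 0 :+ # 1)))))
    , (via x1 (via x1
      (lin (δ x x ∷ h x ∷ wlk (dl x) a A ∷ δ a x ∷ δ d x ∷ wlk (dl x) d N ∷ []) (κ 2 :+ # 0 :+ # 0) (# 1 :+ (# 2 :+
      (# 3 :+ # 0) :+ (# 0 :+ # 4 :+ # 5)) :+ κ 1 :+ κ 1))) , via (good o b (via= (sym (δ-refl b))
      (lin (δ b b ∷ δ a b ∷ cnt A b ∷ cnt B b ∷ []) (κ 1 :+ # 0) (# 1 :+ # 2 :+ (# 0 :+ # 3) :+ κ 1))))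
      (lin (k b ∷ δ x b ∷ δ c b ∷ S (dl b) (arm true c M) ∷ []) (κ 2 :+ # 0) (# 1 :+ # 2 :+ # 3 :+ # 0 :+ κ 2)))
    , (via x1 (via x1
      (lin (δ x x ∷ h x ∷ wlk (dl x) a A ∷ δ a x ∷ δ d x ∷ wlk (dl x) d N ∷ δ b x ∷ []) (κ 2 :+ # 0 :+ # 0) (# 1 :+
      (# 2 :+ (# 3 :+ # 0) :+ (# 0 :+ # 4 :+ # 5)) :+ (# 0 :+ # 6) :+ κ 1 :+ κ 1))) , via (good o c (via= (eqc c)
      (via= (sym (δ-refl c))
      (lin (δ b c + cnt B c ∷ δ c c ∷ δ a c ∷ cnt A c ∷ cnt M c ∷ δ d c ∷ cnt N c ∷ []) (κ 1 :+ # 0 :+ # 1) (# 2 :+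
      # 3 :+ # 0 :+ (# 1 :+ # 4 :+ (# 5 :+ # 6)) :+ κ 1)))))
      (lin (k c ∷ D (arm true c M) c ∷ []) (κ 2 :+ # 0) (# 1 :+ # 0 :+ κ 2)))
    , arm-up c M (mkArm (λ v i → good o v (via i (via= (eqc v)
      (lin (δ c v + cnt M v ∷ δ b v + cnt B v ∷ δ a v ∷ cnt A v ∷ δ d v ∷ cnt N v ∷ []) (κ 1 :+ # 0 :+ # 1) (# 2 :+
      # 3 :+ # 1 :+ κ 1 :+ (# 0 :+ (# 4 :+ # 5))))))) (via= (sym (δ-refl c))
      (lin (δ c c ∷ h c ∷ wlk (dl c) a A ∷ δ a c ∷ δ x c ∷ δ d c ∷ wlk (dl c) d N ∷ δ b c ∷ []) (κ 1 :+ # 0) (# 1 :+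
      (# 2 :+ (# 3 :+ # 4) :+ (# 4 :+ # 5 :+ # 6)) :+ (# 4 :+ # 7) :+ (# 4 :+ # 0) :+ κ 1)))
        (via= (sym (δ-≡ (sym eM)))
          (lin (δ b (end c M) ∷ h (end c M) ∷ wlk (dl (end c M)) a A ∷ δ a (end c M) ∷ δ x (end c M) ∷ δ d (end c M)
          ∷ wlk (λ u z → δ u (end c M)) d N ∷ δ c (end c M) ∷ []) (κ 1 :+ # 0) (# 1 :+ (# 2 :+ (# 3 :+ # 4) :+ (# 4
          :+ # 5 :+ # 6)) :+ (# 4 :+ # 0) :+ (# 4 :+ # 7) :+ κ 1))) (λ v → via (uniqueˡ (flipUp o) v) (via= (eqc v)
          (lin (δ c v + cnt M v ∷ δ b v + cnt B v ∷ δ d v ∷ cnt N v ∷ []) (# 0 :+ κ 1 :+ # 1) (κ 1 :+ # 1 :+ (# 0 :+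
          (# 2 :+ # 3)))))))) ,
    λ f → via≡ (S-arm f true c M) (via≡ (eqS f)
      (lin≡ (wlk f a A ∷ f a x ∷ f x a ∷ sw f x d ∷ wlk f d N ∷ sw f x b ∷ sw f x c ∷ S f (arm true c M) ∷ sw f a b
      ∷ sw f c d ∷ wlk f c M ∷ wlk f b B ∷ []) (# 0 :+ (# 1 :+ # 2) :+ (# 3 :+ # 4) :+ (# 5 :+ (# 6 :+ # 7)) :+ (# 8
      :+ # 9) :+ # 10 :+ # 11) (# 0 :+ # 8 :+ # 11 :+ (# 2 :+ # 1 :+ # 5 :+ (# 6 :+ # 3)) :+ # 7 :+ (# 10 :+ # 9 :+
      # 4))))
    where
    x1 = ≤-reflexive (sym (δ-refl x))
    fr′ = ≤-trans (occ≤D true a A b B x) fr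
    g : ∀ v → 1 ≤ cn a A v + cn x (d ∷ N) v → 2 ≤ D ([ one x b ] ⋄ [ one x c ] ⋄ arm true c M) v + k v
    g v i with δ-split x v
    ... | inj₁ refl = via x1 (via x1
      (lin (δ v v ∷ δ b v ∷ δ c v ∷ S (dl v) (arm true c M) ∷ k v ∷ []) (κ 2 :+ # 0 :+ # 0) (# 0 :+ # 1 :+ (# 0 :+
      # 2 :+ # 3) :+ # 4 :+ κ 1 :+ κ 1)))
    ... | inj₂ z = via (good o v (via i (via= z (via= (eqc v)
      (lin (δ a v + cnt A v ∷ δ x v ∷ δ d v + cnt N v ∷ δ b v + cnt B v ∷ δ c v ∷ cnt M v ∷ []) (κ 1 :+ (# 0 :+ (# 1
      :+ # 2)) :+ κ 0 :+ # 3) (# 0 :+ # 3 :+ κ 1 :+ # 1 :+ (# 4 :+ # 5 :+ # 2)))))))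
      (lin (k v ∷ δ x v ∷ δ b v ∷ δ c v ∷ S (dl v) (arm true c M) ∷ []) (κ 2 :+ # 0) (# 1 :+ # 2 :+ (# 1 :+ # 3 :+
      # 4) :+ # 0 :+ κ 2))
    s : ∀ (t : Vertex → ℕ) → (∀ v → cn a A v + cn b B v ≤ 1 + t v) → ∀ v → cn a A v + cn x (d ∷ N) v ≤ 1 + t v
    s t le v with δ-split x v
    ... | inj₁ refl = via fr′ (via= (eqc x) (via (δ≤1 x x)
      (lin (δ a v + cnt A v ∷ δ v v ∷ δ d v + cnt N v ∷ δ b v + cnt B v ∷ t v ∷ δ c v ∷ cnt M v ∷ []) (# 0 :+ (# 1
      :+ # 2) :+ κ 0 :+ # 3 :+ κ 1) (κ 1 :+ # 4 :+ (# 0 :+ # 3) :+ (# 5 :+ # 6 :+ # 2) :+ # 1))))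
    ... | inj₂ e = via (le v) (via= e (via= (eqc v)
      (lin (δ a v + cnt A v ∷ δ x v ∷ δ d v + cnt N v ∷ t v ∷ δ b v + cnt B v ∷ δ c v ∷ cnt M v ∷ []) (# 0 :+ (# 1
      :+ # 2) :+ (κ 1 :+ # 3) :+ κ 0 :+ # 4) (κ 1 :+ # 3 :+ (# 0 :+ # 4) :+ # 1 :+ (# 5 :+ # 6 :+ # 2)))))

  one-chain : ∀ {h k x} u a A b B c d → OK h (walk u a A b B) k → Fresh x [ walk u a A b B ] → Cut c d b B →
    Pinched h k [ walk u a A b B ] a b c d x
  one-chain {x = x} true a A b B c d o fr (cut {M = M} {N} s eM eN eqc eqS) =
    Pinched-same [ walk true a A b B ] x same s (one-chain-up a A b B M N o fr eM eN eqc eqS)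
  one-chain {x = x} false a A b B c d o fr ct with one-chain {x = x} true a A b B c d o fr ct
  ... | L , vL , eq = mir L , Valid-mir L vL , λ f → via≡ (S-mir f L) (via≡ (eq f)
    (lin≡ (S f (mir L) ∷ sw f a b ∷ sw f c d ∷ S f L ∷ wlk f a A ∷ wlk f b B ∷ sw f x a + sw f x b + (sw f x c + sw
    f x d) ∷ []) (# 0 :+ (# 1 :+ # 2) :+ # 3 :+ (# 4 :+ # 1 :+ # 5 :+ # 6)) (# 4 :+ # 1 :+ # 5 :+ # 6 :+ # 0 :+ (# 3
    :+ (# 1 :+ # 2)))))

  data Edge : Chain → Vertex → Vertex → Set where
    one  : ∀ {u w} → Edge (one u w) u w
    walk : ∀ {u c A d B} → Edge (walk u c A d B) c d

  two-chains : ∀ {h k x a b c d} C₁ Q C₂ → Edge C₁ a b → Edge C₂ c d → Valid h ([ C₁ ] ⋄ Q ⋄ [ C₂ ]) k →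
    Fresh x ([ C₁ ] ⋄ Q ⋄ [ C₂ ]) → Pinched h k ([ C₁ ] ⋄ Q ⋄ [ C₂ ]) a b c d x
  two-chains _ Q _ one one v fr = one-one _ _ Q _ _ v fr
  two-chains _ Q _ one walk v fr = one-walk _ _ Q _ _ _ _ _ v fr
  two-chains _ Q _ walk one v fr = walk-one _ _ _ _ _ Q _ _ v fr
  two-chains _ Q _ walk walk v fr = walk-walk _ _ _ _ _ Q _ _ _ _ _ v fr

  -- Pinching changes the degree of no vertex but `x`, where it adds four, so the chains around the
  -- pinched part stay valid.
  pinch-within : ∀ {h k T a b c d x} P M R → T ⟿ P ⋄ M ⋄ R → Fresh x T →
    (∀ {h k} → Valid h M k → Fresh x M → Pinched h k M a b c d x) → Valid h T k → Pinched h k T a b c d x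
  pinch-within {h} {k} {T} {a} {b} {c} {d} {x} P M R e fr p vT with valid e vT
  ... | vP , vM , vR with p vM (via fr (via= (sym (weight e (dl x)))
    (lin (S (dl x) M ∷ S (dl x) T ∷ S (dl x) P ∷ S (dl x) R ∷ []) (# 0 :+ κ 0 :+ # 1) (κ 0 :+ # 1 :+ (# 2 :+ (# 0 :+
    # 3))))))
  ... | L , vL , eq = P ⋄ L ⋄ R ,
    (Valid-≤ P (λ v → ≤-refl) (λ v → via= (sym (eq (dl v)))
      (lin (S (dl v) M ∷ S (dl v) R ∷ k v ∷ S (dl v) L ∷ dl v a b ∷ dl v b a ∷ dl v c d ∷ dl v d c ∷ dl v x a ∷ [])
      (# 0 :+ # 1 :+ # 2 :+ (# 3 :+ (# 4 :+ # 5 :+ (# 6 :+ # 7)))) (# 3 :+ # 1 :+ # 2 :+ (# 0 :+ (# 8 :+ # 4 :+ (# 8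
      :+ # 5) :+ (# 8 :+ # 6 :+ (# 8 :+ # 7))))))) vP , vL , Valid-≤ R (λ v → via= (sym (eq (dl v)))
      (lin (h v + S (dl v) P ∷ S (dl v) M ∷ S (dl v) L ∷ dl v a b ∷ dl v b a ∷ dl v c d ∷ dl v d c ∷ dl v x a ∷ [])
      (# 0 :+ # 1 :+ (# 2 :+ (# 3 :+ # 4 :+ (# 5 :+ # 6)))) (# 0 :+ # 2 :+ (# 1 :+ (# 7 :+ # 3 :+ (# 7 :+ # 4) :+
      (# 7 :+ # 5 :+ (# 7 :+ # 6))))))) (λ v → ≤-refl) vR) ,
    λ f → via≡ (eq f) (via≡ (sym (weight e f))
      (lin≡ (S f P ∷ S f L ∷ S f R ∷ sw f a b + sw f c d ∷ S f M ∷ sw f x a + sw f x b + (sw f x c + sw f x d) ∷ S f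
      T ∷ []) (# 0 :+ (# 1 :+ # 2) :+ # 3 :+ (# 4 :+ # 5) :+ # 6) (# 6 :+ # 5 :+ (# 1 :+ # 3) :+ (# 0 :+ (# 4 :+
      # 2)))))

  shift⟿ : ∀ u c A d e B → [ walk u c A d (e ∷ B) ] ⟿ [ walk u d (c ∷ A) e B ]
  shift⟿ true c A d e B = mk⟿ (λ f →
    lin≡ (wlk f c A ∷ f c d ∷ f d c ∷ sw f d e ∷ wlk f e B ∷ []) (# 0 :+ (# 1 :+ # 2) :+ (# 3 :+ # 4)) (# 2 :+ # 1
    :+ # 0 :+ # 3 :+ # 4)) λ o → flipUp (shift (flipUp o))
  shift⟿ false c A d e B = mk⟿ (λ f →
    lin≡ (wlk f c A ∷ f c d ∷ f d c ∷ sw f d e ∷ wlk f e B ∷ []) (# 0 :+ (# 1 :+ # 2) :+ (# 3 :+ # 4)) (# 2 :+ # 1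
    :+ # 0 :+ # 3 :+ # 4)) λ o → flipUp (shift (flipUp o))

  flip⟿ : ∀ u c A d B → [ walk u c A d B ] ⟿ [ walk u d B c A ]
  flip⟿ true c A d B = mk⟿ (λ f →
    lin≡ (wlk f c A ∷ f c d ∷ f d c ∷ wlk f d B ∷ []) (# 0 :+ (# 1 :+ # 2) :+ # 3) (# 3 :+ (# 2 :+ # 1) :+ # 0))
    flipUp
  flip⟿ false c A d B = mk⟿ (λ f →
    lin≡ (wlk f c A ∷ f c d ∷ f d c ∷ wlk f d B ∷ []) (# 0 :+ (# 1 :+ # 2) :+ # 3) (# 3 :+ (# 2 :+ # 1) :+ # 0))
    flipUp

  record Centred (a b : Vertex) (C : Chain) : Set where
    constructor centred
    field
      {c d} : Vertex
      {C′}  : Chain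
      edge  : Same c d a b
      mid   : Edge C′ c d
      turn  : [ C ] ⟿ [ C′ ]

  turn-centred : ∀ {a b C C′} → [ C ] ⟿ [ C′ ] → Centred a b C′ → Centred a b C
  turn-centred e (centred s m t) = centred s m (⟿-trans e t)

  centreʳ : ∀ a b u c A d B → 1 ≤ wlk (ind a b) d B → Centred a b (walk u c A d B)
  centreʳ a b u c A d (e ∷ B) i with sw-ind a b d e
  ... | inj₁ s = centred s walk (shift⟿ u c A d e B)
  ... | inj₂ z = turn-centred (shift⟿ u c A d e B) (centreʳ a b u d (c ∷ A) e B (via i (via= z
    (lin (ind a b d e + ind a b e d ∷ wlk (ind a b) e B ∷ []) (κ 1 :+ (# 0 :+ # 1) :+ κ 0) (# 1 :+ κ 1 :+ # 0)))))

  centre : ∀ a b C → 1 ≤ S (ind a b) [ C ] → Centred a b C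
  centre a b (one u w) i with sw-ind a b u w
  ... | inj₁ s = centred s one ⟿-refl
  ... | inj₂ z = absurd (via i (via= z
    (lin (ind a b u w + ind a b w u ∷ []) (κ 1 :+ κ 0 :+ # 0 :+ κ 0) (κ 0 :+ κ 1 :+ # 0))))
  centre a b (walk u c A d B) i with sw-ind a b c d
  ... | inj₁ s = centred s walk ⟿-refl
  ... | inj₂ z with 1≤-split (wlk (ind a b) d B)
  ... | inj₂ j = centreʳ a b u c A d B j
  ... | inj₁ z′ = turn-centred (flip⟿ u c A d B) (centreʳ a b u d B c A (via i (via= z (via= z′
    (lin (wlk (ind a b) c A ∷ ind a b c d + ind a b d c ∷ wlk (ind a b) d B ∷ []) (κ 1 :+ (# 0 :+ # 1 :+ # 2) :+ κ 0
    :+ κ 0) (# 0 :+ κ 1 :+ # 1 :+ # 2))))))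

  record Found (a b : Vertex) (T : Seq) : Set where
    constructor found
    field
      {c d}           : Vertex
      {before after}  : Seq
      {C}             : Chain
      edge            : Same c d a b
      mid             : Edge C c d
      centred-split   : T ⟿ before ⋄ [ C ] ⋄ after

  locate : ∀ a b T → 1 ≤ S (ind a b) T → Found a b T
  locate a b [ C ] i with centre a b C i
  ... | centred s m t = found {before = ε} {ε} s m (⟿-trans t (⟿-trans (⋄-ε _) (⋄-cong ⟿-refl (⋄-εʳ _))))
  locate a b (P ⋄ Q) i with 1≤-split (S (ind a b) P)
  ... | inj₂ j with locate a b P j
  ...   | found {before = P₁} {P₂} {C} s m t = found s m (Split.⟿split (splitˡ Q (split {before = P₁} {C} {P₂} t)))
  locate a b (P ⋄ Q) i | inj₁ z with locate a b Q (via i (via= z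
    (lin (S (ind a b) P ∷ S (ind a b) Q ∷ []) (κ 1 :+ (# 0 :+ # 1) :+ κ 0) (# 1 :+ κ 1 :+ # 0))))
  ...   | found {before = Q₁} {Q₂} {C} s m t = found s m (Split.⟿split (splitʳ P (split {before = Q₁} {C} {Q₂} t)))

  -- The inequality for all weights says that both edges occur in the sequence, and twice if `ab`
  -- and `cd` are the same pair.
  pinch : ∀ {h k} T a b c d x → Valid h T k → Fresh x T →
    (∀ f → sw f a b + sw f c d ≤ S f T) → Pinched h k T a b c d x
  pinch {h} {k} T a b c d x vT fr le with locate a b T (via (le (ind a b)) (via (ind-refl a b)
    (lin (S (ind a b) T ∷ ind a b a b ∷ ind a b b a ∷ ind a b c d ∷ ind a b d c ∷ []) (κ 1 :+ # 0 :+ # 1) (# 0 :+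
    (# 1 :+ # 2 :+ (# 3 :+ # 4)) :+ κ 1))))
  ... | found {a′} {b′} {P} {R} {C} s m t = go m t
    where
    g = ind c d
    Result = Pinched h k T a b c d x
    inP : ∀ {C} → Edge C a′ b′ → T ⟿ P ⋄ [ C ] ⋄ R → 1 ≤ S g P → Result
    inP {C} m t i with locate c d P i
    ... | found {before = P₁} {P₂} {C₂} s₂ m₂ t₂ =
      pinch-within P₁ ([ C₂ ] ⋄ P₂ ⋄ [ C ]) R
        (⟿-trans t (⟿-trans (⋄-cong t₂ ⟿-refl) (⟿-trans (⋄-assoc P₁ ([ C₂ ] ⋄ P₂) ([ C ] ⋄ R))
          (⋄-cong ⟿-refl (⟿-trans (⋄-assoc⁻ ([ C₂ ] ⋄ P₂) [ C ] R) (⋄-cong (⋄-assoc [ C₂ ] P₂ [ C ]) ⟿-refl)))))) fr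
        (λ v f → Pinched-same ([ C₂ ] ⋄ P₂ ⋄ [ C ]) x s s₂ (Pinched-comm ([ C₂ ] ⋄ P₂ ⋄ [ C ]) x (two-chains C₂ P₂ C
          m₂ m v f))) vT
    inR : ∀ {C} → Edge C a′ b′ → T ⟿ P ⋄ [ C ] ⋄ R → 1 ≤ S g R → Result
    inR {C} m t i with locate c d R i
    ... | found {before = R₁} {R₂} {C₂} s₂ m₂ t₂ =
      pinch-within P ([ C ] ⋄ R₁ ⋄ [ C₂ ]) R₂
        (⟿-trans t (⋄-cong ⟿-refl (⟿-trans (⋄-cong ⟿-refl t₂) (⟿-trans (⋄-cong ⟿-refl (⋄-assoc⁻ R₁ [ C₂ ] R₂))
          (⋄-assoc⁻ [ C ] (R₁ ⋄ [ C₂ ]) R₂))))) fr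
        (λ v f → Pinched-same ([ C ] ⋄ R₁ ⋄ [ C₂ ]) x s s₂ (two-chains C R₁ C₂ m m₂ v f)) vT
    go : ∀ {C} → Edge C a′ b′ → T ⟿ P ⋄ [ C ] ⋄ R → Result
    go {C} m t with 1≤-split (S g P) | 1≤-split (S g R)
    ... | inj₂ i | _ = inP m t i
    ... | inj₁ _ | inj₂ i = inR m t i
    -- Tested with `g`, the inequality demands another edge besides `ab`, but a one-way chain has
    -- only one.
    go {one _ _} one t | inj₁ p | inj₁ r =
      absurd (via (le g) (via= (weight t g) (via (ind-refl c d) (via= (sw-same g s) (via= p (via= r
        (lin (S g T ∷ S g P ∷ ind c d a′ b′ + ind c d b′ a′ ∷ S (ind c d) R ∷ ind c d c d ∷ ind c d a b + ind c d b
        a ∷ g d c ∷ []) (κ 1 :+ κ 0 :+ # 0 :+ (# 1 :+ (# 2 :+ # 3)) :+ # 4 :+ # 5 :+ κ 0 :+ κ 0) (κ 0 :+ (# 5 :+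
        (# 4 :+ # 6)) :+ # 0 :+ κ 1 :+ # 2 :+ # 1 :+ # 3))))))))
    go {walk u _ A _ B} walk t | inj₁ p | inj₁ r with 1≤-split (wlk g b′ B)
    ... | inj₂ i = pinch-within P [ walk u a′ A b′ B ] R t fr
        (λ v f → Pinched-same [ walk u a′ A b′ B ] x s same (one-chain u a′ A b′ B c d v f (find-cut c d b′ B i)))
          vT
    -- The central edge is used up by `ab`, so only the other arm is left for `cd`.
    ... | inj₁ z = pinch-within P [ walk u b′ B a′ A ] R (⟿-trans t (⋄-cong ⟿-refl (⋄-cong (flip⟿ u a′ A b′ B)
      ⟿-refl))) fr
        (λ v f → Pinched-same [ walk u b′ B a′ A ] x (Same-sym s) same (one-chain u b′ B a′ A c d v f (find-cut c d
          a′ A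
          (via (le g) (via= (weight t g) (via (ind-refl c d) (via= (sw-same g s) (via= p (via= r (via= z
            (lin (S g T ∷ S g P ∷ wlk g a′ A ∷ ind c d a′ b′ + ind c d b′ a′ ∷ wlk g b′ B ∷ S g R ∷ ind c d c d ∷
            ind c d a b + ind c d b a ∷ g d c ∷ []) (κ 1 :+ # 0 :+ (# 1 :+ (# 2 :+ # 3 :+ # 4 :+ # 5)) :+ # 6 :+ # 7
            :+ κ 0 :+ κ 0 :+ κ 0) (# 2 :+ (# 7 :+ (# 6 :+ # 8)) :+ # 0 :+ κ 1 :+ # 3 :+ # 1 :+ # 5 :+
            # 4)))))))))))) vT
      where
      Same-sym : ∀ {u w a b} → Same u w a b → Same w u a b
      Same-sym same = swap
      Same-sym swap = same

-- Tight cuts and splitting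

module Rooted (n : ℕ) (r : Fin n) where

  open Chains n

  -- Inserting a deleted edge

  Status : Ctx → Ctx → Seq → Vertex → Set
  Status h k T w = (2 ≤ h w × 2 ≤ k w) ⊎ (h w ≤ 1 × k w ≤ 1 × 4 ≤ h w + D T w + k w)

  -- `left` and `right` name the half that contains the moment with degree two on both sides; the
  -- status is inherited by that half, so the search can go on there.
  data Middle (h k : Ctx) (P Q : Seq) (w : Vertex) : Set where
    both : 2 ≤ h w + D P w → 2 ≤ D Q w + k w → Middle h k P Q w
    left : 2 ≤ h w + D P w → Status h (λ v → D Q v + k v) P w → Middle h k P Q w
    right : 2 ≤ D Q w + k w → Status (λ v → h v + D P v) k Q w → Middle h k P Q w

  -- With degree four in all, a vertex has degree below two on at most one side of the junction.
  middle : ∀ h k P Q w → Status h k (P ⋄ Q) w → Middle h k P Q w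
  middle h k P Q w (inj₁ (p , q)) = both (≤-trans p (m≤m+n _ _)) (≤-trans q (m≤n+m _ _))
  middle h k P Q w (inj₂ (p , q , s)) with 2≤-split (h w + D P w) | 2≤-split (D Q w + k w)
  ... | inj₂ i | inj₂ j = both i j
  ... | inj₂ i | inj₁ j = left i (inj₂ (p , j , via s
    (lin (h w ∷ S (dl w) P ∷ S (dl w) Q ∷ k w ∷ []) (κ 4 :+ (# 0 :+ (# 1 :+ # 2) :+ # 3)) (# 0 :+ # 1 :+ (# 2 :+
    # 3) :+ κ 4))))
  ... | inj₁ i | inj₂ j = right j (inj₂ (i , q , via s
    (lin (h w ∷ S (dl w) P ∷ S (dl w) Q ∷ k w ∷ []) (κ 4 :+ (# 0 :+ (# 1 :+ # 2) :+ # 3)) (# 0 :+ # 1 :+ # 2 :+ # 3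
    :+ κ 4))))
  ... | inj₁ i | inj₁ j = absurd (via s (via i (via j
    (lin (h w ∷ S (dl w) P ∷ S (dl w) Q ∷ k w ∷ []) (κ 1 :+ κ 0 :+ (# 0 :+ (# 1 :+ # 2) :+ # 3) :+ κ 1 :+ κ 1) (κ 0
    :+ κ 4 :+ (# 0 :+ # 1) :+ (# 2 :+ # 3))))))

  no-window : ∀ {h k w} C → OK h C k → h w ≤ 1 → k w ≤ 1 → 4 ≤ h w + D [ C ] w + k w → ⊥
  no-window {h} {k} {w} C o p q s with OK-side C w o (via s (via p (via q
    (lin (h w ∷ D [ C ] w ∷ k w ∷ []) (κ 1 :+ (# 0 :+ # 1 :+ # 2) :+ κ 1 :+ κ 1) (# 1 :+ κ 4 :+ # 0 :+ # 2)))))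
  ... | inj₁ i = absurd (via i (via p (lin (h w ∷ []) (κ 1 :+ κ 0 :+ # 0 :+ κ 1) (κ 0 :+ κ 2 :+ # 0))))
  ... | inj₂ i = absurd (via i (via q (lin (k w ∷ []) (κ 1 :+ κ 0 :+ # 0 :+ κ 1) (κ 0 :+ κ 2 :+ # 0))))

  Extended : Ctx → Ctx → Seq → Vertex → Vertex → Set
  Extended h k T u v = Σ Seq λ T′ → Valid h T′ k × (∀ f → S f T′ ≡ S f T + sw f u v)

  insert-between : ∀ {h k} P Q u v → Valid h (P ⋄ Q) k → 2 ≤ h u + D P u → 2 ≤ D Q v + k v → Extended h k (P ⋄ Q) u
    v
  insert-between {h} {k} P Q u v (vP , vQ) p q = P ⋄ [ one u v ] ⋄ Q ,
    (Valid-≤ P (λ y → ≤-refl) (λ y → lin (D Q y ∷ k y ∷ δ u y ∷ δ v y ∷ []) (# 0 :+ # 1) (# 2 :+ # 3 :+ # 0 :+ # 1))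
      vP , (p , q) , Valid-≤ Q (λ y → lin (h y + D P y ∷ δ u y ∷ δ v y ∷ []) (# 0) (# 0 :+ (# 1 :+ # 2))) (λ y →
      ≤-refl) vQ) , λ f → lin≡ (S f P ∷ sw f u v ∷ S f Q ∷ []) (# 0 :+ (# 1 :+ # 2)) (# 0 :+ # 2 :+ # 1)

  insert-between′ : ∀ {h k} P Q u v → Valid h (P ⋄ Q) k → 2 ≤ h v + D P v → 2 ≤ D Q u + k u → Extended h k (P ⋄ Q) u
    v
  insert-between′ P Q u v vT p q with insert-between P Q v u vT p q
  ... | L , vL , eq = L , vL , λ f → via≡ (eq f)
    (lin≡ (S f L ∷ S f P + S f Q ∷ f v u ∷ f u v ∷ []) (# 0 :+ (# 1 :+ (# 2 :+ # 3))) (# 1 :+ (# 3 :+ # 2) :+ # 0))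

  -- Somewhere between two chains, one of u and v has degree two in the earlier
  -- chains and the other one in the later chains.
  insert-edge : ∀ {h k} T u v → Valid h T k → Status h k T u → Status h k T v → Extended h k T u v
  insert-edge {h} {k} ε u v vT (inj₂ (p , q , s)) _ = absurd (via s (via p (via q
    (lin (h u ∷ k u ∷ []) (κ 1 :+ κ 0 :+ (# 0 :+ κ 0 :+ # 1) :+ κ 1 :+ κ 1) (κ 0 :+ κ 4 :+ # 0 :+ # 1)))))
  insert-edge {h} {k} ε u v vT _ (inj₂ (p , q , s)) = absurd (via s (via p (via q
    (lin (h v ∷ k v ∷ []) (κ 1 :+ κ 0 :+ (# 0 :+ κ 0 :+ # 1) :+ κ 1 :+ κ 1) (κ 0 :+ κ 4 :+ # 0 :+ # 1)))))
  insert-edge {h} {k} ε u v vT (inj₁ (p , q)) (inj₁ (p′ , q′)) = [ one u v ] , (p , q′) , λ f → refl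
  insert-edge {h} {k} [ C ] u v vT (inj₂ (p , q , s)) _ = ⊥-elim (no-window C vT p q s)
  insert-edge {h} {k} [ C ] u v vT _ (inj₂ (p , q , s)) = ⊥-elim (no-window C vT p q s)
  insert-edge {h} {k} [ C ] u v vT (inj₁ (p , q)) (inj₁ (p′ , q′)) = [ one u v ] ⋄ [ C ] ,
    ((p , ≤-trans q′ (m≤n+m _ _)) , OK-mono C (λ y _ → lin (h y ∷ δ u y ∷ δ v y ∷ []) (# 0) (# 0 :+ (# 1 :+ # 2)))
      (λ y _ → ≤-refl) vT) , λ f → lin≡ (sw f u v ∷ S f [ C ] ∷ []) (# 0 :+ # 1) (# 1 :+ # 0)
  insert-edge {h} {k} (P ⋄ Q) u v vT@(vP , vQ) su sv with middle h k P Q u su | middle h k P Q v sv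
  ... | both p q  | both p′ q′  = insert-between P Q u v vT p q′
  ... | both p q  | left p′ _   = insert-between′ P Q u v vT p′ q
  ... | both p q  | right q′ _  = insert-between P Q u v vT p q′
  ... | left p _  | both p′ q′  = insert-between P Q u v vT p q′
  ... | left p _  | right q′ _  = insert-between P Q u v vT p q′
  ... | right q _ | both p′ q′  = insert-between′ P Q u v vT p′ q
  ... | right q _ | left p′ _   = insert-between′ P Q u v vT p′ q
  ... | left _ s  | left _ s′ with insert-edge P u v vP s s′
  ... | L , vL , eq = L ⋄ Q , (vL , Valid-≤ Q (λ y → via= (sym (eq (dl y)))
    (lin (h y ∷ S (dl y) P ∷ S (dl y) L ∷ dl y u v ∷ dl y v u ∷ []) (# 0 :+ # 1 :+ # 2) (# 0 :+ # 2 :+ (# 1 :+ (# 3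
    :+ # 4))))) (λ y → ≤-refl) vQ) , λ f → via≡ (eq f)
    (lin≡ (S f L ∷ S f Q ∷ S f P ∷ sw f u v ∷ []) (# 0 :+ # 1 :+ (# 2 :+ # 3)) (# 2 :+ # 1 :+ # 3 :+ # 0))
  insert-edge {h} {k} (P ⋄ Q) u v vT@(vP , vQ) su sv | right _ s | right _ s′ with insert-edge Q u v vQ s s′
  ... | L , vL , eq = P ⋄ L , (Valid-≤ P (λ y → ≤-refl) (λ y → via= (sym (eq (dl y)))
    (lin (S (dl y) Q ∷ k y ∷ S (dl y) L ∷ dl y u v ∷ dl y v u ∷ []) (# 0 :+ # 1 :+ # 2) (# 2 :+ # 1 :+ (# 0 :+ (# 3
    :+ # 4))))) vP , vL) , λ f → via≡ (eq f)
    (lin≡ (S f P ∷ S f L ∷ S f Q ∷ sw f u v ∷ []) (# 0 :+ # 1 :+ (# 2 :+ # 3)) (# 0 :+ # 2 :+ # 3 :+ # 1))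

  -- Edge lists, cuts and uncrossing

  Edges : Set
  Edges = List (Vertex × Vertex)

  Sg : Weight → Edges → ℕ
  Sg f []            = 0
  Sg f ((u , v) ∷ E) = sw f u v + Sg f E

  dg : Edges → Vertex → ℕ
  dg E v = Sg (dl v) E

  VertexSet : Set
  VertexSet = Vertex → Bool

  ι : Bool → ℕ
  ι p = if p then 1 else 0

  crs : VertexSet → Weight
  crs X u v = ι (X u ∧ not (X v))

  -- A cut is represented by its side without `r`. Sides with only isolated vertices are exempt, as
  -- a vertex that has been split off stays in the vertex set without edges.
  Conn : Edges → Set
  Conn E = ∀ X → X r ≡ false → ∀ v → X v ≡ true → 1 ≤ dg E v → 4 ≤ Sg (crs X) E

  Sg-zero : ∀ E → Sg (λ _ _ → 0) E ≡ 0
  Sg-zero []      = refl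
  Sg-zero (_ ∷ E) = Sg-zero E

  Sg-cong : ∀ {f g} E → (∀ u v → f u v ≡ g u v) → Sg f E ≡ Sg g E
  Sg-cong []            eq = refl
  Sg-cong ((u , v) ∷ E) eq = cong₂ _+_ (cong₂ _+_ (eq u v) (eq v u)) (Sg-cong E eq)

  Sg-mono : ∀ f g E → All (λ (u , v) → sw f u v ≤ sw g u v) E → Sg f E ≤ Sg g E
  Sg-mono f g []      []       = z≤n
  Sg-mono f g (e ∷ E) (p ∷ ps) = +-mono-≤ p (Sg-mono f g E ps)

  Sg-strict : ∀ f g {E} → (∀ u v → sw f u v ≤ sw g u v) → Any (λ (u , v) → sw f u v < sw g u v) E → Sg f E < Sg g E
  Sg-strict f g {_ ∷ E} le (here p) = +-mono-≤ p (Sg-mono f g E (universal (λ (u , v) → le u v) E))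
  Sg-strict f g {(u , v) ∷ E} le (there i) = via (le u v) (via (Sg-strict f g le i)
    (lin (sw f u v ∷ Sg f E ∷ g u v + g v u ∷ Sg g E ∷ []) (κ 1 :+ (# 0 :+ # 1) :+ # 2 :+ # 3) (# 2 :+ # 3 :+ # 0 :+
    (κ 1 :+ # 1))))

  Sg-dominate : ∀ f₁ f₂ g₁ g₂ g₃ E → (∀ u v → sw f₁ u v + sw f₂ u v ≤ sw g₁ u v + (sw g₂ u v + sw g₃ u v)) →
    Sg f₁ E + Sg f₂ E ≤ Sg g₁ E + (Sg g₂ E + Sg g₃ E)
  Sg-dominate f₁ f₂ g₁ g₂ g₃ []            le = z≤n
  Sg-dominate f₁ f₂ g₁ g₂ g₃ ((u , v) ∷ E) le = via (le u v) (via (Sg-dominate f₁ f₂ g₁ g₂ g₃ E le)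
    (lin (f₁ u v + f₁ v u ∷ Sg f₁ E ∷ f₂ u v + f₂ v u ∷ Sg f₂ E ∷ g₁ u v + g₁ v u ∷ g₂ u v + g₂ v u ∷ g₃ u v + g₃ v
    u ∷ Sg g₁ E ∷ Sg g₂ E ∷ Sg g₃ E ∷ []) (# 0 :+ # 1 :+ (# 2 :+ # 3) :+ (# 4 :+ (# 5 :+ # 6)) :+ (# 7 :+ (# 8 :+
    # 9))) (# 4 :+ # 7 :+ (# 5 :+ # 8 :+ (# 6 :+ # 9)) :+ (# 0 :+ # 2) :+ (# 1 :+ # 3))))

  search : (P : VertexSet → Set) → (∀ X → Dec (P X)) → (∀ {X Y} → (∀ v → X v ≡ Y v) → P X → P Y) → Σ VertexSet P ⊎
    (∀ X → ¬ P X)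
  search P P? resp with anySubset? (λ s → P? (Vec.lookup s))
  ... | yes (s , p) = inj₁ (Vec.lookup s , p)
  ... | no ¬p       = inj₂ λ X p → ¬p (Vec.tabulate X , resp (λ v → sym (lookup∘tabulate X v)) p)

  crs-cong : ∀ {X Y : VertexSet} → (∀ v → X v ≡ Y v) → ∀ u v → crs X u v ≡ crs Y u v
  crs-cong eq u v = cong₂ (λ p q → ι (p ∧ not q)) (eq u) (eq v)

  Tight : Edges → Vertex × Vertex → VertexSet → Set
  Tight E (u , v) X = X r ≡ false × 1 ≤ sw (crs X) u v × Sg (crs X) E ≤ 4

  tight? : ∀ E e → Σ VertexSet (Tight E e) ⊎ (∀ X → ¬ Tight E e X)
  tight? E (u , v) = search (Tight E (u , v))
    (λ X → (X r ≟ᵇ false) ×-dec ((1 ≤? sw (crs X) u v) ×-dec (Sg (crs X) E ≤? 4)))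
    (λ eq (p , q , s) → trans (sym (eq r)) p ,
      ≤-trans q (≤-reflexive (cong₂ _+_ (crs-cong eq u v) (crs-cong eq v u))) ,
      ≤-trans (≤-reflexive (Sg-cong E (λ u v → sym (crs-cong eq u v)))) s)

  all₁ : (Bool → Bool) → Bool
  all₁ f = f true ∧ f false

  all₁-sound : ∀ f → T (all₁ f) → ∀ p → T (f p)
  all₁-sound f t true  = proj₁ (T-∧ {f true} t)
  all₁-sound f t false = proj₂ (T-∧ {f true} t)

  -- A claim about one edge and two vertex sets depends only on four memberships, and its sixteen
  -- instances are settled by evaluation.
  all₄ : (f : Bool → Bool → Bool → Bool → Bool) →
    {T (all₁ λ p → all₁ λ q → all₁ λ s → all₁ λ t → f p q s t)} → ∀ p q s t → T (f p q s t)
  all₄ f {c} p q s t = all₁-sound (f p q s) (all₁-sound (λ s → all₁ (f p q s)) (all₁-sound (λ q → all₁ λ s → all₁ (f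
    p q s))
    (all₁-sound (λ p → all₁ λ q → all₁ λ s → all₁ (f p q s)) c p) q) s) t

  -- The contribution of an edge to the cut of a set combined from X and Y: `p` and `q` tell which
  -- of its ends lie in X, `s` and `t` which lie in Y.
  x₄ : (Bool → Bool → Bool) → Bool → Bool → Bool → Bool → ℕ
  x₄ _*_ p q s t = ι ((p * s) ∧ not (q * t)) + ι ((q * t) ∧ not (p * s))

  submodular : ∀ X Y E → Sg (crs λ v → X v ∧ Y v) E + Sg (crs λ v → X v ∨ Y v) E ≤ Sg (crs X) E + (Sg (crs Y) E + Sg
    (λ _ _ → 0) E)
  submodular X Y E = Sg-dominate _ _ _ _ _ E λ u v → ≤ᵇ⇒≤ _ _ (all₄
    (λ p q s t → x₄ _∧_ p q s t + x₄ _∨_ p q s t ≤ᵇ x₄ (λ p s → p) p q s t + (x₄ (λ p s → s) p q s t + 0)) (X u) (X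
      v) (Y u) (Y v))

  inside : VertexSet → Weight
  inside X u v = ι (X u ∧ X v)

  Inner : VertexSet → Vertex × Vertex → Set
  Inner X (u , v) = X u ≡ true × X v ≡ true

  inner? : ∀ X e → ¬ Inner X e ⊎ Inner X e
  inner? X (u , v) with X u | X v
  ... | true  | true  = inj₂ (refl , refl)
  ... | true  | false = inj₁ λ ()
  ... | false | _     = inj₁ λ ()

  dg-here : ∀ {E u w} → Any (λ e → e ≡ (u , w)) E → 1 ≤ dg E u × 1 ≤ dg E w
  dg-here {_ ∷ E} {u} {w} (here refl) = via= (sym (δ-refl u))
    (lin (δ u u ∷ δ w u ∷ Sg (dl u) E ∷ []) (κ 1 :+ # 0) (# 0 :+ # 1 :+ # 2 :+ κ 1)) , via= (sym (δ-refl w))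
    (lin (δ w w ∷ δ u w ∷ Sg (dl w) E ∷ []) (κ 1 :+ # 0) (# 1 :+ # 0 :+ # 2 :+ κ 1))
  dg-here {x ∷ xs} {u} {w} (there i) with dg-here i
  ... | p , q = via p
    (lin (Sg (dl u) xs ∷ δ (proj₁ x) u ∷ δ (proj₂ x) u ∷ []) (κ 1 :+ # 0) (# 1 :+ # 2 :+ # 0 :+ κ 1)) , via q
    (lin (Sg (dl w) xs ∷ δ (proj₁ x) w ∷ δ (proj₂ x) w ∷ []) (κ 1 :+ # 0) (# 1 :+ # 2 :+ # 0 :+ κ 1))

  -- Since the cut around `x` has at least four edges, these conditions leave exactly four edges at
  -- `x`, all leading to other vertices.
  record Quartic (E : Edges) : Set where
    constructor quartic
    field
      x       : Vertex
      x≢r     : x ≢ r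
      dg≤4    : dg E x ≤ 4
      active  : 1 ≤ dg E x
      no-loop : All (λ (u , v) → ¬ (u ≡ x × v ≡ x)) E

  crossing : ∀ X u v → 1 ≤ sw (crs X) u v → (X u ≡ true × X v ≡ false) ⊎ (X u ≡ false × X v ≡ true)
  crossing X u v i with X u | X v
  crossing X u v () | true  | true
  ... | true  | false = inj₁ (refl , refl)
  ... | false | true  = inj₂ (refl , refl)
  crossing X u v () | false | false

  bool-split : ∀ p → p ≡ true ⊎ p ≡ false
  bool-split true  = inj₁ refl
  bool-split false = inj₂ refl

  crosses : ∀ X u v → X u ≡ true → X v ≡ false → 1 ≤ sw (crs X) u v
  crosses X u v p q rewrite p | q = s≤s z≤n

  pick : ∀ {A : Vertex × Vertex → Set} {B : Vertex × Vertex → Set} {E} → All A E → Any B E → Σ (Vertex × Vertex) λ e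
    → A e × B e × Any (_≡ e) E
  pick (a ∷ as) (here b) = _ , a , b , here refl
  pick (_ ∷ as) (there i) with pick as i
  ... | e , a , b , j = e , a , b , there j

  -- Uncrosses a tight cut with the tight cuts of its inner edges until no inner
  -- edge is left; then each of its vertices has degree four.
  descend : ∀ E → Conn E → All (λ e → Σ VertexSet (Tight E e)) E → ∀ N X → Sg (inside X) E ≤ N →
    X r ≡ false → ∀ v → X v ≡ true → 1 ≤ dg E v → Sg (crs X) E ≤ 4 → Quartic E
  descend E conn tight N X le Xr v Xv dv X≤4 with decide (inner? X) E
  -- Without inner edges every edge at `v` leaves `X`, so the degree of `v` is at most the size of
  -- the cut.
  ... | inj₁ none = quartic v (λ e → clash (trans (sym (trans (sym (cong X e)) Xv)) Xr)) (≤-trans (Sg-mono (dl v)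
    (crs X) E (all E none)) X≤4) dv (loops E none)
    where
    clash : true ≢ false
    clash ()
    cross : ∀ u w → ¬ Inner X (u , w) → δ u v + δ w v ≤ sw (crs X) u w
    cross u w ni with δ-split u v | δ-split w v
    ... | inj₂ p | inj₂ q = via= p (via= q
      (lin (δ u v ∷ δ w v ∷ ι (X u ∧ not (X w)) ∷ ι (X w ∧ not (X u)) ∷ []) (# 0 :+ # 1 :+ κ 0 :+ κ 0) (# 2 :+ # 3
      :+ # 0 :+ # 1)))
    ... | inj₁ refl | inj₁ refl = ⊥-elim (ni (Xv , Xv))
    ... | inj₁ refl | inj₂ q with bool-split (X w)
    ...   | inj₁ Xw = ⊥-elim (ni (Xv , Xw))
    ... | inj₂ Xw = via (crosses X u w Xv Xw) (via (δ≤1 u u) (via= q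
      (lin (δ u u ∷ δ w u ∷ ι (X u ∧ not (X w)) + ι (X w ∧ not (X u)) ∷ []) (# 0 :+ # 1 :+ # 2 :+ κ 1 :+ κ 0) (# 2
      :+ κ 1 :+ # 0 :+ # 1))))
    cross u w ni | inj₂ p | inj₁ refl with bool-split (X u)
    ...   | inj₁ Xu = ⊥-elim (ni (Xu , Xv))
    ... | inj₂ Xu = via (crosses X w u Xv Xu) (via (δ≤1 w w) (via= p
      (lin (δ u w ∷ δ w w ∷ ι (X w ∧ not (X u)) ∷ ι (X u ∧ not (X w)) ∷ []) (# 0 :+ # 1 :+ (# 2 :+ # 3) :+ κ 1 :+
      κ 0) (# 3 :+ # 2 :+ κ 1 :+ # 1 :+ # 0))))
    all : ∀ E → All (λ e → ¬ Inner X e) E → All (λ (u , w) → sw (dl v) u w ≤ sw (crs X) u w) E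
    all [] [] = []
    all ((u , w) ∷ E) (p ∷ ps) = cross u w p ∷ all E ps
    loops : ∀ E → All (λ e → ¬ Inner X e) E → All (λ (u , w) → ¬ (u ≡ v × w ≡ v)) E
    loops [] [] = []
    loops (_ ∷ E) (p ∷ ps) = (λ { (refl , refl) → p (Xv , Xv) }) ∷ loops E ps
  ... | inj₂ some with pick tight some
  ... | (u , w) , (Y , Yr , uw , Y≤4) , (Xu , Xw) , i = go (crossing Y u w uw) N le
    where
    XY = λ v → X v ∧ Y v
    XY≤4 : Sg (crs XY) E ≤ 4
    XY≤4 = via (submodular X Y E) (via X≤4 (via Y≤4 (via big (via= (Sg-zero E)
      (lin (Sg (crs XY) E ∷ Sg (crs X) E ∷ Sg (crs Y) E ∷ Sg (λ z z₁ → 0) E ∷ Sg (λ u₁ v₁ → ι ((X u₁ ∨ Y u₁) ∧ not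
      (X v₁ ∨ Y v₁))) E ∷ []) (# 0 :+ (# 1 :+ (# 2 :+ # 3)) :+ κ 4 :+ κ 4 :+ # 4 :+ κ 0) (κ 4 :+ (# 0 :+ # 4) :+ # 1
      :+ # 2 :+ κ 4 :+ # 3))))))
      where
      -- The union avoids `r` too, so its cut has at least four edges, and submodularity leaves at
      -- most four for the intersection.
      big : 4 ≤ Sg (crs λ v → X v ∨ Y v) E
      big = conn (λ v → X v ∨ Y v) (cong₂ _∨_ Xr Yr) v (cong (_∨ Y v) Xv) dv
    -- The edge `uw` lies inside `X` but is separated by `Y`, so the intersection has fewer inner
    -- edges.
    small : ∀ M → Sg (inside X) E ≤ M → suc (Sg (inside XY) E) ≤ M
    small M le = ≤-trans (Sg-strict (inside XY) (inside X) mono (strict i)) le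
      where
      mono : ∀ u w → sw (inside XY) u w ≤ sw (inside X) u w
      mono u w = ≤ᵇ⇒≤ _ _ (all₄ (λ p q s t → ι ((p ∧ s) ∧ (q ∧ t)) + ι ((q ∧ t) ∧ (p ∧ s)) ≤ᵇ ι (p ∧ q) + ι (q ∧ p))
        (X u) (X w) (Y u) (Y w))
      here-strict : sw (inside XY) u w < sw (inside X) u w
      here-strict with crossing Y u w uw
      ... | inj₁ (p , q) rewrite Xu | Xw | p | q = s≤s z≤n
      ... | inj₂ (p , q) rewrite Xu | Xw | p | q = s≤s z≤n
      strict : ∀ {E} → Any (_≡ (u , w)) E → Any (λ (u , w) → sw (inside XY) u w < sw (inside X) u w) E
      strict (here refl) = here here-strict
      strict (there i)   = there (strict i)
    go : _ → ∀ N → Sg (inside X) E ≤ N → Quartic E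
    go _ zero le = absurd₀ (small zero le)
    -- `v` need not lie in `Y`; it is replaced by the end of the inner edge that does, and this edge
    -- shows that the new vertex is not isolated.
    go (inj₁ (Yu , _)) (suc N) le = descend E conn tight N XY (s≤s⁻¹ (small (suc N) le)) (cong (_∧ Y r) Xr) u (cong₂
      _∧_ Xu Yu) (proj₁ (dg-here i)) XY≤4
    go (inj₂ (_ , Yw)) (suc N) le = descend E conn tight N XY (s≤s⁻¹ (small (suc N) le)) (cong (_∧ Y r) Xr) w (cong₂
      _∧_ Xw Yw) (proj₂ (dg-here i)) XY≤4

  -- Splitting off a vertex of degree four

  stars : Weight → Vertex → List Vertex → ℕ
  stars f x []       = 0
  stars f x (a ∷ as) = sw f x a + stars f x as

  record Star (x : Vertex) (E : Edges) : Set where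
    constructor star
    field
      nbrs  : List Vertex
      rest  : Edges
      total   : ∀ f → Sg f E ≡ stars f x nbrs + Sg f rest
      nbrs≢ : All (_≢ x) nbrs
      rest≢ : All (λ (u , v) → u ≢ x × v ≢ x) rest
      size  : length E ≡ length nbrs + length rest

  find-star : ∀ x E → All (λ (u , v) → ¬ (u ≡ x × v ≡ x)) E → Star x E
  find-star x [] [] = star [] [] (λ f → refl) [] [] refl
  find-star x ((u , v) ∷ E) (p ∷ ps) with find-star x E ps | u ≟ x | v ≟ x
  ... | _ | yes q | yes q′ = ⊥-elim (p (q , q′))
  ... | star ns R eq n≢ R≢ sz | yes refl | no q = star (v ∷ ns) R (λ f → via≡ (eq f)
    (lin≡ (sw f x v ∷ Sg f E ∷ stars f x ns ∷ Sg f R ∷ []) (# 0 :+ # 1 :+ (# 2 :+ # 3)) (# 0 :+ # 2 :+ # 3 :+ # 1)))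
    (q ∷ n≢) R≢ (cong suc sz)
  ... | star ns R eq n≢ R≢ sz | no q | yes refl = star (u ∷ ns) R (λ f → via≡ (eq f)
    (lin≡ (f u x ∷ f x u ∷ Sg f E ∷ stars f x ns ∷ Sg f R ∷ []) (# 0 :+ # 1 :+ # 2 :+ (# 3 :+ # 4)) (# 1 :+ # 0 :+
    # 3 :+ # 4 :+ # 2))) (q ∷ n≢) R≢ (cong suc sz)
  ... | star ns R eq n≢ R≢ sz | no q | no q′ = star ns ((u , v) ∷ R) (λ f → via≡ (eq f)
    (lin≡ (sw f u v ∷ Sg f E ∷ stars f x ns ∷ Sg f R ∷ []) (# 0 :+ # 1 :+ (# 2 :+ # 3)) (# 2 :+ (# 0 :+ # 3) :+
    # 1))) n≢ ((q , q′) ∷ R≢) (via≡ sz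
    (lin≡ (length E ∷ length ns ∷ length R ∷ []) (κ 1 :+ # 0 :+ (# 1 :+ # 2)) (# 1 :+ (κ 1 :+ # 2) :+ # 0)))

  dg-rest : ∀ x R → All (λ (u , v) → u ≢ x × v ≢ x) R → dg R x ≡ 0
  dg-rest x [] [] = refl
  dg-rest x ((u , v) ∷ R) ((p , q) ∷ ps) = via≡ (δ-≢ p) (via≡ (δ-≢ q) (via≡ (dg-rest x R ps)
    (lin≡ (δ u x ∷ δ v x ∷ Sg (dl x) R ∷ []) (# 0 :+ # 1 :+ # 2 :+ κ 0 :+ κ 0 :+ κ 0) (κ 0 :+ # 0 :+ # 1 :+ # 2))))

  dg-stars : ∀ x ns → All (_≢ x) ns → stars (dl x) x ns ≡ length ns
  dg-stars x [] [] = refl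
  dg-stars x (a ∷ ns) (p ∷ ps) = via≡ (δ-refl x) (via≡ (δ-≢ p) (via≡ (dg-stars x ns ps)
    (lin≡ (δ x x ∷ δ a x ∷ stars (dl x) x ns ∷ length ns ∷ []) (# 0 :+ # 1 :+ # 2 :+ κ 1 :+ κ 0 :+ # 3) (κ 1 :+ # 3
    :+ # 0 :+ # 1 :+ # 2))))

  Violates : Edges → VertexSet → Set
  Violates E X = X r ≡ false × Σ Vertex (λ v → X v ≡ true × 1 ≤ dg E v) × Sg (crs X) E ≤ 3

  conn? : ∀ E → Σ VertexSet (Violates E) ⊎ Conn E
  conn? E with search (Violates E)
    (λ X → (X r ≟ᵇ false) ×-dec (any? (λ v → (X v ≟ᵇ true) ×-dec (1 ≤? dg E v)) ×-dec (Sg (crs X) E ≤? 3)))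
    (λ eq (p , (v , q , q′) , s) → trans (sym (eq r)) p , (v , trans (sym (eq v)) q , q′) ,
      ≤-trans (≤-reflexive (Sg-cong E (λ u v → sym (crs-cong eq u v)))) s)
  ... | inj₁ bad  = inj₁ bad
  ... | inj₂ good = inj₂ λ X Xr v Xv dv → ≰⇒> (λ le → good X (Xr , (v , Xv , dv) , le))

  refute : ∀ {A : Set} N {α β} → N + α ≤ 3 → 4 ≤ N + β → {T (β ≤ᵇ α)} → A
  refute N {α} {β} p q {t} = absurd (via q (via p (via (≤ᵇ⇒≤ β α t)
    (lin (N ∷ β ∷ α ∷ []) (κ 1 :+ κ 0 :+ (# 0 :+ # 1) :+ κ 3 :+ # 2) (κ 0 :+ κ 4 :+ (# 0 :+ # 2) :+ # 1)))))

  excluding including : Vertex → VertexSet → VertexSet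
  excluding x X v = X v ∧ not ⌊ v ≟ x ⌋
  including   x X v = X v ∨ ⌊ v ≟ x ⌋

  ≟-off : ∀ {u x : Vertex} → u ≢ x → ⌊ u ≟ x ⌋ ≡ false
  ≟-off {u} {x} p with u ≟ x
  ... | yes q = ⊥-elim (p q)
  ... | no _  = refl

  ≟-on : ∀ {k} (x : Fin k) → ⌊ x ≟ x ⌋ ≡ true
  ≟-on x with x ≟ x
  ... | yes _ = refl
  ... | no p  = ⊥-elim (p refl)

  excluding-off : ∀ {x u} X → u ≢ x → excluding x X u ≡ X u
  excluding-off {x} {u} X p rewrite ≟-off p = ∧-identityʳ (X u)

  excluding-on : ∀ x X → excluding x X x ≡ false
  excluding-on x X rewrite ≟-on x = ∧-zeroʳ (X x)

  with-off : ∀ {x u} X → u ≢ x → including x X u ≡ X u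
  with-off {x} {u} X p rewrite ≟-off p = ∨-identityʳ (X u)

  with-on : ∀ x X → including x X x ≡ true
  with-on x X rewrite ≟-on x = ∨-zeroʳ (X x)

  spoke⁻ : ∀ {Z x a p} → Z x ≡ false → Z a ≡ p → sw (crs Z) x a ≡ ι p
  spoke⁻ {p = p} e e′ rewrite e | e′ | ∧-identityʳ p = refl

  spoke⁺ : ∀ {Z x a p} → Z x ≡ true → Z a ≡ p → sw (crs Z) x a ≡ ι (not p)
  spoke⁺ {p = true}  e e′ rewrite e | e′ = refl
  spoke⁺ {p = false} e e′ rewrite e | e′ = refl

  Sg-off : ∀ {x Z X} R → (∀ {u} → u ≢ x → Z u ≡ X u) → All (λ (u , v) → u ≢ x × v ≢ x) R → Sg (crs Z) R ≡ Sg (crs X)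
    R
  Sg-off [] eq [] = refl
  Sg-off ((u , v) ∷ R) eq ((p , q) ∷ ps) rewrite eq p | eq q = cong (_ +_) (Sg-off R eq ps)

  sum₄ : (Bool → ℕ) → VertexSet → (a b c d : Vertex) → ℕ
  sum₄ f X a b c d = f (X a) + f (X b) + (f (X c) + f (X d))

  record Spokes (E : Edges) (x a b c d : Vertex) (R : Edges) : Set where
    constructor spokes
    field
      conn : Conn E
      x≢r  : x ≢ r
      a≢x  : a ≢ x
      b≢x  : b ≢ x
      c≢x  : c ≢ x
      d≢x  : d ≢ x
      off  : All (λ (u , v) → u ≢ x × v ≢ x) R
      total  : ∀ f → Sg f E ≡ sw f x a + sw f x b + (sw f x c + sw f x d) + Sg f R

  permute : ∀ {E x a b c d R} → Spokes E x a b c d R → Spokes E x a c b d R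
  permute {E} {x} {a} {b} {c} {d} {R} (spokes cn p a≢ b≢ c≢ d≢ o s) = spokes cn p a≢ c≢ b≢ d≢ o (λ f → via≡ (s f)
    (lin≡ (Sg f E ∷ sw f x a ∷ sw f x b ∷ sw f x c ∷ sw f x d ∷ Sg f R ∷ []) (# 0 :+ (# 1 :+ # 2 :+ (# 3 :+ # 4) :+
    # 5)) (# 1 :+ # 3 :+ (# 2 :+ # 4) :+ # 5 :+ # 0)))

  module _ {E R : Edges} {x a b c d : Vertex} (spoked : Spokes E x a b c d R) where
    open Spokes spoked

    cut⁻ : ∀ X → X r ≡ false → ∀ v → v ≢ x → X v ≡ true → 1 ≤ dg E v → 4 ≤ Sg (crs X) R + sum₄ ι X a b c d
    cut⁻ X Xr v v≢x Xv dv =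
      via (conn Z (trans (excluding-off X (λ e → x≢r (sym e))) Xr) v (trans (excluding-off X v≢x) Xv) dv)
      (via= (total (crs Z)) (via= (Sg-off R (excluding-off X) off)
      (via= (sp a≢x) (via= (sp b≢x) (via= (sp c≢x) (via= (sp d≢x)
        (lin (Sg (crs Z) E ∷ ι ((X x ∧ not ⌊ x ≟ x ⌋) ∧ not (Z a)) + ι (Z a ∧ not (Z x)) ∷ ι ((X x ∧ not ⌊ x ≟ x ⌋)
        ∧ not (Z b)) + ι (Z b ∧ not (Z x)) ∷ ι ((X x ∧ not ⌊ x ≟ x ⌋) ∧ not (Z c)) + ι (Z c ∧ not (Z x)) ∷ ι ((X x ∧
        not ⌊ x ≟ x ⌋) ∧ not (Z d)) + ι (Z d ∧ not (Z x)) ∷ Sg (crs Z) R ∷ Sg (crs X) R ∷ ι (X a) ∷ ι (X b) ∷ ι (X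
        c) ∷ ι (X d) ∷ []) (κ 4 :+ # 0 :+ (# 1 :+ # 2 :+ (# 3 :+ # 4) :+ # 5) :+ # 6 :+ # 7 :+ # 8 :+ # 9 :+ # 10)
        (# 6 :+ (# 7 :+ # 8 :+ (# 9 :+ # 10)) :+ κ 4 :+ # 0 :+ # 5 :+ # 1 :+ # 2 :+ # 3 :+ # 4))))))))
      where
      Z = excluding x X
      sp : ∀ {a} → a ≢ x → sw (crs Z) x a ≡ ι (X a)
      sp p = spoke⁻ {Z} (excluding-on x X) (excluding-off X p)

    -- Connectivity applied to `X` together with `x`. Here `x` itself is the vertex with an edge
    -- that `Conn` asks for, so `X` may even be empty.
    cut⁺ : ∀ X → X r ≡ false → 4 ≤ Sg (crs X) R + sum₄ (λ p → ι (not p)) X a b c d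
    cut⁺ X Xr =
      via (conn Z (trans (with-off X (λ e → x≢r (sym e))) Xr) x (with-on x X) (via= (sym (total (dl x))) (via= (sym
        (δ-refl x))
        (lin (Sg (dl x) E ∷ δ x x ∷ δ a x ∷ δ b x ∷ δ c x ∷ δ d x ∷ Sg (dl x) R ∷ []) (κ 1 :+ # 0 :+ # 1) (# 0 :+
        (# 1 :+ # 2 :+ (# 1 :+ # 3) :+ (# 1 :+ # 4 :+ (# 1 :+ # 5)) :+ # 6) :+ κ 1)))))
      (via= (total (crs Z)) (via= (Sg-off R (with-off X) off)
      (via= (sp a≢x) (via= (sp b≢x) (via= (sp c≢x) (via= (sp d≢x)
        (lin (Sg (crs Z) E ∷ ι ((X x ∨ ⌊ x ≟ x ⌋) ∧ not (Z a)) + ι (Z a ∧ not (Z x)) ∷ ι ((X x ∨ ⌊ x ≟ x ⌋) ∧ not (Z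
        b)) + ι (Z b ∧ not (Z x)) ∷ ι ((X x ∨ ⌊ x ≟ x ⌋) ∧ not (Z c)) + ι (Z c ∧ not (Z x)) ∷ ι ((X x ∨ ⌊ x ≟ x ⌋) ∧
        not (Z d)) + ι (Z d ∧ not (Z x)) ∷ Sg (crs Z) R ∷ Sg (crs X) R ∷ ι (not (X a)) ∷ ι (not (X b)) ∷ ι (not (X
        c)) ∷ ι (not (X d)) ∷ []) (κ 4 :+ # 0 :+ (# 1 :+ # 2 :+ (# 3 :+ # 4) :+ # 5) :+ # 6 :+ # 7 :+ # 8 :+ # 9 :+
        # 10) (# 6 :+ (# 7 :+ # 8 :+ (# 9 :+ # 10)) :+ κ 4 :+ # 0 :+ # 5 :+ # 1 :+ # 2 :+ # 3 :+ # 4))))))))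
      where
      Z = including x X
      sp : ∀ {a} → a ≢ x → sw (crs Z) x a ≡ ι (not (X a))
      sp p = spoke⁺ {Z} (with-on x X) (with-off X p)

    -- The neighbour of `x` in `X` is the vertex with an edge that `cut⁻` asks for; its spoke is one
    -- of the four edges of the cut, which leaves three.
    region⁻ : ∀ X → X r ≡ false → sum₄ ι X a b c d ≡ 1 → 3 ≤ Sg (crs X) R
    region⁻ X Xr eq with bool-split (X a) | bool-split (X b) | bool-split (X c) | bool-split (X d)
    ... | inj₁ p | _ | _ | _ = via (cut⁻ X Xr a a≢x p (via= (sym (total (dl a))) (via= (sym (δ-refl a))
      (lin (Sg (dl a) E ∷ δ a a ∷ δ x a ∷ δ b a ∷ δ c a ∷ δ d a ∷ Sg (dl a) R ∷ []) (κ 1 :+ # 0 :+ # 1) (# 0 :+ (# 2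
      :+ # 1 :+ (# 2 :+ # 3) :+ (# 2 :+ # 4 :+ (# 2 :+ # 5)) :+ # 6) :+ κ 1))))) (via= eq
      (lin (Sg (crs X) R ∷ ι (X a) + ι (X b) + (ι (X c) + ι (X d)) ∷ []) (κ 3 :+ (# 0 :+ # 1) :+ κ 1) (# 0 :+ κ 4 :+
      # 1)))
    ... | _ | inj₁ p | _ | _ = via (cut⁻ X Xr b b≢x p (via= (sym (total (dl b))) (via= (sym (δ-refl b))
      (lin (Sg (dl b) E ∷ δ b b ∷ δ x b ∷ δ a b ∷ δ c b ∷ δ d b ∷ Sg (dl b) R ∷ []) (κ 1 :+ # 0 :+ # 1) (# 0 :+ (# 2
      :+ # 3 :+ (# 2 :+ # 1) :+ (# 2 :+ # 4 :+ (# 2 :+ # 5)) :+ # 6) :+ κ 1))))) (via= eq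
      (lin (Sg (crs X) R ∷ ι (X a) + ι (X b) + (ι (X c) + ι (X d)) ∷ []) (κ 3 :+ (# 0 :+ # 1) :+ κ 1) (# 0 :+ κ 4 :+
      # 1)))
    ... | _ | _ | inj₁ p | _ = via (cut⁻ X Xr c c≢x p (via= (sym (total (dl c))) (via= (sym (δ-refl c))
      (lin (Sg (dl c) E ∷ δ c c ∷ δ x c ∷ δ a c ∷ δ b c ∷ δ d c ∷ Sg (dl c) R ∷ []) (κ 1 :+ # 0 :+ # 1) (# 0 :+ (# 2
      :+ # 3 :+ (# 2 :+ # 4) :+ (# 2 :+ # 1 :+ (# 2 :+ # 5)) :+ # 6) :+ κ 1))))) (via= eq
      (lin (Sg (crs X) R ∷ ι (X a) + ι (X b) + (ι (X c) + ι (X d)) ∷ []) (κ 3 :+ (# 0 :+ # 1) :+ κ 1) (# 0 :+ κ 4 :+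
      # 1)))
    ... | _ | _ | _ | inj₁ p = via (cut⁻ X Xr d d≢x p (via= (sym (total (dl d))) (via= (sym (δ-refl d))
      (lin (Sg (dl d) E ∷ δ d d ∷ δ x d ∷ δ a d ∷ δ b d ∷ δ c d ∷ Sg (dl d) R ∷ []) (κ 1 :+ # 0 :+ # 1) (# 0 :+ (# 2
      :+ # 3 :+ (# 2 :+ # 4) :+ (# 2 :+ # 5 :+ (# 2 :+ # 1)) :+ # 6) :+ κ 1))))) (via= eq
      (lin (Sg (crs X) R ∷ ι (X a) + ι (X b) + (ι (X c) + ι (X d)) ∷ []) (κ 3 :+ (# 0 :+ # 1) :+ κ 1) (# 0 :+ κ 4 :+
      # 1)))
    ... | inj₂ p | inj₂ q | inj₂ s | inj₂ t rewrite p | q | s | t with () ← eq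

    region⁺ : ∀ X → X r ≡ false → sum₄ (λ p → ι (not p)) X a b c d ≡ 1 → 3 ≤ Sg (crs X) R
    region⁺ X Xr eq = via (cut⁺ X Xr) (via= eq
      (lin (Sg (crs X) R ∷ ι (not (X a)) + ι (not (X b)) + (ι (not (X c)) + ι (not (X d))) ∷ []) (κ 3 :+ (# 0 :+
      # 1) :+ κ 1) (# 0 :+ κ 4 :+ # 1)))

    -- The small cut after the split is compared with the cuts of `X` with and without `x` before
    -- it. Of the sixteen positions of the neighbours only those survive in which neither new edge
    -- is cut and the two lie on different sides.
    separates : ∀ {X} → Violates ((a , b) ∷ (c , d) ∷ R) X →
      Sg (crs X) R ≤ 3 × X b ≡ X a × X c ≡ not (X a) × X d ≡ not (X a)
    separates {X} (Xr , (v , Xv , dv) , le) = via le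
      (lin (Sg (crs X) R ∷ ι (X a ∧ not (X b)) ∷ ι (X b ∧ not (X a)) ∷ ι (X c ∧ not (X d)) ∷ ι (X d ∧ not (X c)) ∷
      []) (# 0 :+ κ 3) (κ 3 :+ (# 1 :+ # 2 :+ (# 3 :+ # 4 :+ # 0)))) ,
      pat (X a) (X b) (X c) (X d) (via le
        (lin (N ∷ ι (X a ∧ not (X b)) + ι (X b ∧ not (X a)) ∷ ι (X c ∧ not (X d)) + ι (X d ∧ not (X c)) ∷ []) (# 0
        :+ (# 1 :+ # 2) :+ κ 3) (κ 3 :+ (# 1 :+ (# 2 :+ # 0))))) (cut⁻ X Xr v v≢x Xv (via dv (via= (sym (total (dl
        v))) (lin (δ a v ∷ δ b v ∷ δ c v ∷ δ d v ∷ Sg (dl v) R ∷ Sg (dl v) E ∷ δ x v ∷ []) (κ 1 :+ (# 0 :+ # 1 :+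
        (# 2 :+ # 3 :+ # 4)) :+ # 5) (# 5 :+ κ 1 :+ (# 6 :+ # 0 :+ (# 6 :+ # 1) :+ (# 6 :+ # 2 :+ (# 6 :+ # 3)) :+
        # 4)))))) (cut⁺ X Xr)
      where
      -- After the split `x` is isolated.
      v≢x : v ≢ x
      v≢x refl = absurd (via dv (via= (δ-≢ a≢x) (via= (δ-≢ b≢x) (via= (δ-≢ c≢x) (via= (δ-≢ d≢x) (via= (dg-rest x R
        off) (lin (δ a x ∷ δ b x ∷ δ c x ∷ δ d x ∷ Sg (dl x) R ∷ []) (κ 1 :+ κ 0 :+ (# 0 :+ # 1 :+ (# 2 :+ # 3 :+
        # 4)) :+ κ 0 :+ κ 0 :+ κ 0 :+ κ 0 :+ κ 0) (κ 0 :+ κ 1 :+ # 0 :+ # 1 :+ # 2 :+ # 3 :+ # 4))))))))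
      x₂ : Bool → Bool → ℕ
      x₂ p q = ι (p ∧ not q) + ι (q ∧ not p)
      N = Sg (crs X) R
      pat : ∀ p q s t → N + (x₂ p q + x₂ s t) ≤ 3 → 4 ≤ N + (ι p + ι q + (ι s + ι t)) →
        4 ≤ N + (ι (not p) + ι (not q) + (ι (not s) + ι (not t))) → q ≡ p × s ≡ not p × t ≡ not p
      pat true  true  false false f g h = refl , refl , refl
      pat false false true  true  f g h = refl , refl , refl
      pat true  true  true  true  f g h = refute N f h
      pat true  true  true  false f g h = refute N f h
      pat true  true  false true  f g h = refute N f h
      pat true  false true  true  f g h = refute N f h
      pat false true  true  true  f g h = refute N f h
      pat true  false true  false f g h = refute N f h
      pat true  false false true  f g h = refute N f h
      pat false true  true  false f g h = refute N f h
      pat false true  false true  f g h = refute N f h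
      pat false false false false f g h = refute N f g
      pat false false false true  f g h = refute N f g
      pat false false true  false f g h = refute N f g
      pat false true  false false f g h = refute N f g
      pat true  false false false f g h = refute N f g

  -- The parity step of the argument: this rounding turns two bounds of three halves into the four
  -- crossings of Y.
  half : ∀ g → 3 ≤ g + g → 2 ≤ g
  half zero          p = absurd₀ p
  half (suc zero)    p = absurd (via p (lin [] (κ 1 :+ κ 0 :+ (κ 1 :+ κ 0 :+ (κ 1 :+ κ 0))) (κ 0 :+ κ 3)))
  half (suc (suc g)) p = s≤s (s≤s z≤n)

  -- If both splits were violated, by X and Y, the four regions cut out by X and Y
  -- would each be left by at least three of the remaining edges, while X and Y
  -- are crossed by at most three.  So X has at least two edges inside it that
  -- cross Y, likewise outside, and Y is crossed four times.
  split-conn : ∀ {E x a b c d R} → Spokes E x a b c d R →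
    Conn ((a , b) ∷ (c , d) ∷ R) ⊎ Conn ((a , c) ∷ (b , d) ∷ R)
  split-conn {E} {x} {a} {b} {c} {d} {R} spoked with conn? ((a , b) ∷ (c , d) ∷ R) | conn? ((a , c) ∷ (b , d) ∷ R)
  ... | inj₂ p | _ = inj₁ p
  ... | _ | inj₂ p = inj₂ p
  ... | inj₁ (X , vX) | inj₁ (Y , vY) with separates spoked vX | separates (permute spoked) vY
  ... | X≤3 , Xb , Xc , Xd | Y≤3 , Yc , Yb , Yd = absurd (via four (via Y≤3
    (lin (Sg (crs Y) R ∷ []) (κ 1 :+ κ 0 :+ # 0 :+ κ 3) (κ 0 :+ κ 4 :+ # 0))))
    where
    Xr = proj₁ vX
    Yr = proj₁ vY
    g₁ g₂ : Weight
    g₁ u v = ι ((X u ∧ X v) ∧ (Y u ∧ not (Y v)))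
    g₂ u v = ι ((not (X u) ∧ not (X v)) ∧ (Y u ∧ not (Y v)))
    -- One set separates `a`, `b` from `c`, `d` and the other `a`, `c` from `b`, `d`; so each of the
    -- four regions receives exactly one of the four spokes.
    cnt-region : ∀ (f : Bool → ℕ) (o : Bool → Bool → Bool) →
      (∀ p q → f (o p q) + f (o p (not q)) + (f (o (not p) q) + f (o (not p) (not q))) ≡ 1) →
      sum₄ f (λ v → o (X v) (Y v)) a b c d ≡ 1
    cnt-region f o eq rewrite Xb | Xc | Xd | Yc | Yb | Yd = eq (X a) (Y a)
    A≥3 : 3 ≤ Sg (crs λ v → X v ∧ Y v) R
    A≥3 = region⁻ spoked (λ v → X v ∧ Y v) (cong (_∧ Y r) Xr) (cnt-region ι _∧_ λ { true true → refl ; true false →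
      refl ; false true → refl ; false false → refl })
    B≥3 : 3 ≤ Sg (crs λ v → X v ∧ not (Y v)) R
    B≥3 = region⁻ spoked (λ v → X v ∧ not (Y v)) (cong (_∧ not (Y r)) Xr) (cnt-region ι (λ p q → p ∧ not q) λ { true
      true → refl ; true false → refl ; false true → refl ; false false → refl })
    C≥3 : 3 ≤ Sg (crs λ v → not (X v) ∧ Y v) R
    C≥3 = region⁻ spoked (λ v → not (X v) ∧ Y v) (trans (cong (not (X r) ∧_) Yr) (∧-zeroʳ (not (X r)))) (cnt-region
      ι (λ p q → not p ∧ q) λ { true true → refl ; true false → refl ; false true → refl ; false false → refl })
    -- The fourth region contains `r`, so it is represented by its complement, the union.
    D≥3 : 3 ≤ Sg (crs λ v → X v ∨ Y v) R
    D≥3 = region⁺ spoked (λ v → X v ∨ Y v) (cong₂ _∨_ Xr Yr) (cnt-region (λ p → ι (not p)) _∨_ λ { true true → refl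
      ; true false → refl ; false true → refl ; false false → refl })
    -- An edge counted on the left that does not cross `X` runs inside `X` between the two regions
    -- and is counted twice; hence the double `g₁`.
    AB : Sg (crs λ v → X v ∧ Y v) R + Sg (crs λ v → X v ∧ not (Y v)) R ≤ Sg (crs X) R + (Sg g₁ R + Sg g₁ R)
    AB = Sg-dominate _ _ _ _ _ R λ u v → ≤ᵇ⇒≤ _ _ (all₄ (λ p q s t →
      x₄ _∧_ p q s t + x₄ (λ p s → p ∧ not s) p q s t ≤ᵇ
      x₄ (λ p s → p) p q s t + ((ι ((p ∧ q) ∧ (s ∧ not t)) + ι ((q ∧ p) ∧ (t ∧ not s))) + (ι ((p ∧ q) ∧ (s ∧ not t))
        + ι ((q ∧ p) ∧ (t ∧ not s)))))
      (X u) (X v) (Y u) (Y v))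
    CD : Sg (crs λ v → not (X v) ∧ Y v) R + Sg (crs λ v → X v ∨ Y v) R ≤ Sg (crs X) R + (Sg g₂ R + Sg g₂ R)
    CD = Sg-dominate _ _ _ _ _ R λ u v → ≤ᵇ⇒≤ _ _ (all₄ (λ p q s t →
      x₄ (λ p s → not p ∧ s) p q s t + x₄ _∨_ p q s t ≤ᵇ
      x₄ (λ p s → p) p q s t + ((ι ((not p ∧ not q) ∧ (s ∧ not t)) + ι ((not q ∧ not p) ∧ (t ∧ not s))) + (ι ((not p
        ∧ not q) ∧ (s ∧ not t)) + ι ((not q ∧ not p) ∧ (t ∧ not s)))))
      (X u) (X v) (Y u) (Y v))
    Y-crossed : Sg g₁ R + Sg g₂ R ≤ Sg (crs Y) R + (Sg (λ _ _ → 0) R + Sg (λ _ _ → 0) R)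
    Y-crossed = Sg-dominate _ _ _ _ _ R λ u v → ≤ᵇ⇒≤ _ _ (all₄ (λ p q s t →
      (ι ((p ∧ q) ∧ (s ∧ not t)) + ι ((q ∧ p) ∧ (t ∧ not s))) + (ι ((not p ∧ not q) ∧ (s ∧ not t)) + ι ((not q ∧ not
        p) ∧ (t ∧ not s))) ≤ᵇ
      x₄ (λ p s → s) p q s t + 0)
      (X u) (X v) (Y u) (Y v))
    four : 4 ≤ Sg (crs Y) R
    four = via Y-crossed (via= (Sg-zero R) (via= (Sg-zero R)
      (via (half (Sg g₁ R) (via AB (via A≥3 (via B≥3 (via X≤3
        (lin (Sg (crs X) R ∷ Sg g₁ R + Sg g₁ R ∷ Sg (λ u v → ι ((X u ∧ Y u) ∧ not (X v ∧ Y v))) R ∷ Sg (λ u v → ι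
        ((X u ∧ not (Y u)) ∧ not (X v ∧ not (Y v)))) R ∷ []) (κ 3 :+ (# 0 :+ # 1) :+ # 2 :+ # 3 :+ κ 3) (# 1 :+ (# 2
        :+ # 3) :+ κ 3 :+ κ 3 :+ # 0)))))))
      (via (half (Sg g₂ R) (via CD (via C≥3 (via D≥3 (via X≤3
        (lin (Sg (crs X) R ∷ Sg g₂ R + Sg g₂ R ∷ Sg (λ u v → ι ((not (X u) ∧ Y u) ∧ not (not (X v) ∧ Y v))) R ∷ Sg
        (λ u v → ι ((X u ∨ Y u) ∧ not (X v ∨ Y v))) R ∷ []) (κ 3 :+ (# 0 :+ # 1) :+ # 2 :+ # 3 :+ κ 3) (# 1 :+ (# 2
        :+ # 3) :+ κ 3 :+ κ 3 :+ # 0)))))))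
        (lin (Sg (crs Y) R ∷ Sg (λ z z₁ → 0) R ∷ Sg g₁ R ∷ Sg g₂ R ∷ []) (κ 4 :+ (# 0 :+ (# 1 :+ # 1)) :+ κ 0 :+ κ 0
        :+ # 2 :+ # 3) (# 0 :+ (# 2 :+ # 3) :+ # 1 :+ # 1 :+ κ 2 :+ κ 2))))))

  sw-crs≤1 : ∀ X u v → sw (crs X) u v ≤ 1
  sw-crs≤1 X u v with X u | X v
  ... | true  | true  = z≤n
  ... | true  | false = ≤-refl
  ... | false | true  = ≤-refl
  ... | false | false = z≤n

  only : Vertex → VertexSet
  only u v = ⌊ v ≟ u ⌋

  only≤δ : ∀ u p q → sw (crs (only u)) p q ≤ δ p u + δ q u
  only≤δ u p q with p ≟ u | q ≟ u
  ... | yes refl | yes _ = z≤n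
  ... | yes refl | no _  = via= (sym (δ-refl u)) (lin (δ u u ∷ δ q u ∷ []) (κ 1 :+ κ 0 :+ # 0) (# 0 :+ # 1 :+ κ 1))
  ... | no _ | yes refl  = via= (sym (δ-refl u)) (lin (δ u u ∷ δ p u ∷ []) (κ 0 :+ κ 1 :+ # 0) (# 1 :+ # 0 :+ κ 1))
  ... | no _ | no _      = z≤n

  only≤dg : ∀ u E → Sg (crs (only u)) E ≤ dg E u
  only≤dg u E = Sg-mono (crs (only u)) (dl u) E (universal (λ (p , q) → only≤δ u p q) E)

  -- The induction on the number of edges

  base : Ctx
  base v = δ r v + δ r v

  Decomposed : Edges → Set
  Decomposed E = Σ Seq λ T → Valid base T base × (∀ f → S f T ≡ Sg f E)

  Removed : (Vertex × Vertex → Set) → Edges → Set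
  Removed P E = Σ (Vertex × Vertex) λ e → Σ Edges λ E′ → P e × (∀ f → Sg f E ≡ sw f (proj₁ e) (proj₂ e) + Sg f E′) ×
    length E ≡ suc (length E′)

  remove : ∀ {P E} → Any P E → Removed P E
  remove {E = e ∷ E} (here p) = e , E , p , (λ f → refl) , refl
  remove {E = e ∷ E} (there i) with remove i
  ... | e′ , E′ , p , eq , l = e′ , e ∷ E′ , p , (λ f → via≡ (eq f)
    (lin≡ (sw f (proj₁ e) (proj₂ e) ∷ Sg f E ∷ sw f (proj₁ e′) (proj₂ e′) ∷ Sg f E′ ∷ []) (# 0 :+ # 1 :+ (# 2 :+
    # 3)) (# 2 :+ (# 0 :+ # 3) :+ # 1))) , cong suc l

  module _ (E E′ : Edges) {u v : Vertex} (conn : Conn E) (total : ∀ f → Sg f E ≡ sw f u v + Sg f E′)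
    (loose : ∀ X → ¬ Tight E (u , v) X) where

    -- A cut crossed by the deleted edge was not tight, so it had five edges and loses only one.
    delete-conn : Conn E′
    delete-conn X Xr w Xw dw with 1≤-split (sw (crs X) u v)
    ... | inj₁ z = via (conn X Xr w Xw (via dw (via= (sym (total (dl w)))
      (lin (Sg (dl w) E′ ∷ Sg (dl w) E ∷ dl w u v ∷ dl w v u ∷ []) (κ 1 :+ # 0 :+ # 1) (# 1 :+ κ 1 :+ (# 2 :+ # 3 :+
      # 0)))))) (via= (total (crs X)) (via= z
      (lin (Sg (crs X) E ∷ ι (X u ∧ not (X v)) + ι (X v ∧ not (X u)) ∷ Sg (crs X) E′ ∷ []) (κ 4 :+ # 0 :+ (# 1 :+
      # 2) :+ κ 0) (# 2 :+ κ 4 :+ # 0 :+ # 1))))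
    ... | inj₂ i = via (≰⇒> (λ le → loose X (Xr , i , le))) (via= (total (crs X)) (via (sw-crs≤1 X u v)
      (lin (Sg (crs X) E ∷ ι (X u ∧ not (X v)) + ι (X v ∧ not (X u)) ∷ Sg (crs X) E′ ∷ []) (κ 4 :+ # 0 :+ (# 1 :+
      # 2) :+ κ 1) (# 2 :+ (κ 1 :+ κ 4) :+ # 0 :+ # 1))))

    end-status : ∀ w T → (∀ f → S f T ≡ Sg f E′) → 1 ≤ δ u w + δ v w → Status base base T w
    end-status w T eq i with w ≟ r
    ... | yes refl = inj₁ (via= (sym (δ-refl r)) (via= (sym (δ-refl r))
      (lin (δ w w ∷ []) (κ 2 :+ # 0 :+ # 0) (# 0 :+ # 0 :+ κ 1 :+ κ 1))) , via= (sym (δ-refl r)) (via= (sym (δ-refl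
      r)) (lin (δ w w ∷ []) (κ 2 :+ # 0 :+ # 0) (# 0 :+ # 0 :+ κ 1 :+ κ 1))))
    ... | no w≢r = inj₂ (small , small , via four (via (only≤dg w E′) (via= (sym (eq (dl w)))
      (lin (Sg (crs (only w)) E′ ∷ dg E′ w ∷ S (dl w) T ∷ δ r w + δ r w ∷ []) (κ 4 :+ # 0 :+ # 1 :+ # 2) (# 3 :+ # 2
      :+ # 3 :+ κ 4 :+ # 0 :+ # 1)))))
      where
      small : base w ≤ 1
      small = via= (δ-≢ (λ e → w≢r (sym e))) (via= (δ-≢ (λ e → w≢r (sym e)))
        (lin (δ r w ∷ []) (# 0 :+ # 0 :+ κ 0 :+ κ 0) (κ 1 :+ # 0 :+ # 0)))
      -- `Conn E′` says nothing about an isolated vertex. The cut around `w` keeps three of its four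
      -- edges, and then connectivity restores the fourth.
      three : 3 ≤ Sg (crs (only w)) E′
      three = via (conn (only w) (≟-off (λ e → w≢r (sym e))) w (≟-on w) (via i (via= (sym (total (dl w)))
        (lin (δ u w + δ v w ∷ Sg (dl w) E ∷ Sg (dl w) E′ ∷ []) (κ 1 :+ # 0 :+ # 1) (# 1 :+ κ 1 :+ (# 0 :+ # 2))))))
        (via= (total (crs (only w))) (via (sw-crs≤1 (only w) u v)
          (lin (Sg (crs (only w)) E ∷ ι (only w u ∧ not (only w v)) + ι (only w v ∧ not (only w u)) ∷ Sg (crs (only
          w)) E′ ∷ []) (κ 3 :+ # 0 :+ (# 1 :+ # 2) :+ κ 1) (# 2 :+ κ 4 :+ # 0 :+ # 1))))
      four : 4 ≤ Sg (crs (only w)) E′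
      four = delete-conn (only w) (≟-off (λ e → w≢r (sym e))) w (≟-on w) (via three (via (only≤dg w E′)
        (lin (Sg (crs (only w)) E′ ∷ dg E′ w ∷ []) (κ 1 :+ # 0 :+ # 1) (# 1 :+ κ 3 :+ # 0))))

  -- `N` bounds the number of edges, which falls by one on deletion and by two on splitting off.
  decompose : ∀ N E → length E ≤ N → Conn E → Decomposed E
  decompose N       []      _  conn = ε , tt , λ f → refl
  decompose zero    (_ ∷ _) () conn
  decompose (suc N) E@(e ∷ xs) le conn with decide (tight? E) E
  -- This case also disposes of loops, since they cross no cut.
  ... | inj₂ some with remove some
  ... | (u , v) , E′ , loose , total , len with decompose N E′ (s≤s⁻¹ (≤-trans (≤-reflexive (sym len)) le))
    (delete-conn E E′ conn total loose)
  ... | T , vT , eq with insert-edge T u v vT (end-status E E′ conn total loose u T eq (via= (sym (δ-refl u))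
    (lin (δ u u ∷ δ v u ∷ []) (κ 1 :+ # 0) (# 0 :+ # 1 :+ κ 1)))) (end-status E E′ conn total loose v T eq (via=
    (sym (δ-refl v)) (lin (δ v v ∷ δ u v ∷ []) (κ 1 :+ # 0) (# 1 :+ # 0 :+ κ 1))))
  ... | T′ , vT′ , eq′ = T′ , vT′ , λ f → via≡ (eq′ f) (via≡ (eq f) (via≡ (sym (total f))
    (lin≡ (S f T′ ∷ S f T ∷ sw f u v ∷ Sg f E′ ∷ sw f (proj₁ e) (proj₂ e) + Sg f xs ∷ []) (# 0 :+ (# 1 :+ # 2) :+
    # 3 :+ # 4) (# 4 :+ # 0 :+ # 1 :+ (# 2 :+ # 3)))))
  decompose (suc N) E@((u , v) ∷ E₁) le conn | inj₁ all@((X , Xr , uv , X≤4) ∷ _) = reduce (vertex (crossing X u v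
    uv))
    where
    vertex : _ → Quartic E
    vertex (inj₁ (Xu , _)) = descend E conn all _ X ≤-refl Xr u Xu (via= (sym (δ-refl u))
      (lin (δ u u ∷ δ v u ∷ Sg (dl u) E₁ ∷ []) (κ 1 :+ # 0) (# 0 :+ # 1 :+ # 2 :+ κ 1))) X≤4
    vertex (inj₂ (_ , Xv)) = descend E conn all _ X ≤-refl Xr v Xv (via= (sym (δ-refl v))
      (lin (δ v v ∷ δ u v ∷ Sg (dl v) E₁ ∷ []) (κ 1 :+ # 0) (# 1 :+ # 0 :+ # 2 :+ κ 1))) X≤4
    split-off : ∀ {x a b c d R} → x ≢ r → a ≢ x → b ≢ x → c ≢ x → d ≢ x → All (λ (u , v) → u ≢ x × v ≢ x) R →
      (∀ f → Sg f E ≡ sw f x a + sw f x b + (sw f x c + sw f x d) + Sg f R) → length E ≡ 4 + length R →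
      Conn ((a , b) ∷ (c , d) ∷ R) → Decomposed E
    split-off {x} {a} {b} {c} {d} {R} x≢r a≢ b≢ c≢ d≢ R≢ total len conn′
      with decompose N ((a , b) ∷ (c , d) ∷ R) (via le (via= (sym len)
        (lin (length R ∷ N ∷ length E₁ ∷ []) (κ 1 :+ (κ 1 :+ # 0) :+ (κ 1 :+ # 1) :+ (κ 1 :+ # 2)) (# 1 :+ (κ 1 :+
        # 2) :+ (κ 4 :+ # 0))))) conn′
    -- The smaller family has no edge at `x`, so `x` is fresh for its sequence.
    ... | T , vT , eq with pinch T a b c d x vT
        (via= (eq (dl x)) (via= (δ-≢ a≢) (via= (δ-≢ b≢) (via= (δ-≢ c≢) (via= (δ-≢ d≢) (via= (dg-rest x R R≢)
          (lin (D T x ∷ dl x a b ∷ dl x b a ∷ dl x c d ∷ dl x d c ∷ Sg (dl x) R ∷ []) (# 0 :+ (# 1 :+ # 2 :+ (# 3 :+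
          # 4 :+ # 5)) :+ κ 0 :+ κ 0 :+ κ 0 :+ κ 0 :+ κ 0) (κ 0 :+ # 0 :+ # 1 :+ # 2 :+ # 3 :+ # 4 :+ # 5))))))))
        (λ f → via= (sym (eq f))
          (lin (sw f a b ∷ sw f c d ∷ S f T ∷ Sg f R ∷ []) (# 0 :+ # 1 :+ # 2) (# 2 :+ (# 0 :+ (# 1 :+ # 3)))))
    ... | T′ , vT′ , eq′ = T′ , vT′ , λ f → via≡ (eq′ f) (via≡ (eq f) (via≡ (sym (total f))
      (lin≡ (S f T′ ∷ S f T ∷ sw f x a + sw f x b + (sw f x c + sw f x d) ∷ sw f a b ∷ sw f c d ∷ Sg f R ∷ sw f u v
      + Sg f E₁ ∷ []) (# 0 :+ (# 1 :+ # 2) :+ (# 3 :+ (# 4 :+ # 5)) :+ # 6) (# 6 :+ (# 0 :+ (# 3 :+ # 4)) :+ # 1 :+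
      (# 2 :+ # 5)))))
    reduce : Quartic E → Decomposed E
    reduce (quartic x x≢r dg≤4 act loops) with find-star x E loops
    ... | star ns R total n≢ R≢ len = go ns n≢ total len (via four (via= deg
      (lin (δ u x + δ v x + Sg (dl x) E₁ ∷ length ns ∷ []) (κ 4 :+ # 0 :+ # 1) (# 1 :+ κ 4 :+ # 0)))) (via dg≤4
      (via= (sym deg) (lin (length ns ∷ δ u x + δ v x + Sg (dl x) E₁ ∷ []) (# 0 :+ κ 4 :+ # 1) (κ 4 :+ # 1 :+
      # 0))))
      where
      deg : dg E x ≡ length ns
      deg = via≡ (total (dl x)) (via≡ (dg-stars x ns n≢) (via≡ (dg-rest x R R≢)
        (lin≡ (δ u x + δ v x + Sg (dl x) E₁ ∷ stars (dl x) x ns ∷ Sg (dl x) R ∷ length ns ∷ []) (# 0 :+ (# 1 :+ # 2)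
        :+ # 3 :+ κ 0) (# 3 :+ # 0 :+ # 1 :+ # 2))))
      four : 4 ≤ dg E x
      four = ≤-trans (conn (only x) (≟-off (λ e → x≢r (sym e))) x (≟-on x) act) (only≤dg x E)
      go : ∀ ns → All (_≢ x) ns → (∀ f → Sg f E ≡ stars f x ns + Sg f R) → length E ≡ length ns + length R →
        4 ≤ length ns → length ns ≤ 4 → Decomposed E
      go (a ∷ b ∷ c ∷ d ∷ []) (a≢ ∷ b≢ ∷ c≢ ∷ d≢ ∷ []) total len _ _ with split-conn (spokes {E} {x} {a} {b} {c} {d}
        {R} conn x≢r a≢ b≢ c≢ d≢ R≢ (λ f → via≡ (total f)
        (lin≡ (sw f u v + Sg f E₁ ∷ sw f x a ∷ sw f x b ∷ sw f x c ∷ sw f x d ∷ Sg f R ∷ []) (# 0 :+ (# 1 :+ (# 2 :+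
        (# 3 :+ (# 4 :+ κ 0))) :+ # 5)) (# 1 :+ # 2 :+ (# 3 :+ # 4) :+ # 5 :+ # 0))))
      ... | inj₁ conn′ = split-off x≢r a≢ b≢ c≢ d≢ R≢ (λ f → via≡ (total f)
        (lin≡ (sw f u v + Sg f E₁ ∷ sw f x a ∷ sw f x b ∷ sw f x c ∷ sw f x d ∷ Sg f R ∷ []) (# 0 :+ (# 1 :+ (# 2 :+
        (# 3 :+ (# 4 :+ κ 0))) :+ # 5)) (# 1 :+ # 2 :+ (# 3 :+ # 4) :+ # 5 :+ # 0))) len conn′
      ... | inj₂ conn′ = split-off x≢r a≢ c≢ b≢ d≢ R≢ (λ f → via≡ (total f)
        (lin≡ (sw f u v + Sg f E₁ ∷ sw f x a ∷ sw f x b ∷ sw f x c ∷ sw f x d ∷ Sg f R ∷ []) (# 0 :+ (# 1 :+ (# 2 :+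
        (# 3 :+ (# 4 :+ κ 0))) :+ # 5)) (# 1 :+ # 3 :+ (# 2 :+ # 4) :+ # 5 :+ # 0))) len conn′
      go [] _ _ _ () _
      go (_ ∷ []) _ _ _ (s≤s ()) _
      go (_ ∷ _ ∷ []) _ _ _ (s≤s (s≤s ())) _
      go (_ ∷ _ ∷ _ ∷ []) _ _ _ (s≤s (s≤s (s≤s ()))) _
      go (_ ∷ _ ∷ _ ∷ _ ∷ _ ∷ _) _ _ _ _ (s≤s (s≤s (s≤s (s≤s ()))))

-- Realisation by edge sets

open import Defs

module Transfer (G : Graph) (r : V G) where
  open Chains (n G)
  open Rooted (n G) r
  open UpOK using (good; simpleˡ; simpleʳ)

  -- Walks read from one end to the other, as the vertex and edge sequences of a trail require.
  data Straight : Set where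
    walk : Bool → V G → V G → List (V G) → Straight
    one  : V G → V G → Straight

  chain : Straight → Chain
  chain (walk up c d B) = walk up c [] d B
  chain (one u v)       = one u v

  straighten : Bool → V G → List (V G) → V G → List (V G) → Straight
  straighten up c []      d B = walk up c d B
  straighten up c (a ∷ A) d B = straighten up a A c (d ∷ B)

  straighten⟿ : ∀ up c A d B → [ walk up c A d B ] ⟿ [ chain (straighten up c A d B) ]
  straighten⟿ up c []      d B = ⟿-refl
  straighten⟿ up c (a ∷ A) d B = ⟿-trans (flip⟿ up c (a ∷ A) d B)
    (⟿-trans (shift⟿ up d B c a A) (⟿-trans (flip⟿ up c (d ∷ B) a A) (straighten⟿ up a A c (d ∷ B))))

  row : List Straight → Seq
  row []       = ε
  row (C ∷ Cs) = [ chain C ] ⋄ row Cs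

  row-++ : ∀ Cs Ds → row Cs ⋄ row Ds ⟿ row (Cs ++ Ds)
  row-++ [] Ds = mk⟿ (λ f → refl) λ {h} {k} (_ , o) → Valid-≤ (row Ds) (λ v → lin (h v ∷ []) (# 0 :+ κ 0) (# 0)) (λ
    v → ≤-refl) o
  row-++ (C ∷ Cs) Ds = ⟿-trans (⋄-assoc [ chain C ] (row Cs) (row Ds)) (⋄-cong ⟿-refl (row-++ Cs Ds))

  flatten : ∀ T → Σ (List Straight) λ Cs → T ⟿ row Cs
  flatten ε                   = [] , ⟿-refl
  flatten [ walk up c A d B ] = straighten up c A d B ∷ [] , ⟿-trans (straighten⟿ up c A d B) (⋄-εʳ _)
  flatten [ one u v ]         = one u v ∷ [] , ⋄-εʳ _
  flatten (P ⋄ Q) with flatten P | flatten Q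
  ... | Cs , p | Ds , q = Cs ++ Ds , ⟿-trans (⋄-cong p q) (row-++ Cs Ds)

  steps : V G → List (V G) → Edges
  steps c []      = []
  steps c (d ∷ B) = (c , d) ∷ steps d B

  slots : Straight → Edges
  slots (walk _ c d B) = steps c (d ∷ B)
  slots (one u v)      = (u , v) ∷ []

  Sg-steps : ∀ f c B → Sg f (steps c B) ≡ wlk f c B
  Sg-steps f c []      = refl
  Sg-steps f c (d ∷ B) = cong (sw f c d +_) (Sg-steps f d B)

  Sg-slots : ∀ f C → Sg f (slots C) ≡ S f [ chain C ]
  Sg-slots f (walk _ c d B) = Sg-steps f c (d ∷ B)
  Sg-slots f (one u v)      = lin≡ (sw f u v ∷ []) (# 0 :+ κ 0) (# 0)

  -- Matching the edges of the graph to the chains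

  edges : List (E G) → Edges
  edges = map (ends G)

  Realises : List (E G) → Edges → Set
  Realises = Pointwise (λ e (u , v) → Joins G e u v)

  joined : ∀ u v es → 1 ≤ Sg (ind u v) (edges es) → Σ (E G) λ e → Σ (List (E G)) λ es′ → Joins G e u v × e ∷ es′ ↭
    es
  joined u v (e ∷ es) i with sw-ind u v (proj₁ (ends G e)) (proj₂ (ends G e))
  ... | inj₁ s = e , es , joins s , ↭-refl
    where
    joins : Same (proj₁ (ends G e)) (proj₂ (ends G e)) u v → Joins G e u v
    joins same = inj₁ refl
    joins swap = inj₂ refl
  ... | inj₂ z with joined u v es (via i (via= z
    (lin (ind u v (proj₁ (ends G e)) (proj₂ (ends G e)) + ind u v (proj₂ (ends G e)) (proj₁ (ends G e)) ∷ Sg (ind u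
    v) (map (ends G) es) ∷ []) (κ 1 :+ (# 0 :+ # 1) :+ κ 0) (# 1 :+ κ 1 :+ # 0))))
  ... | e′ , es′ , j , p = e′ , e ∷ es′ , j , ↭-trans (swap↭ e′ e refl) (prep e p)

  Sg-↭ : ∀ f {es es′} → es ↭ es′ → Sg f (edges es) ≡ Sg f (edges es′)
  Sg-↭ f {es} {es′} p = trans (asum es) (trans (sum-↭ (map⁺ g p)) (sym (asum es′)))
    where
    g : E G → ℕ
    g e = sw f (proj₁ (ends G e)) (proj₂ (ends G e))
    asum : ∀ es → Sg f (edges es) ≡ sum (map g es)
    asum []       = refl
    asum (e ∷ es) = cong (g e +_) (asum es)

  sw-joins : ∀ f {e u v} → Joins G e u v → sw f (proj₁ (ends G e)) (proj₂ (ends G e)) ≡ sw f u v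
  sw-joins f (inj₁ p) rewrite p = refl
  sw-joins f {e} {u} {v} (inj₂ p) rewrite p = lin≡ (f v u ∷ f u v ∷ []) (# 0 :+ # 1) (# 1 :+ # 0)

  -- `R` is the weight of the chains still to be served. The edges left over keep exactly these
  -- weights, so the greedy choice never gets stuck.
  assign : ∀ (R : Weight → ℕ) ss es → (∀ f → Sg f ss + R f ≡ Sg f (edges es)) →
    Σ (List (E G)) λ es₁ → Σ (List (E G)) λ es₂ → Realises es₁ ss × es₁ ++ es₂ ↭ es × (∀ f → R f ≡ Sg f (edges es₂))
  assign R []             es eq = [] , es , [] , ↭-refl , eq
  assign R ((u , v) ∷ ss) es eq with joined u v es (via= (eq (ind u v)) (via (ind-refl u v)
    (lin (Sg (ind u v) (edges es) ∷ ind u v u v ∷ ind u v v u ∷ Sg (ind u v) ss ∷ R (ind u v) ∷ []) (κ 1 :+ # 0 :+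
    # 1) (# 0 :+ (# 1 :+ # 2 :+ # 3 :+ # 4) :+ κ 1))))
  ... | e , es′ , j , p with assign R ss es′ (λ f → via≡ (eq f) (via≡ (sym (Sg-↭ f p)) (via≡ (sw-joins f j)
    (lin≡ (Sg f ss ∷ R f ∷ Sg f (edges es) ∷ f (proj₁ (ends G e)) (proj₂ (ends G e)) + f (proj₂ (ends G e)) (proj₁
    (ends G e)) ∷ Sg f (map (ends G) es′) ∷ sw f u v ∷ []) (# 0 :+ # 1 :+ # 2 :+ (# 3 :+ # 4) :+ # 5) (# 4 :+ (# 5
    :+ # 0 :+ # 1) :+ # 2 :+ # 3)))))
  ... | es₁ , es₂ , q , p′ , eq′ = e ∷ es₁ , es₂ , j ∷ q , ↭-trans (prep e p′) p , eq′

  assign-all : ∀ Cs es → (∀ f → S f (row Cs) ≡ Sg f (edges es)) →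
    Σ (List (List (E G))) λ ess → Pointwise (λ C es → Realises es (slots C)) Cs ess × concat ess ↭ es
  assign-all []       []       eq = [] , [] , ↭-refl
  -- The constant weight counts every edge twice, so no edge is left over.
  assign-all []       (e ∷ es) eq with () ← eq (λ _ _ → 1)
  assign-all (C ∷ Cs) es eq with assign (λ f → S f (row Cs)) (slots C) es (λ f → via≡ (Sg-slots f C) (via≡ (eq f)
    (lin≡ (Sg f (slots C) ∷ S f (row Cs) ∷ S f [ chain C ] ∷ Sg f (edges es) ∷ []) (# 0 :+ # 1 :+ # 2 :+ # 3) (# 3
    :+ # 0 :+ (# 2 :+ # 1)))))
  ... | es₁ , es₂ , q , p , eq′ with assign-all Cs es₂ eq′
  ... | ess , qs , p′ = es₁ ∷ ess , q ∷ qs , ↭-trans (++⁺ˡ es₁ p′) p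

  -- Degrees in the earlier and the later chains

  before after : (Cs : List Straight) → Fin (length Cs) → Ctx
  before (C ∷ Cs) zero    v = 0
  before (C ∷ Cs) (suc i) v = D [ chain C ] v + before Cs i v
  after  (C ∷ Cs) zero    v = D (row Cs) v
  after  (C ∷ Cs) (suc i) v = after Cs i v

  chain-at : ∀ {h k} Cs i → Valid h (row Cs) k → OK (λ v → h v + before Cs i v) (chain (lookup Cs i)) (λ v → after
    Cs i v + k v)
  chain-at {h} {k} (C ∷ Cs) zero (o , _) = OK-mono (chain C) (λ v _ → lin (h v ∷ []) (# 0) (# 0 :+ κ 0)) (λ v _ →
    ≤-refl) o
  chain-at {h} {k} (C ∷ Cs) (suc i) (_ , o) = OK-mono (chain (lookup Cs i)) (λ v _ →
    lin (h v ∷ D [ chain C ] v ∷ before Cs i v ∷ []) (# 0 :+ # 1 :+ # 2) (# 0 :+ (# 1 :+ # 2))) (λ v _ → ≤-refl)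
    (chain-at Cs i o)

  -- With `φ` selecting the positions below or above that of a chain, this becomes the degree in the
  -- union of the earlier or later chains, computed chain by chain.
  blocks : (ℕ → Bool) → List ℕ → ℕ
  blocks φ []       = 0
  blocks φ (b ∷ bs) = (if φ 0 then b else 0) + blocks (φ ∘ suc) bs

  masked : (E G → Bool) → (E G → ℕ) → List (E G) → ℕ
  masked χ w es = sum (map (λ e → if χ e then w e else 0) es)

  masked-const : ∀ χ w b es → (∀ {e} → e ∈ es → χ e ≡ b) → masked χ w es ≡ (if b then sum (map w es) else 0)
  masked-const χ w true  []       p = refl
  masked-const χ w false []       p = refl
  masked-const χ w true  (e ∷ es) p rewrite p (here refl) = cong (w e +_) (masked-const χ w true es (p ∘ there))
  masked-const χ w false (e ∷ es) p rewrite p (here refl) = masked-const χ w false es (p ∘ there)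

  masked-++ : ∀ χ w es es′ → masked χ w (es ++ es′) ≡ masked χ w es + masked χ w es′
  masked-++ χ w []       es′ = refl
  masked-++ χ w (e ∷ es) es′ = via≡ (masked-++ χ w es es′)
    (lin≡ ((if χ e then w e else 0) ∷ masked χ w (es ++ es′) ∷ masked χ w es ∷ masked χ w es′ ∷ []) (# 0 :+ # 1 :+
    (# 2 :+ # 3)) (# 0 :+ # 2 :+ # 3 :+ # 1))

  masked-blocks : ∀ χ w φ ess → (∀ {e} (p : Any (e ∈_) ess) → χ e ≡ φ (toℕ (index p))) →
    masked χ w (concat ess) ≡ blocks φ (map (λ es → sum (map w es)) ess)
  masked-blocks χ w φ []         eq = refl
  masked-blocks χ w φ (es ∷ ess) eq = trans (masked-++ χ w es (concat ess))
    (cong₂ _+_ (masked-const χ w (φ 0) es (λ p → eq (here p))) (masked-blocks χ w (φ ∘ suc) ess (λ p → eq (there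
      p))))

  endsAt-δ : ∀ e v → endsAt G e v ≡ δ (proj₁ (ends G e)) v + δ (proj₂ (ends G e)) v
  endsAt-δ e v with ends G e
  ... | a , b = sym (cong₂ _+_ (δ-def a v) (δ-def b v))

  Sg-realises : ∀ {es ss} v → Realises es ss → sum (map (λ e → endsAt G e v) es) ≡ dg ss v
  Sg-realises v []                 = refl
  Sg-realises v (_∷_ {e} {u , w} j js) = cong₂ _+_ (trans (endsAt-δ e v) (sw-joins (dl v) j)) (Sg-realises v js)

  block-sums : V G → List (List (E G)) → List ℕ
  block-sums v = map (λ es → sum (map (λ e → endsAt G e v) es))

  Matched : List Straight → List (List (E G)) → Set
  Matched = Pointwise (λ C es → Realises es (slots C))

  block : ∀ C {es} v → Realises es (slots C) → sum (map (λ e → endsAt G e v) es) ≡ D [ chain C ] v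
  block C v q = trans (Sg-realises v q) (Sg-slots (dl v) C)

  blocks-none : ∀ {φ} → (∀ j → φ j ≡ false) → ∀ bs → blocks φ bs ≡ 0
  blocks-none p []       = refl
  blocks-none p (b ∷ bs) rewrite p 0 = blocks-none (p ∘ suc) bs

  blocks-all : ∀ {φ Cs ess} v → (∀ j → φ j ≡ true) → Matched Cs ess → blocks φ (block-sums v ess) ≡ D (row Cs) v
  blocks-all v p []       = refl
  blocks-all {Cs = C ∷ _} v p (q ∷ qs) rewrite p 0 = cong₂ _+_ (block C v q) (blocks-all v (p ∘ suc) qs)

  blocks-before : ∀ {Cs ess} v → Matched Cs ess → ∀ i → blocks (_<ᵇ toℕ i) (block-sums v ess) ≡ before Cs i v
  blocks-before {ess = _ ∷ ess} v (q ∷ qs) zero = blocks-none (λ j → refl) (block-sums v ess)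
  blocks-before {C ∷ _} v (q ∷ qs) (suc i) = cong₂ _+_ (block C v q) (blocks-before v qs i)

  blocks-after : ∀ {Cs ess} v → Matched Cs ess → ∀ i → blocks (toℕ i <ᵇ_) (block-sums v ess) ≡ after Cs i v
  blocks-after v (q ∷ qs) zero    = blocks-all v (λ j → refl) qs
  blocks-after v (q ∷ qs) (suc i) = blocks-after v qs i

  deg-blocks : ∀ {ess} χ φ v → concat ess ↭ allFin (m G) → (∀ {e} (p : Any (e ∈_) ess) → χ e ≡ φ (toℕ (index p))) →
    deg G χ v ≡ blocks φ (block-sums v ess)
  deg-blocks {ess} χ φ v p eq = trans (sym (sum-↭ (map⁺ (λ e → if χ e then endsAt G e v else 0) p))) (masked-blocks
    χ (λ e → endsAt G e v) φ ess eq)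

  disjoint : ∀ {A : Set} (xs ys : List A) → Unique (xs ++ ys) → ∀ {x} → x ∈ xs → x ∉ ys
  disjoint (x ∷ xs) ys (p ∷ u) (here refl) q = All.lookup p (∈-++⁺ʳ xs q) refl
  disjoint (x ∷ xs) ys (p ∷ u) (there i)   q = disjoint xs ys u i q

  unique-++ : ∀ {A : Set} (xs ys : List A) → Unique (xs ++ ys) → Unique ys
  unique-++ []       ys u       = u
  unique-++ (x ∷ xs) ys (_ ∷ u) = unique-++ xs ys u

  unique-++ˡ : ∀ {A : Set} (xs ys : List A) → Unique (xs ++ ys) → Unique xs
  unique-++ˡ []       ys u       = []
  unique-++ˡ (x ∷ xs) ys (p ∷ u) = All.tabulate (λ i → All.lookup p (∈-++⁺ˡ i)) ∷ unique-++ˡ xs ys u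

  index-unique : ∀ {A : Set} {x : A} xss → Unique (concat xss) → (p q : Any (x ∈_) xss) → index p ≡ index q
  index-unique (xs ∷ xss) u (here p)  (here q)  = refl
  index-unique (xs ∷ xss) u (here p)  (there q) = ⊥-elim (disjoint xs (concat xss) u p (∈-concat⁺ q))
  index-unique (xs ∷ xss) u (there p) (here q)  = ⊥-elim (disjoint xs (concat xss) u q (∈-concat⁺ p))
  index-unique (xs ∷ xss) u (there p) (there q) = cong suc (index-unique xss (unique-++ xs (concat xss) u) p q)

  unique-at : ∀ {A : Set} xss → Unique (concat {A = A} xss) → ∀ i → Unique (lookup xss i)
  unique-at (xs ∷ xss) u zero    = unique-++ˡ xs (concat xss) u
  unique-at (xs ∷ xss) u (suc i) = unique-at xss (unique-++ xs (concat xss) u) i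

  any-at : ∀ {A : Set} {x : A} xss i → x ∈ lookup xss i → Σ (Any (x ∈_) xss) λ p → index p ≡ i
  any-at (xs ∷ xss) zero    p = here p , refl
  any-at (xs ∷ xss) (suc i) p with any-at xss i p
  ... | q , e = there q , cong suc e

  at-any : ∀ {A : Set} {x : A} {xss} (p : Any (x ∈_) xss) → x ∈ lookup xss (index p)
  at-any (here p)  = p
  at-any (there p) = at-any p

  incident : ∀ H v → 1 ≤ deg G H v → InSub G H v
  incident H v i = go (allFin (m G)) i
    where
    go : ∀ es → 1 ≤ masked H (λ e → endsAt G e v) es → InSub G H v
    go (e ∷ es) i with H e in He
    ... | false = go es i
    ... | true with 1≤-split (endsAt G e v)
    ... | inj₁ z = go es (via i (via= z
      (lin (endsAt G e v ∷ masked H (λ e → endsAt G e v) es ∷ []) (κ 1 :+ (# 0 :+ # 1) :+ κ 0) (# 1 :+ κ 1 :+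
      # 0))))
    ... | inj₂ j = e , He , hit (via j (via= (endsAt-δ e v)
      (lin (endsAt G e v ∷ δ (proj₁ (ends G e)) v + δ (proj₂ (ends G e)) v ∷ []) (κ 1 :+ # 0 :+ # 1) (# 1 :+ κ 1 :+
      # 0))))
      where
      hit : 1 ≤ δ (proj₁ (ends G e)) v + δ (proj₂ (ends G e)) v → Σ (V G) λ w → Joins G e v w
      hit j with δ-split (proj₁ (ends G e)) v | δ-split (proj₂ (ends G e)) v
      ... | inj₁ p | _ = proj₂ (ends G e) , inj₁ (cong (_, proj₂ (ends G e)) p)
      ... | _ | inj₁ p = proj₁ (ends G e) , inj₂ (cong (proj₁ (ends G e) ,_) p)
      ... | inj₂ p | inj₂ q = absurd (via j (via= p (via= q
        (lin (δ (proj₁ (ends G e)) v ∷ δ (proj₂ (ends G e)) v ∷ []) (κ 1 :+ κ 0 :+ (# 0 :+ # 1) :+ κ 0 :+ κ 0) (κ 0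
        :+ κ 1 :+ # 0 :+ # 1)))))

  Good-base : ∀ H v → 2 ≤ base v + deg G H v → Good G r H v
  Good-base H v i with δ-split r v
  ... | inj₁ p = inj₁ (sym p)
  ... | inj₂ z = inj₂ (via i (via= z (via= z
    (lin (δ r v ∷ deg G H v ∷ []) (κ 2 :+ (# 0 :+ # 0 :+ # 1) :+ κ 0 :+ κ 0) (# 1 :+ κ 2 :+ # 0 :+ # 0)))))

  In-base : ∀ H v → 1 ≤ base v + deg G H v → v ≡ r ⊎ InSub G H v
  In-base H v i with δ-split r v
  ... | inj₁ p = inj₁ (sym p)
  ... | inj₂ z = inj₂ (incident H v (via i (via= z (via= z
    (lin (δ r v ∷ deg G H v ∷ []) (κ 1 :+ (# 0 :+ # 0 :+ # 1) :+ κ 0 :+ κ 0) (# 1 :+ κ 1 :+ # 0 :+ # 0))))))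

  -- Walks as paths and cycles of the graph

  edge-at : ∀ {es c} B → Realises es (steps c B) → Fin (length B) → E G
  edge-at (d ∷ B) (_∷_ {e} j js) zero    = e
  edge-at (d ∷ B) (j ∷ js)       (suc i) = edge-at B js i

  edge-joins : ∀ {es c} B (js : Realises es (steps c B)) i →
    Joins G (edge-at B js i) (lookup (c ∷ B) (inject₁ i)) (lookup (c ∷ B) (suc i))
  edge-joins (d ∷ B) (j ∷ js) zero    = j
  edge-joins (d ∷ B) (j ∷ js) (suc i) = edge-joins B js i

  edge-∈ : ∀ {es c} B (js : Realises es (steps c B)) i → edge-at B js i ∈ es
  edge-∈ (d ∷ B) (j ∷ js) zero    = here refl
  edge-∈ (d ∷ B) (j ∷ js) (suc i) = there (edge-∈ B js i)

  ∈-edge : ∀ {es c e} B (js : Realises es (steps c B)) → e ∈ es → Σ (Fin (length B)) λ i → edge-at B js i ≡ e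
  ∈-edge (d ∷ B) (j ∷ js) (here refl) = zero , refl
  ∈-edge (d ∷ B) (j ∷ js) (there p) with ∈-edge B js p
  ... | i , q = suc i , q

  edge-inj : ∀ {es c} B (js : Realises es (steps c B)) → Unique es → Injective _≡_ _≡_ (edge-at B js)
  edge-inj (d ∷ B) (j ∷ js) (p ∷ u) {zero}  {zero}  eq = refl
  edge-inj (d ∷ B) (j ∷ js) (p ∷ u) {zero}  {suc y} eq = ⊥-elim (All.lookup p (edge-∈ B js y) eq)
  edge-inj (d ∷ B) (j ∷ js) (p ∷ u) {suc x} {zero}  eq = ⊥-elim (All.lookup p (edge-∈ B js x) (sym eq))
  edge-inj (d ∷ B) (j ∷ js) (p ∷ u) {suc x} {suc y} eq = cong suc (edge-inj B js u eq)

  cnt-lookup : ∀ l j → 1 ≤ cnt l (lookup l j)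
  cnt-lookup (a ∷ l) zero = via= (sym (δ-refl a))
    (lin (δ a a ∷ cnt l (lookup (a ∷ l) zero) ∷ []) (κ 1 :+ # 0) (# 0 :+ # 1 :+ κ 1))
  cnt-lookup (a ∷ l) (suc j) = via (cnt-lookup l j)
    (lin (cnt l (lookup l j) ∷ δ a (lookup (a ∷ l) (suc j)) ∷ []) (κ 1 :+ # 0) (# 1 :+ # 0 :+ κ 1))

  lookup-inj : ∀ l → (∀ v → cnt l v ≤ 1) → Injective _≡_ _≡_ (lookup l)
  lookup-inj (a ∷ l) p {zero}  {zero}  eq = refl
  lookup-inj (a ∷ l) p {zero} {suc y} refl = absurd (via (p a) (via= (sym (δ-refl a)) (via (cnt-lookup l y)
    (lin (δ (lookup l y) (lookup l y) ∷ cnt l (lookup l y) ∷ []) (κ 1 :+ κ 0 :+ κ 1 :+ # 0 :+ # 1) (κ 0 :+ (# 0 :+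
    # 1) :+ κ 1 :+ κ 1)))))
  lookup-inj (a ∷ l) p {suc x} {zero} refl = absurd (via (p a) (via= (sym (δ-refl a)) (via (cnt-lookup l x)
    (lin (δ (lookup l x) (lookup l x) ∷ cnt l (lookup l x) ∷ []) (κ 1 :+ κ 0 :+ κ 1 :+ # 0 :+ # 1) (κ 0 :+ (# 0 :+
    # 1) :+ κ 1 :+ κ 1)))))
  lookup-inj (a ∷ l) p {suc x} {suc y} eq = cong suc (lookup-inj l (λ v → via (p v)
    (lin (cnt l v ∷ δ a v ∷ []) (# 0 :+ κ 1) (κ 1 :+ (# 1 :+ # 0)))) eq)

  lookup-end : ∀ c B → lookup (c ∷ B) (fromℕ (length B)) ≡ end c B
  lookup-end c []      = refl
  lookup-end c (d ∷ B) = lookup-end d B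

  -- A position before the last one counts its own vertex, and the last position counts it once more
  -- if the two vertices agree.
  cnt-inject : ∀ c B j → 1 + δ (end c B) (lookup (c ∷ B) (inject₁ j)) ≤ cnt (c ∷ B) (lookup (c ∷ B) (inject₁ j))
  cnt-inject c (d ∷ B) zero = via= (sym (δ-refl c)) (via (cn-end d B c)
    (lin (δ (end c (d ∷ B)) (lookup (c ∷ d ∷ B) (inject₁ zero)) ∷ δ c c ∷ δ d c + cnt B c ∷ []) (κ 1 :+ # 0 :+ # 1
    :+ # 2) (# 1 :+ # 2 :+ κ 1 :+ # 0)))
  cnt-inject c (d ∷ B) (suc j) = via (cnt-inject d B j)
    (lin (δ (end c (d ∷ B)) (lookup (c ∷ d ∷ B) (inject₁ (suc j))) ∷ δ d (lookup (d ∷ B) (inject₁ j)) + cnt B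
    (lookup (d ∷ B) (inject₁ j)) ∷ δ c (lookup (c ∷ d ∷ B) (inject₁ (suc j))) ∷ []) (κ 1 :+ # 0 :+ # 1) (# 2 :+ # 1
    :+ (κ 1 :+ # 0)))

  inject-inj : ∀ c B → (∀ v → cnt (c ∷ B) v ≤ 1 + δ (end c B) v) → Injective _≡_ _≡_ (λ i → lookup (c ∷ B) (inject₁
    i))
  inject-inj c (d ∷ B) p {zero}  {zero}  eq = refl
  inject-inj c (d ∷ B) p {zero}  {suc y} eq = absurd (via (p c) (via= (sym (δ-refl c))
    (via (subst (λ v → 1 + δ (end d B) v ≤ cnt (d ∷ B) v) (sym eq) (cnt-inject d B y))
      (lin (δ (end c (d ∷ B)) c ∷ δ c c ∷ δ d (lookup (c ∷ d ∷ B) (inject₁ zero)) + cnt B (lookup (c ∷ d ∷ B)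
      (inject₁ zero)) ∷ []) (κ 1 :+ κ 0 :+ (κ 1 :+ # 0) :+ # 1 :+ # 2) (κ 0 :+ (# 1 :+ # 2) :+ κ 1 :+ (κ 1 :+
      # 0))))))
  inject-inj c (d ∷ B) p {suc x} {zero}  eq = absurd (via (p c) (via= (sym (δ-refl c))
    (via (subst (λ v → 1 + δ (end d B) v ≤ cnt (d ∷ B) v) eq (cnt-inject d B x))
      (lin (δ (end c (d ∷ B)) c ∷ δ c c ∷ δ d (lookup (c ∷ d ∷ B) (inject₁ zero)) + cnt B (lookup (c ∷ d ∷ B)
      (inject₁ zero)) ∷ []) (κ 1 :+ κ 0 :+ (κ 1 :+ # 0) :+ # 1 :+ # 2) (κ 0 :+ (# 1 :+ # 2) :+ κ 1 :+ (κ 1 :+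
      # 0))))))
  inject-inj c (d ∷ B) p {suc x} {suc y} eq = cong suc (inject-inj d B (λ v → via (p v)
    (lin (δ d v + cnt B v ∷ δ (end c (d ∷ B)) v ∷ δ c v ∷ []) (# 0 :+ (κ 1 :+ # 1)) (κ 1 :+ # 1 :+ (# 2 :+ # 0))))
    eq)

  module _ {χ : EdgeSet G} {es : List (E G)} (unique : Unique es) (member : ∀ e → (χ e ≡ true) ⇔ (e ∈ es))
    (H K : EdgeSet G) where
    open Equivalence using (to; from)

    trail : ∀ c B → Realises es (steps c B) → Trail G χ (length B)
    trail c B js = record
      { ws      = lookup (c ∷ B)
      ; es      = edge-at B js
      ; es-inj  = edge-inj B js unique
      ; es-join = edge-joins B js
      ; es-set = λ e → mk⇔ (λ p → ∈-edge B js (to (member e) p)) (λ { (i , refl) → from (member e) (edge-∈ B js i)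
        })
      }

    up-chain : ∀ c d B → Realises es (steps c (d ∷ B)) →
      UpOK (λ v → base v + deg G H v) (λ v → base v + deg G K v) c [] d B → UpChain G r H K χ
    -- Only here paths and cycles part: the bounds of `UpOK` leave room for a repeated vertex only
    -- if the two ends agree.
    up-chain c d B js o with c ≟ end d B
    ... | no ne = path
      (record { L = length B ; trail = trail c (d ∷ B) js ; ws-inj = lookup-inj (c ∷ d ∷ B) simple })
      (λ j → Good-base K _ (good o _ (via (cnt-lookup (c ∷ d ∷ B) j)
        (lin (δ c (lookup (c ∷ d ∷ B) j) ∷ δ d (lookup (c ∷ d ∷ B) j) + cnt B (lookup (c ∷ d ∷ B) j) ∷ []) (κ 1 :+
        (# 0 :+ # 1)) (# 0 :+ κ 0 :+ # 1 :+ κ 1)))))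
      (In-base H c (via (UpOK.ends o c) (via= (sym (δ-refl c))
        (lin (δ r c + δ r c + deg G H c ∷ δ c c ∷ δ (end d B) c ∷ []) (κ 1 :+ # 0 :+ # 1) (# 0 :+ (# 1 :+ # 2) :+
        κ 1)))))
      (subst (λ v → v ≡ r ⊎ InSub G H v) (sym (lookup-end c (d ∷ B)))
        (In-base H (end d B) (via (UpOK.ends o (end d B)) (via= (sym (δ-refl (end d B)))
          (lin (δ r (end d B) + δ r (end d B) + deg G H (end d B) ∷ δ (end d B) (end d B) ∷ δ c (end d B) ∷ []) (κ 1
          :+ # 0 :+ # 1) (# 0 :+ (# 2 :+ # 1) :+ κ 1))))))
      where
      simple : ∀ v → cnt (c ∷ d ∷ B) v ≤ 1
      simple v with δ-split c v
      ... | inj₁ refl = via (simpleʳ o c) (via= (δ-≢ (λ e → ne (sym e)))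
        (lin (δ v v ∷ δ d v + cnt B v ∷ δ (end d B) v ∷ []) (# 0 :+ # 1 :+ (κ 1 :+ # 2) :+ κ 0) (κ 1 :+ (# 0 :+ κ 0
        :+ # 1) :+ # 2)))
      ... | inj₂ z = via (simpleˡ o v) (via= z
        (lin (δ c v ∷ δ d v + cnt B v ∷ []) (# 0 :+ # 1 :+ (κ 1 :+ # 0) :+ κ 0) (κ 1 :+ (# 0 :+ κ 0 :+ # 1) :+
        # 0)))
    ... | yes e = cycle
      (record { L = length B ; trail = trail c (d ∷ B) js ; closed = trans (lookup-end c (d ∷ B)) (sym e)
              ; ws-inj = inject-inj c (d ∷ B) (λ v → via (simpleʳ o v)
                (lin (δ c v ∷ δ d v + cnt B v ∷ δ (end d B) v ∷ []) (# 0 :+ # 1 :+ (κ 1 :+ # 2)) (κ 1 :+ # 2 :+ (# 0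
                :+ κ 0 :+ # 1)))) })
      (λ j → Good-base K _ (good o _ (via (cnt-lookup (c ∷ d ∷ B) j)
        (lin (δ c (lookup (c ∷ d ∷ B) j) ∷ δ d (lookup (c ∷ d ∷ B) j) + cnt B (lookup (c ∷ d ∷ B) j) ∷ []) (κ 1 :+
        (# 0 :+ # 1)) (# 0 :+ κ 0 :+ # 1 :+ κ 1)))))
      -- At the base of the cycle both ends are counted, so `ends` yields earlier degree two.
      (zero , Good-base H c (via (UpOK.ends o c) (via= (sym (δ-refl c)) (via= (sym (δ-≡ (sym e)))
        (lin (δ r c + δ r c + deg G H c ∷ δ c c ∷ δ (end d B) c ∷ []) (κ 2 :+ # 0 :+ # 1 :+ # 2) (# 0 :+ (# 1 :+
        # 2) :+ κ 1 :+ κ 1))))))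

  matched-at : ∀ {Cs ess} → Matched Cs ess → ∀ (i : Fin (length ess)) →
    Σ (Fin (length Cs)) λ j → toℕ j ≡ toℕ i × Realises (lookup ess i) (slots (lookup Cs j))
  matched-at (q ∷ qs) zero = zero , refl , q
  matched-at (q ∷ qs) (suc i) with matched-at qs i
  ... | j , e , p = suc j , cong suc e , p

  assemble : ∀ Cs es ess → Matched Cs (es ∷ ess) → concat (es ∷ ess) ↭ allFin (m G) → Valid base (row Cs) base →
    ChainDecomposition G r
  -- The numbering starts at zero, so the last index is the length of the tail.
  assemble Cs es₀ ess₀ qs perm valid = length ess₀ , idx , chains
    where
    ess = es₀ ∷ ess₀
    unique : Unique (concat ess)
    unique = Permₛ.Unique-resp-↭ (setoid (E G)) (↭⇒↭ₛ (↭-sym perm)) (allFin⁺ (m G))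
    place : ∀ e → Any (e ∈_) ess
    place e = ∈-concat⁻ ess (∈-resp-↭ (↭-sym perm) (∈-allFin e))
    idx : E G → Fin (length ess)
    idx e = index (place e)
    idx≡ : ∀ {e} (p : Any (e ∈_) ess) → idx e ≡ index p
    idx≡ {e} p = index-unique ess unique (place e) p
    member : ∀ i e → (⌊ idx e ≟ i ⌋ ≡ true) ⇔ (e ∈ lookup ess i)
    member i e = mk⇔ fwd bwd
      where
      fwd : ⌊ idx e ≟ i ⌋ ≡ true → e ∈ lookup ess i
      fwd p with idx e ≟ i
      ... | yes refl = at-any (place e)
      bwd : e ∈ lookup ess i → ⌊ idx e ≟ i ⌋ ≡ true
      bwd p with any-at ess i p
      ... | q , refl rewrite idx≡ q = ≟-on (index q)
    chains : ∀ i → IsChain G r (λ e → toℕ (idx e) <ᵇ toℕ i) (λ e → toℕ i <ᵇ toℕ (idx e)) (λ e → ⌊ idx e ≟ i ⌋)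
    chains i with matched-at qs i
    ... | j , j≡i , js = shape (lookup Cs j) js (OK-mono (chain (lookup Cs j)) (λ v _ → lo v) (λ v _ → hi v)
      (chain-at Cs j valid))
      where
      H K χ : EdgeSet G
      H e = toℕ (idx e) <ᵇ toℕ i
      K e = toℕ i <ᵇ toℕ (idx e)
      χ e = ⌊ idx e ≟ i ⌋
      lo : ∀ v → base v + before Cs j v ≤ base v + deg G H v
      lo v = via= (trans (sym (blocks-before v qs j)) (trans (cong (λ t → blocks (_<ᵇ t) (block-sums v ess)) j≡i)
        (sym (deg-blocks H (_<ᵇ toℕ i) v perm (λ p → cong (λ t → toℕ t <ᵇ toℕ i) (idx≡ p))))))
          (lin (δ r v + δ r v ∷ before Cs j v ∷ deg G H v ∷ []) (# 0 :+ # 1 :+ # 2) (# 0 :+ # 2 :+ # 1))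
      hi : ∀ v → after Cs j v + base v ≤ base v + deg G K v
      hi v = via= (trans (sym (blocks-after v qs j)) (trans (cong (λ t → blocks (t <ᵇ_) (block-sums v ess)) j≡i)
        (sym (deg-blocks K (toℕ i <ᵇ_) v perm (λ p → cong (λ t → toℕ i <ᵇ toℕ t) (idx≡ p))))))
          (lin (after Cs j v ∷ δ r v + δ r v ∷ deg G K v ∷ []) (# 0 :+ # 1 :+ # 2) (# 1 :+ # 2 :+ # 0))
      shape : ∀ C → Realises (lookup ess i) (slots C) → OK (λ v → base v + deg G H v) (chain C) (λ v → base v + deg
        G K v) → IsChain G r H K χ
      shape (walk true c d B)  js o = inj₁ (up-chain (unique-at ess unique i) (member i) H K c d B js o)
      shape (walk false c d B) js o = inj₂ (inj₁ (up-chain (unique-at ess unique i) (member i) K H c d B js o))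
      shape (one u v)          js (p , q) = inj₂ (inj₂ (only-edge (lookup ess i) (member i) js))
        where
        open Equivalence using (to; from)
        only-edge : ∀ es → (∀ e → (χ e ≡ true) ⇔ (e ∈ es)) → Realises es ((u , v) ∷ []) → OneWayChain G r H K χ
        only-edge (e ∷ []) mem (j ∷ []) = e ,
          (λ f → mk⇔ (λ t → single (to (mem f) t)) (λ { refl → from (mem f) (here refl) })) ,
          u , v , j , Good-base H u p , Good-base K v q
          where
          single : ∀ {f} → f ∈ e ∷ [] → f ≡ e
          single (here p) = p

  -- From edge-connectivity to cuts

  other : ∀ {k} → 2 ≤ k → (s : Fin k) → Σ (Fin k) (_≢ s)
  other (s≤s (s≤s _)) zero    = suc zero , λ ()
  other (s≤s (s≤s _)) (suc _) = zero , λ ()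

  crossed : VertexSet → E G → Bool
  crossed X e = (X (proj₁ (ends G e)) ∧ not (X (proj₂ (ends G e)))) ∨ (X (proj₂ (ends G e)) ∧ not (X (proj₁ (ends G
    e))))

  crossed-ι : ∀ p q → (if (p ∧ not q) ∨ (q ∧ not p) then 1 else 0) ≡ ι (p ∧ not q) + ι (q ∧ not p)
  crossed-ι true  true  = refl
  crossed-ι true  false = refl
  crossed-ι false true  = refl
  crossed-ι false false = refl

  size-crossed : ∀ X es → sum (map (λ e → if crossed X e then 1 else 0) es) ≡ Sg (crs X) (edges es)
  size-crossed X []       = refl
  size-crossed X (e ∷ es) = cong₂ _+_ (crossed-ι (X (proj₁ (ends G e))) (X (proj₂ (ends G e)))) (size-crossed X es)

  uncrossed : ∀ p q → not ((p ∧ not q) ∨ (q ∧ not p)) ≡ true → p ≡ q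
  uncrossed true  true  _ = refl
  uncrossed false false _ = refl

  constant : ∀ X {u v} → Reach G (λ e → not (crossed X e)) u v → X u ≡ X v
  constant X here = refl
  constant X (step e p (inj₁ q) rs) = trans (trans (sym (cong (X ∘ proj₁) q)) (trans (uncrossed _ _ p) (cong (X ∘
    proj₂) q))) (constant X rs)
  constant X (step e p (inj₂ q) rs) = trans (trans (sym (cong (X ∘ proj₂) q)) (trans (sym (uncrossed _ _ p)) (cong
    (X ∘ proj₁) q))) (constant X rs)

  -- If fewer than four edges crossed `X`, deleting them would leave the graph connected, while
  -- membership in `X` is constant along walks that use no crossing edge.
  cut≥4 : EdgeConnected G 4 → ∀ X → X r ≡ false → ∀ v → X v ≡ true → 4 ≤ Sg (crs X) (edges (allFin (m G)))
  cut≥4 (_ , conn) X Xr v Xv with 4 ≤? Sg (crs X) (edges (allFin (m G)))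
  ... | yes p = p
  ... | no ¬p with () ← trans (sym Xv) (trans (constant X (conn (crossed X) (≤-trans (s≤s (≤-reflexive (size-crossed
    X (allFin (m G))))) (≰⇒> ¬p)) v r)) Xr)

  theorem : EdgeConnected G 4 → ChainDecomposition G r
  theorem ec with decompose _ (edges (allFin (m G))) ≤-refl (λ X Xr v Xv _ → cut≥4 ec X Xr v Xv)
  ... | T , vT , eq with flatten T
  ... | Cs , fl with assign-all Cs (allFin (m G)) (λ f → trans (sym (weight fl f)) (eq f))
  ... | es ∷ ess , qs , perm = assemble Cs es ess qs perm (valid fl vT)
  -- A decomposition consists of at least one chain; the empty sequence is excluded by the cut
  -- around a vertex other than `r`.
  ... | [] , [] , _ with other (proj₁ ec) r
  ...   | v , v≢r = absurd (via (cut≥4 ec (only v) (≟-off (λ e → v≢r (sym e))) v (≟-on v))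
            (via= (sym (eq (crs (only v)))) (via= (weight fl (crs (only v)))
              (lin (Sg (crs (only v)) (edges (allFin (m G))) ∷ S (crs (only v)) T ∷ []) (κ 1 :+ κ 0 :+ # 0 :+ # 1 :+
              κ 0) (κ 0 :+ κ 4 :+ # 0 :+ # 1)))))

theorem3 : (G : Graph) (r : V G) → EdgeConnected G 4 → ChainDecomposition G r
theorem3 G r = Transfer.theorem G r
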